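{- Let $n\ge 1$ and let $\sigma,\tau,\pi$ be elements of $\mathcal{D}_n$. Then $$\sum_{\substack{\sigma_1\in\mathcal{D}_n\\ \sigma\to\sigma_1}} t_{\sigma_1,\tau}^{\pi}\;=\;\sum_{\substack{\tau_1\in\mathcal{D}_n\\ \tau^*\to\tau_1^*}} t_{\sigma,\tau_1}^{\pi}.$$
   Context: **Words and diagrams.** $\mathcal{D}_n$ is the set of words $\sigma=\sigma_1\cdots\sigma_{2n}$ on the alphabet $\{0,1\}$ with $n$ zeros and $n$ ones such that each prefix contains at least as many $0$s as $1$s. A word is identified with a Ferrers diagram (English convention): its rows correspond to the letters $0$, the last $0$ giving the top row, and the row of a given $0$ has as many (left-justified) boxes as there are $1$s before this $0$. A word $\pi\in\mathcal D_n$ is also identified with the noncrossing perfect matching of $\{1,\dots,2n\}$ obtained by reading $0$ as an opening and $1$ as a closing parenthesis. The conjugate of $\sigma=\sigma_1\cdots\sigma_{2n}$ is $\sigma^*$ with $\sigma^*_i=1-\sigma_{2n+1-i}$. We write $\sigma\le\tau$ if the diagram of $\sigma$ is contained in that of $\tau$, and $\tau/\sigma$ is then the set of boxes of $\tau$ not in $\sigma$. We write $\sigma\to\tau$ if $\sigma\le\tau$ and $\tau/\sigma$ is a horizontal strip, i.e. has no two boxes in the same column (possibly $\sigma=\tau$). **The triangle.** $\mathcal{T}^n$ is the graph with vertices $(x,y)\in\mathbb{Z}^2$, $x\ge y\ge 0$, $x+y\le 4n-2$, with all unit horizontal and vertical edges between these vertices, together with $2n$ external (half-)edges: the $i$th one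 hangs vertically below the vertex $(2i-2,0)$, for $i=1,\dots,2n$. The left boundary vertices are $L_i=(i-1,i-1)$ and the right boundary vertices are $R_i=(2n-2+i,2n-i)$, $i=1,\dots,2n$ (so $L_{2n}=R_1$). **TFPL configurations.** For $\sigma,\tau,\pi\in\mathcal{D}_n$, $t_{\sigma,\tau}^\pi$ is the number of subgraphs (edge sets) $f$ of $\mathcal{T}^n$ such that: - all $2n$ external edges belong to $f$; - every vertex other than the $L_i$ and $R_i$ is incident to exactly two edges of $f$; - for $1\le i\le 2n-1$ the horizontal edge from $L_i$ to its right neighbour is in $f$; for $2\le i\le 2n$ the vertical edge just below $L_i$ is in $f$ if and only if $\sigma_i=0$; - for $2\le i\le 2n$ the horizontal edge from $R_i$ to its left neighbour is in $f$; for $1\le i\le 2n-1$ the vertical edge just below $R_i$ is in $f$ if and only if $\tau_i=1$; - the $n$ vertices $L_i$ with $\sigma_i=1$ are the starting points of $n$ paths of $f$ whose other endpoints are the $n$ vertices $R_j$ with $\tau_j=0$ (the path at the vertex $L_{2n}=R_1$ is reduced to this single vertex), and the external edges $i$ and $j$ are the two ends of the same path of $f$ if and only if $\{i,j\}$ is a pair of the matching $\pi$. Closed paths are allowed. -}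

module Defs where

open import Data.Fin as Fin using (Fin; toℕ; opposite)
open import Data.Fin.Patterns using (0F; 1F)
import Data.Fin.Properties as Fin
open import Data.List using (List; []; _∷_; [_]; _++_; _∷ʳ_; map; filter; length; concatMap;
  cartesianProduct; upTo; allFin; take; drop; inits; deduplicate)
open import Data.List.Membership.Propositional using (_∈_; _∉_; lose)
open import Data.List.Membership.Propositional.Properties using (∈-filter⁺; ∈-filter⁻; ∈-deduplicate⁺)
open import Data.List.Properties using (filter-notAll)
open import Data.List.Relation.Binary.Subset.Propositional using (_⊆_)
open import Data.List.Relation.Unary.All as All using (All)
open import Data.List.Relation.Unary.Any as Any using (Any; here; there; any?)
open import Data.List.Relation.Unary.AllPairs using (AllPairs; allPairs?)
open import Data.Nat using (ℕ; zero; suc; pred; _+_; _*_; _∸_; _≤_; _<_; _≟_; _≤?_; _<?_)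
open import Data.Nat.Properties using (≤-refl; ≤-trans; ≤-pred)
open import Data.Product using (∃-syntax; _×_; _,_; proj₁; proj₂)
open import Data.Product.Properties using (≡-dec)
open import Data.Sum using (_⊎_; inj₁; inj₂)
open import Data.Vec as Vec using (Vec; []; _∷_; lookup; toList)
open import Function using (_⇔_; mk⇔; Equivalence)
open import Relation.Binary.Definitions using (DecidableEquality)
open import Relation.Binary.PropositionalEquality using (_≡_; _≢_; refl; sym; cong)
open import Relation.Nullary using (¬_; Dec; yes; no; ¬?)
open import Relation.Nullary.Decidable using (map′; _×-dec_; _⊎-dec_; _→-dec_)

private
  _⇔-dec_ : {A B : Set} → Dec A → Dec B → Dec (A ⇔ B)
  a? ⇔-dec b? = map′ (λ (f , g) → mk⇔ f g) (λ e → Equivalence.to e , Equivalence.from e)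
                     ((a? →-dec b?) ×-dec (b? →-dec a?))

Letter : Set
Letter = Fin 2

-- The letter σ_i, for i = 1, …, 2n, is `lookup σ k` with toℕ k = i - 1.
Word : ℕ → Set
Word n = Vec Letter (2 * n)

count : Letter → List Letter → ℕ
count a w = length (filter (Fin._≟ a) w)

Prefixes≥ : List Letter → Set
Prefixes≥ w = All (λ p → count 1F p ≤ count 0F p) (inits w)

IsDyck : ℕ → List Letter → Set
IsDyck n w = count 0F w ≡ n × count 1F w ≡ n × Prefixes≥ w

IsDyck? : ∀ n w → Dec (IsDyck n w)
IsDyck? n w = (count 0F w ≟ n) ×-dec (count 1F w ≟ n)
  ×-dec All.all? (λ p → count 1F p ≤? count 0F p) (inits w)

Dyck : ∀ n → Word n → Set
Dyck n w = IsDyck n (toList w)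

Dyck? : ∀ n (w : Word n) → Dec (Dyck n w)
Dyck? n w = IsDyck? n (toList w)

allWords : ∀ m → List (Vec Letter m)
allWords zero    = [ [] ]
allWords (suc m) = concatMap (λ a → map (a ∷_) (allWords m)) (allFin 2)

𝒟 : ∀ n → List (Word n)
𝒟 n = filter (Dyck? n) (allWords (2 * n))

-- `opposite` exchanges 0F and 1F.
_* : ∀ {m} → Vec Letter m → Vec Letter m
w * = Vec.reverse (Vec.map opposite w)

-- The parentheses at positions i < j match when they are an opening and a
-- closing one and the word strictly between them is balanced.
Matched : ∀ n → Word n → Fin (2 * n) → Fin (2 * n) → Set
Matched n π i j = lookup π i ≡ 0F × lookup π j ≡ 1F × IsDyck (count 0F between) between
  where between = take (toℕ j ∸ suc (toℕ i)) (drop (suc (toℕ i)) (toList π))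

Matched? : ∀ n π i j → Dec (Matched n π i j)
Matched? n π i j = (lookup π i Fin.≟ 0F) ×-dec (lookup π j Fin.≟ 1F) ×-dec IsDyck? _ _

-- Row lengths from top to bottom, when k letters 1 precede the word.
rowsFrom : ℕ → List Letter → List ℕ
rowsFrom k []       = []
rowsFrom k (0F ∷ w) = rowsFrom k w ∷ʳ k
rowsFrom k (1F ∷ w) = rowsFrom (suc k) w

rows : List Letter → List ℕ
rows = rowsFrom 0

-- A box is a pair (row , column), both counted from 0.
boxesFrom : ℕ → List ℕ → List (ℕ × ℕ)
boxesFrom r []       = []
boxesFrom r (l ∷ ls) = map (r ,_) (upTo l) ++ boxesFrom (suc r) ls

boxes : ∀ {m} → Vec Letter m → List (ℕ × ℕ)
boxes w = boxesFrom 0 (rows (toList w))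

_≟□_ : DecidableEquality (ℕ × ℕ)
_≟□_ = ≡-dec _≟_ _≟_

open import Data.List.Membership.DecPropositional _≟□_ using () renaming (_∉?_ to _∉□?_)
open import Data.List.Relation.Binary.Subset.DecPropositional _≟□_ using (_⊆?_)

_⊑_ : ∀ {m} → Vec Letter m → Vec Letter m → Set
σ ⊑ τ = boxes σ ⊆ boxes τ

_∕_ : ∀ {m} → Vec Letter m → Vec Letter m → List (ℕ × ℕ)
τ ∕ σ = filter (_∉□? boxes σ) (boxes τ)

HorizontalStrip : List (ℕ × ℕ) → Set
HorizontalStrip = AllPairs (λ b b′ → proj₂ b ≢ proj₂ b′)

infix 4 _⟶_ _⟶?_ _⊑_

_⟶_ : ∀ {m} → Vec Letter m → Vec Letter m → Set
σ ⟶ τ = σ ⊑ τ × HorizontalStrip (τ ∕ σ)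

_⟶?_ : ∀ {m} (σ τ : Vec Letter m) → Dec (σ ⟶ τ)
σ ⟶? τ = (boxes σ ⊆? boxes τ) ×-dec allPairs? (λ b b′ → ¬? (proj₂ b ≟ proj₂ b′)) (τ ∕ σ)

Vertex : Set
Vertex = ℕ × ℕ

_≟ᵛ_ : DecidableEquality Vertex
_≟ᵛ_ = ≡-dec _≟_ _≟_

-- `left v` and `down v` join v to its left neighbour and to its lower
-- neighbour; `down (x , 0)` is a half-edge.
data Edge : Set where
  left down : Vertex → Edge

-- `foot x` is the free end of the half-edge below (x , 0).
data Node : Set where
  vertex : Vertex → Node
  foot   : ℕ → Node

ends : Edge → Node × Node
ends (left (x , y))     = vertex (x , y) , vertex (pred x , y)
ends (down (x , zero))  = vertex (x , zero) , foot x
ends (down (x , suc y)) = vertex (x , suc y) , vertex (x , y)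

_≟ᵉ_ : DecidableEquality Edge
left u ≟ᵉ left v = map′ (cong left) (λ { refl → refl }) (u ≟ᵛ v)
left u ≟ᵉ down v = no λ ()
down u ≟ᵉ left v = no λ ()
down u ≟ᵉ down v = map′ (cong down) (λ { refl → refl }) (u ≟ᵛ v)

_≟ⁿ_ : DecidableEquality Node
vertex u ≟ⁿ vertex v = map′ (cong vertex) (λ { refl → refl }) (u ≟ᵛ v)
vertex u ≟ⁿ foot y   = no λ ()
foot x   ≟ⁿ vertex v = no λ ()
foot x   ≟ⁿ foot y   = map′ (cong foot) (λ { refl → refl }) (x ≟ y)

open import Data.List.Membership.DecPropositional _≟ᵉ_ using () renaming (_∈?_ to _∈ᵉ?_)
open import Data.List.Membership.DecPropositional _≟ⁿ_ using () renaming (_∈?_ to _∈ⁿ?_)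

-- 4n ∸ 1 strictly bounds both coordinates when n ≥ 1.
vertices : ℕ → List Vertex
vertices n = filter (λ (x , y) → (y ≤? x) ×-dec (x + y ≤? 4 * n ∸ 2))
                    (cartesianProduct (upTo (4 * n ∸ 1)) (upTo (4 * n ∸ 1)))

-- L n k and R n k are L_i and R_i with i = toℕ k + 1.
L R : ∀ n → Fin (2 * n) → Vertex
L n k = toℕ k , toℕ k
R n k = (2 * n ∸ 1) + toℕ k , (2 * n ∸ 1) ∸ toℕ k

external : ∀ n → Fin (2 * n) → Edge
external n k = down (2 * toℕ k , 0)

externalEnd : ∀ n → Fin (2 * n) → Node
externalEnd n k = foot (2 * toℕ k)

-- A vertex (x , y) of the triangle has its left neighbour in the triangle iff
-- y < x, and its lower neighbour iff 0 < y.
edges : ℕ → List Edge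
edges n = map left (filter (λ (x , y) → y <? x) (vertices n))
       ++ map down (filter (λ (x , y) → 0 <? y) (vertices n))
       ++ map (external n) (allFin (2 * n))

-- As `edges n` has no repetitions, its subsets are its sublists.
sublists : ∀ {A : Set} → List A → List (List A)
sublists []       = [ [] ]
sublists (x ∷ xs) = map (x ∷_) (sublists xs) ++ sublists xs

Incident : Vertex → Edge → Set
Incident v e = vertex v ≡ proj₁ (ends e) ⊎ vertex v ≡ proj₂ (ends e)

Incident? : ∀ v e → Dec (Incident v e)
Incident? v e = (vertex v ≟ⁿ proj₁ (ends e)) ⊎-dec (vertex v ≟ⁿ proj₂ (ends e))

degree : List Edge → Vertex → ℕ
degree f v = length (filter (Incident? v) f)

Adjacent : List Edge → Node → Node → Set
Adjacent f u v = Any (λ e → ends e ≡ (u , v) ⊎ ends e ≡ (v , u)) f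

Adjacent? : ∀ f u v → Dec (Adjacent f u v)
Adjacent? f u v = any? (λ e → (ends e ≟² (u , v)) ⊎-dec (ends e ≟² (v , u))) f
  where _≟²_ = ≡-dec _≟ⁿ_ _≟ⁿ_

-- Path f u v us : the nodes us are distinct and form a path in f from u to v.
data Path (f : List Edge) : Node → Node → List Node → Set where
  stop : ∀ {u} → Path f u u [ u ]
  step : ∀ {u v w us} → Adjacent f u w → Path f w v us → u ∉ us → Path f u v (u ∷ us)

Joined : List Edge → Node → Node → Set
Joined f u v = ∃[ us ] Path f u v us

module _ (f : List Edge) where

  private
    start∈ : ∀ {u v us} → Path f u v us → u ∈ us
    start∈ stop         = here refl
    start∈ (step _ _ _) = here refl

    _without_ : List Node → Node → List Node
    us without u = filter (λ w → ¬? (w ≟ⁿ u)) us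

    JoinedIn : List Node → Node → Node → Set
    JoinedIn as u v = ∃[ us ] Path f u v us × us ⊆ as

    joinedIn? : ∀ k as → length as ≤ k → ∀ u v → Dec (JoinedIn as u v)
    joinedIn? k as as≤k u v with u ∈ⁿ? as
    ... | no u∉as = no λ (_ , p , us⊆as) → u∉as (us⊆as (start∈ p))
    joinedIn? zero    (_ ∷ _) () u v | yes _
    joinedIn? (suc k) as as≤k u v | yes u∈as with u ≟ⁿ v
    ... | yes refl = yes (_ , stop , λ { (here refl) → u∈as })
    ... | no u≢v   = map′ extend shorten (any? (λ w → Adjacent? f u w ×-dec joinedIn? k as′ as′≤k w v) as′)
      where
      as′ = as without u

      as′≤k : length as′ ≤ k
      as′≤k = ≤-pred (≤-trans (filter-notAll (λ w → ¬? (w ≟ⁿ u)) as (Any.map (λ u≡w w≢u → w≢u (sym u≡w)) u∈as)) as≤k)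

      extend : Any (λ w → Adjacent f u w × JoinedIn as′ w v) as′ → JoinedIn as u v
      extend q with Any.satisfied q
      ... | w , a , us , p , us⊆as′ = u ∷ us , step a p u∉us , sub
        where
        u∉us : u ∉ us
        u∉us u∈us = proj₂ (∈-filter⁻ (λ w → ¬? (w ≟ⁿ u)) {xs = as} (us⊆as′ u∈us)) refl

        sub : u ∷ us ⊆ as
        sub (here refl) = u∈as
        sub (there x∈)  = proj₁ (∈-filter⁻ (λ w → ¬? (w ≟ⁿ u)) {xs = as} (us⊆as′ x∈))

      shorten : JoinedIn as u v → Any (λ w → Adjacent f u w × JoinedIn as′ w v) as′
      shorten (_ , stop , _) with () ← u≢v refl
      shorten (_ , step {us = us} a p u∉us , us⊆as) = lose (sub (start∈ p)) (a , us , p , sub)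
        where
        sub : us ⊆ as′
        sub x∈ = ∈-filter⁺ (λ w → ¬? (w ≟ⁿ u)) (us⊆as (there x∈)) λ { refl → u∉us x∈ }

    endNodes : List Edge → List Node
    endNodes = concatMap (λ e → proj₁ (ends e) ∷ proj₂ (ends e) ∷ [])

    adjacent∈ : ∀ {u v} g → Adjacent g u v → v ∈ endNodes g
    adjacent∈ (e ∷ g) (here (inj₁ refl)) = there (here refl)
    adjacent∈ (e ∷ g) (here (inj₂ refl)) = here refl
    adjacent∈ (e ∷ g) (there a)          = there (there (adjacent∈ g a))

    path⊆ : ∀ {u v us as} → u ∈ as → endNodes f ⊆ as → Path f u v us → us ⊆ as
    path⊆ u∈ f⊆ stop         (here refl) = u∈
    path⊆ u∈ f⊆ (step a p _) (here refl) = u∈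
    path⊆ u∈ f⊆ (step a p _) (there x∈)  = path⊆ (f⊆ (adjacent∈ f a)) f⊆ p x∈

    -- Without the deduplication the search would branch needlessly.
    candidates : Node → List Node
    candidates u = deduplicate _≟ⁿ_ (u ∷ endNodes f)

    bounded : ∀ {u v} → Joined f u v → JoinedIn (candidates u) u v
    bounded (us , p) = us , p , λ x∈ → ∈-deduplicate⁺ _≟ⁿ_ (path⊆ (here refl) there p x∈)

  Joined? : ∀ u v → Dec (Joined f u v)
  Joined? u v = map′ (λ (us , p , _) → us , p) bounded (joinedIn? _ (candidates u) ≤-refl u v)

Boundary : ∀ n → Vertex → Set
Boundary n v = ∃[ k ] (v ≡ L n k ⊎ v ≡ R n k)

Boundary? : ∀ n v → Dec (Boundary n v)
Boundary? n v = Fin.any? λ k → (v ≟ᵛ L n k) ⊎-dec (v ≟ᵛ R n k)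

-- With i = toℕ k + 1, `0 < toℕ k` says 2 ≤ i and `suc (toℕ k) < 2 * n` says
-- i ≤ 2n - 1; the right neighbour of L_i = (x , x) is (suc x , x).  By the degree
-- conditions, a path between two of the special ends is a whole component of
-- f, so leftToRight and rightToLeft describe n disjoint paths.
record IsTFPL (n : ℕ) (σ τ π : Word n) (f : List Edge) : Set where
  field
    externals   : ∀ k → external n k ∈ f
    interior    : All (λ v → ¬ Boundary n v → degree f v ≡ 2) (vertices n)
    leftHoriz   : ∀ (k : Fin (2 * n)) → suc (toℕ k) < 2 * n → left (suc (toℕ k) , toℕ k) ∈ f
    leftVert    : ∀ k → 0 < toℕ k → (down (L n k) ∈ f ⇔ lookup σ k ≡ 0F)
    rightHoriz  : ∀ k → 0 < toℕ k → left (R n k) ∈ f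
    rightVert   : ∀ k → suc (toℕ k) < 2 * n → (down (R n k) ∈ f ⇔ lookup τ k ≡ 1F)
    leftToRight : ∀ i → lookup σ i ≡ 1F →
                  ∃[ j ] (lookup τ j ≡ 0F × Joined f (vertex (L n i)) (vertex (R n j)))
    rightToLeft : ∀ j → lookup τ j ≡ 0F →
                  ∃[ i ] (lookup σ i ≡ 1F × Joined f (vertex (L n i)) (vertex (R n j)))
    matching    : ∀ i j → i Fin.< j →
                  (Joined f (externalEnd n i) (externalEnd n j) ⇔ Matched n π i j)

IsTFPL? : ∀ n σ τ π f → Dec (IsTFPL n σ τ π f)
IsTFPL? n σ τ π f = map′
  (λ (a , b , c , d , e , g , h , i , j) → record
    { externals = a ; interior = b ; leftHoriz = c ; leftVert = d ; rightHoriz = e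
    ; rightVert = g ; leftToRight = h ; rightToLeft = i ; matching = j })
  (λ t → let open IsTFPL t in externals , interior , leftHoriz , leftVert , rightHoriz
    , rightVert , leftToRight , rightToLeft , matching)
  (      Fin.all? (λ k → external n k ∈ᵉ? f)
   ×-dec All.all? (λ v → ¬? (Boundary? n v) →-dec (degree f v ≟ 2)) (vertices n)
   ×-dec Fin.all? {n = 2 * n} (λ k → (suc (toℕ k) <? 2 * n) →-dec (left (suc (toℕ k) , toℕ k) ∈ᵉ? f))
   ×-dec Fin.all? (λ k → (0 <? toℕ k) →-dec ((down (L n k) ∈ᵉ? f) ⇔-dec (lookup σ k Fin.≟ 0F)))
   ×-dec Fin.all? (λ k → (0 <? toℕ k) →-dec (left (R n k) ∈ᵉ? f))
   ×-dec Fin.all? (λ k → (suc (toℕ k) <? 2 * n) →-dec ((down (R n k) ∈ᵉ? f) ⇔-dec (lookup τ k Fin.≟ 1F)))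
   ×-dec Fin.all? (λ i → (lookup σ i Fin.≟ 1F) →-dec
           Fin.any? λ j → (lookup τ j Fin.≟ 0F) ×-dec Joined? f (vertex (L n i)) (vertex (R n j)))
   ×-dec Fin.all? (λ j → (lookup τ j Fin.≟ 0F) →-dec
           Fin.any? λ i → (lookup σ i Fin.≟ 1F) ×-dec Joined? f (vertex (L n i)) (vertex (R n j)))
   ×-dec Fin.all? (λ i → Fin.all? λ j → (i Fin.<? j) →-dec
           (Joined? f (externalEnd n i) (externalEnd n j) ⇔-dec Matched? n π i j)))

t : ∀ n → (σ τ π : Word n) → ℕ
t n σ τ π = length (filter (IsTFPL? n σ τ π) (sublists (edges n)))

module Submission where

-- Wieland drift.  Extend a configuration with boundary words σ₁ and τ beyond the left
-- boundary by edges that record the strip σ ⟶ σ₁, and replace every cell of one parity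
-- class by its complement unless it consists of two parallel edges.  Inside a cell this
-- does not change which corners of degree 1 are joined, so paths survive with the same
-- ends.  Moved one unit to the right, the result is a configuration with left word σ,
-- beyond whose right boundary there are edges recording a strip τ * ⟶ τ₁ *.  Two points
-- are not local: the new configuration has all the required edges at the right boundary,
-- and its right word τ₁ is a Dyck word; both hold because every path that ends at the
-- right boundary comes from the left one, while a component has at most two ends.  The
-- drift is injective, which gives one inequality between the two sums; reflection of the
-- triangle gives the other.

open import Data.Bool using (Bool; true; false; not; _∧_; _∨_; _xor_; if_then_else_)
import Data.Bool.Properties as Bool
open import Data.Empty using (⊥; ⊥-elim)
open import Data.Fin as Fin using (Fin; toℕ; opposite; fromℕ<)
open import Data.Fin.Patterns using (0F; 1F)
import Data.Fin.Properties as Fin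
open import Data.List using (List; []; _∷_; [_]; _++_; _∷ʳ_; map; filter; length;
  cartesianProduct; upTo; take; drop; inits; reverse; sum)
import Data.List.Properties as List
open import Data.List.Membership.Propositional using (_∈_; _∉_; lose; find)
import Data.List.Membership.Propositional.Properties as ∈
open import Data.List.Relation.Binary.Subset.Propositional using (_⊆_)
open import Data.List.Relation.Unary.All as All using (All; []; _∷_)
import Data.List.Relation.Unary.All.Properties as All
open import Data.List.Relation.Unary.AllPairs using (AllPairs; []; _∷_)
open import Data.List.Relation.Unary.Any as Any using (Any; here; there)
open import Data.List.Relation.Unary.Unique.Propositional using (Unique)
import Data.List.Relation.Unary.Unique.Propositional.Properties as Unique
open import Data.Nat using (ℕ; zero; suc; pred; _+_; _*_; _∸_; _≤_; _<_; _≟_; _≤?_; _<?_; z≤n; s≤s)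
open import Data.Nat.Properties
open import Data.Nat.Tactic.RingSolver using (solve-∀)
open import Data.Product using (∃; ∃₂; ∃-syntax; _×_; _,_; proj₁; proj₂)
open import Data.Product.Properties using (,-injectiveˡ; ,-injectiveʳ)
open import Data.Sum using (_⊎_; inj₁; inj₂)
open import Data.Unit using (tt)
open import Data.Vec as Vec using (Vec; []; _∷_; lookup; toList; tabulate)
import Data.Vec.Properties as Vec
open import Function using (_∘_; id; _⇔_; mk⇔; Equivalence; case_of_)
open import Relation.Binary.Construct.Closure.Equivalence as Eq using (EqClosure)
open import Relation.Binary.Construct.Closure.ReflexiveTransitive using (Star; ε; _◅_; _◅◅_)
open import Relation.Binary.Construct.Closure.Symmetric using (SymClosure; fwd; bwd)
open import Relation.Binary.PropositionalEquality using (_≡_; _≢_; refl; sym; trans; cong; cong₂; subst; subst₂; module ≡-Reasoning)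
open import Relation.Binary.Definitions using (tri<; tri≈; tri>)
open import Relation.Nullary using (¬_; Dec; yes; no; does; contradiction)
open import Relation.Nullary.Decidable using (map′; _×-dec_; _→-dec_; toWitness; dec-true; dec-false)
open import Defs
open import Data.List.Membership.DecPropositional _≟ᵉ_ using () renaming (_∈?_ to _∈ᵉ?_)

-- Cells and the connections inside them

-- Every edge lies in exactly one cell of the class, and two different cells meet only in opposite
-- corners, where their degrees add up to 2. Since `drift` turns the degree d of a corner into 2 -
-- d, the sum is 2 again. A path passes from one cell into another exactly where both degrees are 1,
-- and those are the corners whose connections a cell keeps. No inverse of the drift is constructed:
-- it would need the two nonlocal arguments once more, at the left boundary. Injectivity is cheaper.
-- A strip is determined by its two words, so the new configuration and its right word give back
-- every side of the drifted cells, and `drift` is an involution on cells. Reflection interchanges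
-- and conjugates the boundary words, so that four inequalities form a cycle and all are equalities.
-- Positions are triples with a fixed sum. This avoids truncated subtraction and makes reflection an
-- exchange of the two outer coordinates.

⟦_⟧ : Bool → ℕ
⟦ true  ⟧ = 1
⟦ false ⟧ = 0

interchange : ∀ a b c d → a + b + (c + d) ≡ a + c + (b + d)
interchange = solve-∀

data Corner : Set where
  sw se ne nw : Corner

next prev : Corner → Corner
next sw = se
next se = ne
next ne = nw
next nw = sw
prev sw = nw
prev se = sw
prev ne = se
prev nw = ne

record Cell : Set where
  constructor cell
  field bot rgt top lft : Bool

open Cell

-- A side is named by the corner at which it starts, counterclockwise.
_!_ : Cell → Corner → Bool
c ! sw = bot c
c ! se = rgt c
c ! ne = top c
c ! nw = lft c

deg : Cell → Corner → ℕ
deg c κ = ⟦ c ! κ ⟧ + ⟦ c ! prev κ ⟧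

parallel : Cell → Bool
parallel (cell b r t l) = not (b xor t) ∧ not (r xor l) ∧ (b xor r)

-- Wieland's gyration followed by complementation of all sides: a cell with two parallel sides would
-- be turned and then complemented, which leaves it as it is.
drift : Cell → Cell
drift c@(cell b r t l) = if parallel c then c else cell (not b) (not r) (not t) (not l)

eqCorner : Corner → Corner → Bool
eqCorner sw sw = true
eqCorner se se = true
eqCorner ne ne = true
eqCorner nw nw = true
eqCorner _  _  = false

eqCorner-sound : ∀ κ κ′ → eqCorner κ κ′ ≡ true → κ ≡ κ′
eqCorner-sound sw sw refl = refl
eqCorner-sound se se refl = refl
eqCorner-sound ne ne refl = refl
eqCorner-sound nw nw refl = refl

-- Reachability counterclockwise in at most `j` steps. Of two corners connected by sides of the
-- cell, one reaches the other counterclockwise, and 3 steps suffice for four corners; hence the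
-- form of `joined`.
arc : ℕ → Cell → Corner → Corner → Bool
arc zero    c κ κ′ = eqCorner κ κ′
arc (suc j) c κ κ′ = eqCorner κ κ′ ∨ ((c ! κ) ∧ arc j c (next κ) κ′)

joined : Cell → Corner → Corner → Bool
joined c κ κ′ = arc 3 c κ κ′ ∨ arc 3 c κ′ κ

private
  -- There are 16 cells and four corners, so local facts about cells can be settled by exhaustive
  -- evaluation.
  ∀Bool? : ∀ {P : Bool → Set} → (∀ b → Dec (P b)) → Dec (∀ b → P b)
  ∀Bool? P? = map′ (λ { (p , q) true → p ; (p , q) false → q }) (λ p → p true , p false)
                   (P? true ×-dec P? false)

  ∀Cell? : ∀ {P : Cell → Set} → (∀ c → Dec (P c)) → Dec (∀ c → P c)
  ∀Cell? P? = map′ (λ p (cell b r t l) → p b r t l) (λ p b r t l → p (cell b r t l))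
    (∀Bool? λ b → ∀Bool? λ r → ∀Bool? λ t → ∀Bool? λ l → P? (cell b r t l))

  ∀Corner? : ∀ {P : Corner → Set} → (∀ κ → Dec (P κ)) → Dec (∀ κ → P κ)
  ∀Corner? P? = map′
    (λ { (p , q , r , s) sw → p ; (p , q , r , s) se → q ; (p , q , r , s) ne → r ; (p , q , r , s) nw → s })
    (λ p → p sw , p se , p ne , p nw) (P? sw ×-dec P? se ×-dec P? ne ×-dec P? nw)

drift-involutive : ∀ c → drift (drift c) ≡ c
drift-involutive (cell false false false false) = refl
drift-involutive (cell false false false true)  = refl
drift-involutive (cell false false true  false) = refl
drift-involutive (cell false false true  true)  = refl
drift-involutive (cell false true  false false) = refl
drift-involutive (cell false true  false true)  = refl
drift-involutive (cell false true  true  false) = refl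
drift-involutive (cell false true  true  true)  = refl
drift-involutive (cell true  false false false) = refl
drift-involutive (cell true  false false true)  = refl
drift-involutive (cell true  false true  false) = refl
drift-involutive (cell true  false true  true)  = refl
drift-involutive (cell true  true  false false) = refl
drift-involutive (cell true  true  false true)  = refl
drift-involutive (cell true  true  true  false) = refl
drift-involutive (cell true  true  true  true)  = refl

-- A cell with two parallel sides has degree 1 at each corner; any other cell is complemented, which
-- turns d into 2 - d.
deg-drift : ∀ c κ → deg (drift c) κ + deg c κ ≡ 2
deg-drift = toWitness {a? = ∀Cell? λ c → ∀Corner? λ κ → deg (drift c) κ + deg c κ ≟ 2} tt

joined-next : ∀ c κ κ′ → c ! κ ≡ true → joined c (next κ) κ′ ≡ joined c κ κ′
joined-next = toWitness {a? = ∀Cell? λ c → ∀Corner? λ κ → ∀Corner? λ κ′ →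
  (c ! κ Bool.≟ true) →-dec (joined c (next κ) κ′ Bool.≟ joined c κ κ′)} tt

joined-isolated : ∀ c κ κ′ → deg c κ ≡ 0 → joined c κ κ′ ≡ true → deg c κ′ ≡ 0
joined-isolated = toWitness {a? = ∀Cell? λ c → ∀Corner? λ κ → ∀Corner? λ κ′ →
  (deg c κ ≟ 0) →-dec ((joined c κ κ′ Bool.≟ true) →-dec (deg c κ′ ≟ 0))} tt

-- If a non-parallel cell has corners of degree 1, its sides form a single arc, and the
-- complementary arc has the same two ends. A parallel cell is unchanged.
joined-drift : ∀ c κ κ′ → deg c κ ≡ 1 → deg c κ′ ≡ 1 → joined c κ κ′ ≡ true → joined (drift c) κ κ′ ≡ true
joined-drift = toWitness {a? = ∀Cell? λ c → ∀Corner? λ κ → ∀Corner? λ κ′ →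
  (deg c κ ≟ 1) →-dec ((deg c κ′ ≟ 1) →-dec ((joined c κ κ′ Bool.≟ true) →-dec (joined (drift c) κ κ′ Bool.≟ true)))} tt

joined-refl : ∀ c κ → joined c κ κ ≡ true
joined-refl c sw = refl
joined-refl c se = refl
joined-refl c ne = refl
joined-refl c nw = refl

-- The cells form a triangle, the cell in line m and row y being at distance k
-- from the right boundary, m + y + k = P + 1.  The sites are the corners of
-- the cells; the two kinds of sites are the two classes of the bipartition.
data Site : Set where
  black white : ℕ → ℕ → ℕ → Site

Cells : Set
Cells = ℕ → ℕ → ℕ → Cell

corner : Corner → ℕ → ℕ → ℕ → Site
corner sw m y k = black m y (suc k)
corner se m y k = white (suc m) y k
corner ne m y k = black m (suc y) k
corner nw m y k = white m (suc y) k

data Wire (P : ℕ) (X : Cells) : Site → Site → Set where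
  wire : ∀ {m y k} κ → m + y + k ≡ suc P → X m y k ! κ ≡ true →
         Wire P X (corner κ m y k) (corner (next κ) m y k)

Connected : ℕ → Cells → Site → Site → Set
Connected P X = EqClosure (Wire P X)

-- At a black site the corner `ne` of one cell meets the corner `sw` of another, at a white site
-- `nw` meets `se`. Sites on the border of the array belong to one cell only and carry no condition.
record Balanced (P : ℕ) (X : Cells) : Set where
  field
    black-degree : ∀ m y k → m + y + k ≡ P → deg (X m y (suc k)) ne + deg (X m (suc y) k) sw ≡ 2
    white-degree : ∀ m y k → m + y + k ≡ P → deg (X (suc m) y k) nw + deg (X m (suc y) k) se ≡ 2

symᶜ : ∀ {P X u v} → Connected P X u v → Connected P X v u
symᶜ = Eq.symmetric _

corners-connected : ∀ {P X m y k} κ κ′ → m + y + k ≡ suc P → joined (X m y k) κ κ′ ≡ true →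
                    Connected P X (corner κ m y k) (corner κ′ m y k)
corners-connected {P} {X} {m} {y} {k} κ κ′ p q with arc 3 (X m y k) κ κ′ in eq
... | true  = along 3 κ eq
  where
  along : ∀ j κ → arc j (X m y k) κ κ′ ≡ true → Connected P X (corner κ m y k) (corner κ′ m y k)
  along zero    κ e rewrite eqCorner-sound κ κ′ e = ε
  along (suc j) κ e with eqCorner κ κ′ in κ≡ | X m y k ! κ in side
  ... | true  | _    rewrite eqCorner-sound κ κ′ κ≡ = ε
  ... | false | true = fwd (wire κ p side) ◅ along j (next κ) e
... | false = symᶜ (along 3 κ′ q)
  where
  along : ∀ j κ′ → arc j (X m y k) κ′ κ ≡ true → Connected P X (corner κ′ m y k) (corner κ m y k)
  along zero    κ′ e rewrite eqCorner-sound κ′ κ e = ε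
  along (suc j) κ′ e with eqCorner κ′ κ in κ≡ | X m y k ! κ′ in side
  ... | true  | _    rewrite eqCorner-sound κ′ κ κ≡ = ε
  ... | false | true = fwd (wire κ′ p side) ◅ along j (next κ′) e

private
  sum-middle : ∀ m {y k j} → m + suc y + k ≡ suc j → m + y + k ≡ j
  sum-middle m {y} {k} e = suc-injective (trans (cong (_+ k) (sym (+-suc m y))) e)

  meet : ∀ {P X} → Balanced P X → ∀ κ κ′ {m y k m′ y′ k′} → m + y + k ≡ suc P → m′ + y′ + k′ ≡ suc P →
         corner κ m y k ≡ corner κ′ m′ y′ k′ →
         (κ ≡ κ′ × m ≡ m′ × y ≡ y′ × k ≡ k′) ⊎ deg (X m y k) κ + deg (X m′ y′ k′) κ′ ≡ 2
  meet B sw sw p q refl = inj₁ (refl , refl , refl , refl)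
  meet B se se p q refl = inj₁ (refl , refl , refl , refl)
  meet B ne ne p q refl = inj₁ (refl , refl , refl , refl)
  meet B nw nw p q refl = inj₁ (refl , refl , refl , refl)
  meet B ne sw {m} p q refl = inj₂ (Balanced.black-degree B _ _ _ (sum-middle m q))
  meet {X = X} B sw ne {m} {suc y} {k} p q refl =
    inj₂ (trans (+-comm (deg (X m (suc y) k) sw) _) (Balanced.black-degree B _ _ _ (sum-middle m p)))
  meet B nw se {m′ = m′} p q refl = inj₂ (Balanced.white-degree B _ _ _ (sum-middle m′ q))
  meet {X = X} B se nw {m} {suc y} {k} p q refl =
    inj₂ (trans (+-comm (deg (X m (suc y) k) se) _) (Balanced.white-degree B _ _ _ (sum-middle m p)))

-- `Y` is tied to the drift of `X` by an equation, so that, `drift` being an involution, the same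
-- argument also leads from the drifted cells back.
module _ {P : ℕ} {X Y : Cells} (Y≡ : ∀ m y k → m + y + k ≡ suc P → Y m y k ≡ drift (X m y k))
         (B : Balanced P X) {u : Site} where

  private
    -- The invariant carried along a connection in `X`: on arrival at `w`, the start is connected in
    -- `Y` to all corners of degree 1 on the same arc as `w`. The site `w` itself may be interior to
    -- the arc and then isolated in the drifted cell.
    Good : Site → Set
    Good w = ∀ {m y k} κ κ′ → m + y + k ≡ suc P → corner κ m y k ≡ w → joined (X m y k) κ κ′ ≡ true →
             deg (X m y k) κ′ ≡ 1 → Connected P Y u (corner κ′ m y k)

    inside : ∀ {m y k} κ κ′ → m + y + k ≡ suc P → deg (X m y k) κ ≡ 1 → deg (X m y k) κ′ ≡ 1 →
             joined (X m y k) κ κ′ ≡ true → Connected P Y (corner κ m y k) (corner κ′ m y k)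
    inside κ κ′ p d d′ j = corners-connected κ κ′ p
      (trans (cong (λ c → joined c κ κ′) (Y≡ _ _ _ p)) (joined-drift _ κ κ′ d d′ j))

    good-step : ∀ {m y k} κ₁ κ₂ → m + y + k ≡ suc P → 1 ≤ deg (X m y k) κ₂ →
                (∀ κ′ → joined (X m y k) κ₂ κ′ ≡ joined (X m y k) κ₁ κ′) →
                Good (corner κ₁ m y k) → Good (corner κ₂ m y k)
    good-step {m} {y} {k} κ₁ κ₂ p 1≤ j≡ good {m′} {y′} {k′} κ κ′ q e j d with meet B κ κ₂ q p e
    ... | inj₁ (refl , refl , refl , refl) = good κ₁ κ′ p refl (trans (sym (j≡ κ′)) j) d
    -- Degree 0 in the other cell leaves no arc to follow, and degree 2 contradicts the side just
    -- traversed. So both degrees are 1, and the connection crosses from one cell into the other.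
    ... | inj₂ d+d≡2 = go (deg (X m′ y′ k′) κ) refl d+d≡2
      where
      go : ∀ d₀ → deg (X m′ y′ k′) κ ≡ d₀ → d₀ + deg (X m y k) κ₂ ≡ 2 → Connected P Y u (corner κ′ m′ y′ k′)
      go 0 dκ s = contradiction (trans (sym d) (joined-isolated _ κ κ′ dκ j)) λ ()
      go 1 dκ s = subst (Connected P Y u) (sym e)
                    (good κ₁ κ₂ p refl (trans (sym (j≡ κ₂)) (joined-refl _ κ₂)) (suc-injective s))
                  ◅◅ inside κ κ′ q dκ d j
      go 2 dκ s = contradiction (subst (1 ≤_) (suc-injective (suc-injective s)) 1≤) λ ()
      go (suc (suc (suc _))) dκ ()

    1≤side : ∀ c κ → c ! κ ≡ true → 1 ≤ deg c κ × 1 ≤ deg c (next κ)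
    1≤side c sw e rewrite e = s≤s z≤n , m≤n+m 1 _
    1≤side c se e rewrite e = s≤s z≤n , m≤n+m 1 _
    1≤side c ne e rewrite e = s≤s z≤n , m≤n+m 1 _
    1≤side c nw e rewrite e = s≤s z≤n , m≤n+m 1 _

    good-along : ∀ {w w′} → Connected P X w w′ → Good w → Good w′
    good-along ε g = g
    good-along (fwd (wire {m} {y} {k} κ p e) ◅ s) g = good-along s
      (λ {m} → good-step κ (next κ) p (proj₂ (1≤side _ κ e)) (λ κ′ → joined-next _ κ κ′ e) g {m})
    good-along (bwd (wire {m} {y} {k} κ p e) ◅ s) g = good-along s
      (λ {m} → good-step (next κ) κ p (proj₁ (1≤side _ κ e)) (λ κ′ → sym (joined-next _ κ κ′ e)) g {m})

  drift-connected : (∀ {m y k} κ → m + y + k ≡ suc P → corner κ m y k ≡ u → deg (X m y k) κ ≡ 1) →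
    ∀ {m y k} κ → m + y + k ≡ suc P → deg (X m y k) κ ≡ 1 →
    Connected P X u (corner κ m y k) → Connected P Y u (corner κ m y k)
  drift-connected du κ p d s = good-along s start κ κ p refl (joined-refl _ κ) d
    where
    start : Good u
    start {m} {y} {k} κ κ′ q e j d′ = subst (λ v → Connected P Y v (corner κ′ m y k)) e (inside κ κ′ q (du κ q e) d′ j)

-- Configurations

module Trails {A : Set} (_≟ᴬ_ : (x y : A) → Dec (x ≡ y)) (_~_ : A → A → Set) where

  -- Trail u w v : the walks from u to v through w at first that never turn back.
  data Trail (u : A) : A → A → Set where
    done : ∀ {w} → u ~ w → Trail u w w
    more : ∀ {w x v} → u ~ w → u ≢ x → Trail w x v → Trail u w v

  -- A detour u, w, u is cut out: the trail from the second u is already contained in the trail from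
  -- w.
  trail : ∀ {u v} → Star _~_ u v → u ≢ v → ∃ λ w → Trail u w v
  trail ε u≢u = contradiction refl u≢u
  trail {u} {v} (_◅_ {j = w} e s) u≢v with w ≟ᴬ v
  ... | yes refl = w , done e
  ... | no w≢v with trail s w≢v
  ...   | x , p with u ≟ᴬ x
  ...     | no u≢x = w , more e u≢x p
  ...     | yes refl with p
  ...       | done _     = contradiction refl u≢v
  ...       | more _ _ q = _ , q

  End : A → Set
  End v = ∀ {a b} → v ~ a → v ~ b → a ≡ b

  module _ (~-sym : ∀ {u v} → u ~ v → v ~ u)
           (narrow : ∀ {w a b c} → w ~ a → w ~ b → w ~ c → a ≡ b ⊎ a ≡ c ⊎ b ≡ c) where

    first : ∀ {u w v} → Trail u w v → u ~ w
    first (done e)     = e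
    first (more e _ _) = e

    -- With at most two neighbours and no turning back, each step is forced by the one before;
    -- neither trail can run on past an end, which has a single neighbour.
    trail-end-unique : ∀ {u w v v′} → End v → End v′ → Trail u w v → Trail u w v′ → v ≡ v′
    trail-end-unique ev ev′ (done _) (done _) = refl
    trail-end-unique ev ev′ (done e) (more _ u≢x q) = contradiction (ev (~-sym e) (first q)) u≢x
    trail-end-unique ev ev′ (more _ u≢x p) (done e) = contradiction (ev′ (~-sym e) (first p)) u≢x
    trail-end-unique ev ev′ (more e u≢x p) (more _ u≢x′ q) with narrow (~-sym e) (first p) (first q)
    ... | inj₁ u≡x           = contradiction u≡x u≢x
    ... | inj₂ (inj₁ u≡x′)   = contradiction u≡x′ u≢x′
    ... | inj₂ (inj₂ refl)   = trail-end-unique ev ev′ p q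

    end-unique : ∀ {u v v′} → End u → End v → End v′ → u ≢ v → u ≢ v′ →
                 Star _~_ u v → Star _~_ u v′ → v ≡ v′
    end-unique eu ev ev′ u≢v u≢v′ s s′ with trail s u≢v | trail s′ u≢v′
    ... | w , p | w′ , q with eu (first p) (first q)
    ...   | refl = trail-end-unique ev ev′ p q

at-most-one : ∀ {A : Set} {xs : List A} → length xs ≤ 1 → ∀ {x y} → x ∈ xs → y ∈ xs → x ≡ y
at-most-one {xs = _ ∷ []} _ (here refl) (here refl) = refl
at-most-one {xs = _ ∷ _ ∷ _} (s≤s ())

at-most-two : ∀ {A : Set} {xs : List A} → length xs ≤ 2 → ∀ {x y z} → x ∈ xs → y ∈ xs → z ∈ xs →
              x ≡ y ⊎ x ≡ z ⊎ y ≡ z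
at-most-two _ (here refl) (here refl) _ = inj₁ refl
at-most-two _ (here refl) (there _) (here refl) = inj₂ (inj₁ refl)
at-most-two _ (there _) (here refl) (here refl) = inj₂ (inj₂ refl)
at-most-two (s≤s l) (there p) (there q) _ = inj₁ (at-most-one l p q)
at-most-two (s≤s l) (there p) (here _) (there r) = inj₂ (inj₁ (at-most-one l p r))
at-most-two (s≤s l) (here _) (there q) (there r) = inj₂ (inj₂ (at-most-one l q r))

-- The vertices with x − y even or odd, at distance k from the right boundary:
-- even m y k and odd m y k are (2m + y , y) and (2m + y + 1 , y) where m + y + k
-- is P + 1 and P respectively and 2n = P + 2; leg m k is the free end of the
-- external edge below (2m , 0).  Reflecting the triangle exchanges m and k.
data Point : Set where
  even odd : ℕ → ℕ → ℕ → Point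
  leg      : ℕ → ℕ → Point

_≟ᴾ_ : (u v : Point) → Dec (u ≡ v)
even m y k ≟ᴾ even m′ y′ k′ = map′ (λ { (refl , refl , refl) → refl }) (λ { refl → refl , refl , refl })
                                   ((m ≟ m′) ×-dec ((y ≟ y′) ×-dec (k ≟ k′)))
odd m y k  ≟ᴾ odd m′ y′ k′  = map′ (λ { (refl , refl , refl) → refl }) (λ { refl → refl , refl , refl })
                                   ((m ≟ m′) ×-dec ((y ≟ y′) ×-dec (k ≟ k′)))
leg m k    ≟ᴾ leg m′ k′     = map′ (λ { (refl , refl) → refl }) (λ { refl → refl , refl }) ((m ≟ m′) ×-dec (k ≟ k′))
even _ _ _ ≟ᴾ odd _ _ _  = no λ ()
even _ _ _ ≟ᴾ leg _ _    = no λ ()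
odd _ _ _  ≟ᴾ even _ _ _ = no λ ()
odd _ _ _  ≟ᴾ leg _ _    = no λ ()
leg _ _    ≟ᴾ even _ _ _ = no λ ()
leg _ _    ≟ᴾ odd _ _ _  = no λ ()

data Dir : Set where
  west east north south : Dir

-- Every edge other than the external ones has exactly one odd end.
Config : Set
Config = ℕ → ℕ → ℕ → Dir → Bool

-- South of odd m 0 k there is no vertex; the value there is irrelevant.
far : Dir → ℕ → ℕ → ℕ → Point
far west  m y       k = even m y (suc k)
far east  m y       k = even (suc m) y k
far north m y       k = even m (suc y) k
far south m (suc y) k = even (suc m) y (suc k)
far south m zero    k = odd m zero k

data Link (P : ℕ) (h : Config) : Point → Point → Set where
  link    : ∀ {m y k} d → m + y + k ≡ P → h m y k d ≡ true → Link P h (odd m y k) (far d m y k)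
  legLink : ∀ {m k} → m + k ≡ suc P → Link P h (leg m k) (even m 0 k)

Linked : ℕ → Config → Point → Point → Set
Linked P h = EqClosure (Link P h)

symˡ : ∀ {P h u v} → Linked P h u v → Linked P h v u
symˡ = Eq.symmetric _

-- The edge below even m y k; the external edges are always present.
floor : Config → ℕ → ℕ → ℕ → Bool
floor h m zero    k = true
floor h m (suc y) k = h m y k north

-- A word is given by its letters, true standing for 1; the letter with i letters
-- before and k letters after it is a i k.
Letters : Set
Letters = ℕ → ℕ → Bool

-- A matching of the external edges, M i k j l concerning those with i and k, and
-- with j and l, external edges to their left and right.
Pairing : Set₁
Pairing = ℕ → ℕ → ℕ → ℕ → Set

-- At y = 0 the floor is an external edge, so `left-floor` makes `a` begin with 0 and `right-floor`
-- makes `c` end with 1. At the top both conditions concern the same edge, so `summit`, by which `a`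
-- ends with 1, also makes `c` begin with 0.
record TFPL (P : ℕ) (a c : Letters) (M : Pairing) (h : Config) : Set where
  field
    bottom      : ∀ m k → m + k ≡ P → h m 0 k south ≡ false
    odd-degree  : ∀ m y k → m + y + k ≡ P →
                  ⟦ h m y k west ⟧ + ⟦ h m y k east ⟧ + ⟦ h m y k north ⟧ + ⟦ h m y k south ⟧ ≡ 2
    even-degree : ∀ m y k → suc m + y + k ≡ P →
                  ⟦ h (suc m) y k west ⟧ + ⟦ h m y (suc k) east ⟧ + ⟦ floor h (suc m) y (suc k) ⟧
                    + ⟦ h m (suc y) k south ⟧ ≡ 2
    left-edge   : ∀ y k → y + k ≡ P → h 0 y k west ≡ true
    left-floor  : ∀ y k → y + k ≡ suc P → floor h 0 y k ≡ not (a y k)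
    right-edge  : ∀ m y → m + y ≡ P → h m y 0 east ≡ true
    right-floor : ∀ m y → m + y ≡ suc P → floor h m y 0 ≡ c m y
    summit      : a (suc P) 0 ≡ true
    left-path   : ∀ i k → i + k ≡ suc P → a i k ≡ true →
                  ∃₂ λ j l → j + l ≡ suc P × c j l ≡ false × Linked P h (even 0 i k) (even j l 0)
    right-path  : ∀ j l → j + l ≡ suc P → c j l ≡ false →
                  ∃₂ λ i k → i + k ≡ suc P × a i k ≡ true × Linked P h (even 0 i k) (even j l 0)
    leg-path    : ∀ i k j l → i + k ≡ suc P → j + l ≡ suc P → i < j →
                  Linked P h (leg i k) (leg j l) ⇔ M i k j l

flip-dir : Dir → Dir
flip-dir west  = east
flip-dir east  = west
flip-dir north = north
flip-dir south = south

mirror : Config → Config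
mirror h m y k d = h k y m (flip-dir d)

mirror-point : Point → Point
mirror-point (even m y k) = even k y m
mirror-point (odd m y k)  = odd k y m
mirror-point (leg m k)    = leg k m

mirror-letters : Letters → Letters
mirror-letters a i k = not (a k i)

mirror-pairing : Pairing → Pairing
mirror-pairing M i k j l = M l j k i

swap-sum : ∀ m y {k j} → m + y + k ≡ j → k + y + m ≡ j
swap-sum m y {k} e = trans (lemma k y m) e
  where
  lemma : ∀ k y m → k + y + m ≡ m + y + k
  lemma = solve-∀

mirror-linked : ∀ {P h h′ u v} → (∀ m y k d → h m y k d ≡ true → h′ k y m (flip-dir d) ≡ true) →
                Linked P h u v → Linked P h′ (mirror-point u) (mirror-point v)
mirror-linked {P} {h} {h′} h≡ = Eq.gmap mirror-point reflect
  where
  reflect : ∀ {u v} → Link P h u v → Link P h′ (mirror-point u) (mirror-point v)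
  reflect (link {m} {y} west p e)         = link east (swap-sum m y p) (h≡ _ _ _ west e)
  reflect (link {m} {y} east p e)         = link west (swap-sum m y p) (h≡ _ _ _ east e)
  reflect (link {m} {y} north p e)        = link north (swap-sum m y p) (h≡ _ _ _ north e)
  reflect (link {m} {zero} {k} south p e) = link south (swap-sum m 0 p) (h≡ _ _ _ south e)
  reflect (link {m} {suc y} south p e)    = link south (swap-sum m (suc y) p) (h≡ _ _ _ south e)
  reflect (legLink {m} {k} p)             = legLink (trans (+-comm k m) p)

flip-flip : ∀ d → flip-dir (flip-dir d) ≡ d
flip-flip west  = refl
flip-flip east  = refl
flip-flip north = refl
flip-flip south = refl

Bool-flip : ∀ {x y} → x ≡ not y → not x ≡ y
Bool-flip {y = y} refl = Bool.not-involutive y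

mirror-TFPL : ∀ {P a c M h} → TFPL P a c M h →
              TFPL P (mirror-letters c) (mirror-letters a) (mirror-pairing M) (mirror h)
mirror-TFPL {P} {a} {c} {M} {h} T = record
  { bottom      = λ m k p → bottom k m (trans (+-comm k m) p)
  ; odd-degree  = λ m y k p → trans (rearrange ⟦ h k y m east ⟧ ⟦ h k y m west ⟧ ⟦ h k y m north ⟧ ⟦ h k y m south ⟧)
                                    (odd-degree k y m (swap-sum m y p))
  ; even-degree = λ m y k p → trans (cong (λ z → ⟦ h k y (suc m) east ⟧ + ⟦ h (suc k) y m west ⟧ + ⟦ z ⟧
                                        + ⟦ h k (suc y) m south ⟧) (floor-mirror (suc m) y (suc k)))
      (trans (rearrange ⟦ h k y (suc m) east ⟧ ⟦ h (suc k) y m west ⟧ _ ⟦ h k (suc y) m south ⟧)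
             (even-degree k y m (trans (shift k y m) p)))
  ; left-edge   = λ y k p → right-edge k y (trans (+-comm k y) p)
  ; left-floor  = λ y k p → trans (floor-mirror 0 y k)
                    (trans (right-floor k y (trans (+-comm k y) p)) (sym (Bool.not-involutive _)))
  ; right-edge  = λ m y p → left-edge y m (trans (+-comm y m) p)
  ; right-floor = λ m y p → trans (floor-mirror m y 0) (left-floor y m (trans (+-comm y m) p))
  -- The edge below the top vertex is read both as a right floor and as a left floor: `c` begins
  -- with 0 because `a` ends with 1.
  ; summit      = Bool-flip (trans (sym (right-floor 0 (suc P) refl)) (trans
                    (left-floor (suc P) 0 (+-identityʳ _)) (cong not summit)))
  ; left-path   = λ i k p e → case right-path k i (trans (+-comm k i) p) (trans (sym (Bool.not-involutive _)) (cong not e)) of λ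
      { (i′ , k′ , q , f , s) → k′ , i′ , trans (+-comm k′ i′) q , cong not f , symˡ (mirror-linked forth s) }
  ; right-path  = λ j l p e → case left-path l j (trans (+-comm l j) p) (trans (sym (Bool.not-involutive _)) (cong not e)) of λ
      { (j′ , l′ , q , f , s) → l′ , j′ , trans (+-comm l′ j′) q , cong not f , symˡ (mirror-linked forth s) }
  ; leg-path    = λ i k j l p q i<j →
      let open Equivalence (leg-path l j k i (trans (+-comm l j) q) (trans (+-comm k i) p)
                              (complement< i k j l p q i<j)) in
      mk⇔ (λ s → to (symˡ (mirror-linked (λ _ _ _ _ e → e) s)))
          (λ m → symˡ (mirror-linked forth (from m)))
  }
  where
  open TFPL T
  forth : ∀ m y k d → h m y k d ≡ true → mirror h k y m (flip-dir d) ≡ true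
  forth m y k d = trans (cong (h m y k) (flip-flip d))
  rearrange : ∀ x y z w → x + y + z + w ≡ y + x + z + w
  rearrange = solve-∀
  shift : ∀ k y m → suc k + y + m ≡ suc m + y + k
  shift = solve-∀
  floor-mirror : ∀ m y k → floor (mirror h) m y k ≡ floor h k y m
  floor-mirror m zero    k = refl
  floor-mirror m (suc y) k = refl
  complement< : ∀ i k j l → i + k ≡ suc P → j + l ≡ suc P → i < j → l < k
  complement< i k j l p q i<j = +-cancelˡ-< i l k (subst (i + l <_) (trans q (sym p)) (+-monoˡ-< l i<j))

when : Bool → Point → List Point
when b u = if b then [ u ] else []

below : ℕ → ℕ → ℕ → Point
below m zero    k = leg m k
below m (suc y) k = odd m y k

-- An even point reads its edges off its odd neighbours; the empty lists stand for neighbours beyond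
-- the boundary.
eastward westward upward : Config → ℕ → ℕ → ℕ → List Point
eastward h m y zero    = []
eastward h m y (suc k) = when (h m y k west) (odd m y k)
westward h zero    y k = []
westward h (suc m) y k = when (h m y k east) (odd m y k)
upward h zero    y k       = []
upward h (suc m) y zero    = []
upward h (suc m) y (suc k) = when (h m (suc y) k south) (odd m (suc y) k)

neighbours : Config → Point → List Point
neighbours h (odd m y k)  = when (h m y k west) (far west m y k) ++ when (h m y k east) (far east m y k)
  ++ when (h m y k north) (far north m y k) ++ when (h m y k south) (far south m y k)
neighbours h (even m y k) = eastward h m y k ++ westward h m y k ++ when (floor h m y k) (below m y k) ++ upward h m y k
neighbours h (leg m k)    = [ even m 0 k ]

length-when : ∀ b u → length (when b u) ≡ ⟦ b ⟧
length-when true  u = refl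
length-when false u = refl

length-++₄ : ∀ {A : Set} (ws xs ys zs : List A) {i j k l} → length ws ≡ i → length xs ≡ j → length ys ≡ k → length zs ≡ l →
             length (ws ++ xs ++ ys ++ zs) ≡ i + j + k + l
length-++₄ ws xs ys zs refl refl refl refl = trans (List.length-++ ws) (trans (cong (length ws +_)
  (trans (List.length-++ xs) (cong (length xs +_) (List.length-++ ys)))) (assoc (length ws) _ _ _))
  where
  assoc : ∀ a b c d → a + (b + (c + d)) ≡ a + b + c + d
  assoc = solve-∀

⟦⟧≤1 : ∀ b → ⟦ b ⟧ ≤ 1
⟦⟧≤1 true  = ≤-refl
⟦⟧≤1 false = z≤n

_~[_,_]_ : Point → ℕ → Config → Point → Set
u ~[ P , h ] v = SymClosure (Link P h) u v

Inside : ℕ → Point → Set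
Inside P (even m y k) = m + y + k ≡ suc P
Inside P (odd m y k)  = m + y + k ≡ P
Inside P (leg m k)    = m + k ≡ suc P

far-inside : ∀ {P m y k} d → m + y + k ≡ P → Inside P (far d m y k)
far-inside {m = m} {y} {k} west  p = trans (+-suc (m + y) k) (cong suc p)
far-inside east  p = cong suc p
far-inside {m = m} {y} {k} north p = trans (cong (_+ k) (+-suc m y)) (cong suc p)
far-inside {y = zero} south p = p
far-inside {m = m} {suc y} {k} south p = cong suc (trans (+-suc (m + y) k) (trans (cong (_+ k) (sym (+-suc m y))) p))

~-inside : ∀ {P h u v} → u ~[ P , h ] v → Inside P u
~-inside (fwd (link d p _)) = p
~-inside (bwd (link d p _)) = far-inside d p
~-inside (fwd (legLink p))  = p
~-inside (bwd (legLink {m} {k} p)) = trans (cong (_+ k) (+-identityʳ m)) p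

when∈ : ∀ {b u} → b ≡ true → u ∈ when b u
when∈ refl = here refl

module _ {P a c M h} (T : TFPL P a c M h) where
  open TFPL T

  ∈neighbours : ∀ {u v} → u ~[ P , h ] v → v ∈ neighbours h u
  ∈neighbours (fwd (link {m} {y} {k} west p e))  = ∈.∈-++⁺ˡ (when∈ e)
  ∈neighbours (fwd (link {m} {y} {k} east p e))  = ∈.∈-++⁺ʳ (when (h m y k west) _) (∈.∈-++⁺ˡ (when∈ e))
  ∈neighbours (fwd (link {m} {y} {k} north p e)) = ∈.∈-++⁺ʳ (when (h m y k west) _)
    (∈.∈-++⁺ʳ (when (h m y k east) _) (∈.∈-++⁺ˡ (when∈ e)))
  ∈neighbours (fwd (link {m} {y} {k} south p e)) = ∈.∈-++⁺ʳ (when (h m y k west) _)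
    (∈.∈-++⁺ʳ (when (h m y k east) _) (∈.∈-++⁺ʳ (when (h m y k north) _) (when∈ e)))
  ∈neighbours (fwd (legLink p)) = here refl
  ∈neighbours (bwd (link {m} {y} {k} west p e))  = ∈.∈-++⁺ˡ (when∈ e)
  ∈neighbours (bwd (link {m} {y} {k} east p e))  = ∈.∈-++⁺ʳ (eastward h (suc m) y k) (∈.∈-++⁺ˡ (when∈ e))
  ∈neighbours (bwd (link {m} {y} {k} north p e)) = ∈.∈-++⁺ʳ (eastward h m (suc y) k)
    (∈.∈-++⁺ʳ (westward h m (suc y) k) (∈.∈-++⁺ˡ (when∈ e)))
  ∈neighbours (bwd (link {m} {zero} {k} south p e)) with () ← trans (sym e) (bottom m k (trans (cong (_+ k) (sym (+-identityʳ m))) p))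
  ∈neighbours (bwd (link {m} {suc y} {k} south p e)) = ∈.∈-++⁺ʳ (eastward h (suc m) y (suc k))
    (∈.∈-++⁺ʳ (westward h (suc m) y (suc k)) (∈.∈-++⁺ʳ (when (floor h (suc m) y (suc k)) _) (when∈ e)))
  ∈neighbours (bwd (legLink {m} {k} p)) = ∈.∈-++⁺ʳ (eastward h m 0 k) (∈.∈-++⁺ʳ (westward h m 0 k) (here refl))

  private
    outer : ∀ {i f} → i ≤ 1 → i + 0 + f + 0 ≤ 1 + f
    outer {i} {f} i≤1 rewrite +-identityʳ i | +-identityʳ (i + f) = +-monoˡ-≤ f i≤1

  left-neighbours : ∀ y k → length (neighbours h (even 0 y k)) ≤ 1 + ⟦ floor h 0 y k ⟧
  left-neighbours y zero    = ≤-trans (≤-reflexive (length-++₄ [] [] (when (floor h 0 y zero) (below 0 y zero)) []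
    refl refl (length-when (floor h 0 y zero) _) refl)) (outer z≤n)
  left-neighbours y (suc k) = ≤-trans (≤-reflexive (length-++₄ (eastward h 0 y (suc k)) []
    (when (floor h 0 y (suc k)) (below 0 y (suc k))) []
    (length-when (h 0 y k west) _) refl (length-when (floor h 0 y (suc k)) _) refl)) (outer (⟦⟧≤1 (h 0 y k west)))

  right-neighbours : ∀ m y → length (neighbours h (even m y 0)) ≤ 1 + ⟦ floor h m y 0 ⟧
  right-neighbours zero    y = left-neighbours y 0
  right-neighbours (suc m) y = ≤-trans (≤-reflexive (length-++₄ [] (westward h (suc m) y 0)
    (when (floor h (suc m) y 0) (below (suc m) y 0)) []
    refl (length-when (h m y 0 east) _) (length-when (floor h (suc m) y 0) _) refl))
    (≤-trans (≤-reflexive (+-identityʳ _)) (+-monoˡ-≤ ⟦ floor h (suc m) y 0 ⟧ (⟦⟧≤1 (h m y 0 east))))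

  -- The edge at `u` places `u` inside the triangle, where the degree conditions are available.
  two-neighbours : ∀ {u v} → u ~[ P , h ] v → length (neighbours h u) ≤ 2
  two-neighbours {odd m y k} e = ≤-reflexive (trans
    (length-++₄ (when (h m y k west) _) (when (h m y k east) _) (when (h m y k north) _) (when (h m y k south) _)
       (length-when (h m y k west) _) (length-when (h m y k east) _) (length-when (h m y k north) _)
       (length-when (h m y k south) _)) (odd-degree m y k (~-inside e)))
  two-neighbours {leg _ _} _ = s≤s z≤n
  two-neighbours {even zero y k} _ = ≤-trans (left-neighbours y k) (+-monoʳ-≤ 1 (⟦⟧≤1 (floor h 0 y k)))
  two-neighbours {even (suc m) y zero} _ = ≤-trans (right-neighbours (suc m) y) (+-monoʳ-≤ 1 (⟦⟧≤1 (floor h (suc m) y 0)))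
  two-neighbours {even (suc m) y (suc k)} e = ≤-reflexive (trans
    (length-++₄ (eastward h (suc m) y (suc k)) (westward h (suc m) y (suc k)) (when (floor h (suc m) y (suc k)) _) _
       (length-when (h (suc m) y k west) _) (length-when (h m y (suc k) east) _) (length-when (floor h (suc m) y (suc k)) _)
       (length-when (h m (suc y) k south) _))
       (even-degree m y k (suc-injective (trans (sym (+-suc (suc m + y) k)) (~-inside e)))))

  open Trails _≟ᴾ_ _~[ P , h ]_ using (End; end-unique)

  ends-unique : ∀ {u v v′} → End u → End v → End v′ → u ≢ v → u ≢ v′ → Linked P h u v → Linked P h u v′ → v ≡ v′
  ends-unique = end-unique (λ { (fwd e) → bwd e ; (bwd e) → fwd e })
    λ p q r → at-most-two (two-neighbours p) (∈neighbours p) (∈neighbours q) (∈neighbours r)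

  end : ∀ {u} → length (neighbours h u) ≤ 1 → End u
  end l p q = at-most-one l (∈neighbours p) (∈neighbours q)

  leg-end : ∀ {m k} → End (leg m k)
  leg-end = end ≤-refl

  -- The letter 1 means that the vertical edge is missing, which leaves only the horizontal one.
  left-end : ∀ {y k} → y + k ≡ suc P → a y k ≡ true → End (even 0 y k)
  left-end {y} {k} p e = end (subst (λ b → length (neighbours h (even 0 y k)) ≤ 1 + ⟦ b ⟧)
    (trans (left-floor y k p) (cong not e)) (left-neighbours y k))

  right-end : ∀ {m y} → m + y ≡ suc P → c m y ≡ false → End (even m y 0)
  right-end {m} {y} p e = end (subst (λ b → length (neighbours h (even m y 0)) ≤ 1 + ⟦ b ⟧)
    (trans (right-floor m y p) e) (right-neighbours m y))

-- The drift

raise-middle : ∀ m {y k j} → m + y + k ≡ j → m + suc y + k ≡ suc j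
raise-middle m {y} {k} p = trans (cong (_+ k) (+-suc m y)) (cong suc p)

raise-last : ∀ m {y k j} → m + y + k ≡ j → m + y + suc k ≡ suc j
raise-last m {y} {k} p = trans (+-suc (m + y) k) (cong suc p)

drop-zero : ∀ m {k j} → m + 0 + k ≡ j → m + k ≡ j
drop-zero m {k} p = trans (cong (_+ k) (sym (+-identityʳ m))) p

add-zero : ∀ m {k j} → m + k ≡ j → m + 0 + k ≡ j
add-zero m {k} p = trans (cong (_+ k) (+-identityʳ m)) p

⟦⟧+⟦not⟧ : ∀ b → ⟦ b ⟧ + ⟦ not b ⟧ ≡ 1
⟦⟧+⟦not⟧ true  = refl
⟦⟧+⟦not⟧ false = refl

⟦⟧-injective : ∀ {b b′} → ⟦ b ⟧ ≡ ⟦ b′ ⟧ → b ≡ b′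
⟦⟧-injective {true}  {true}  _ = refl
⟦⟧-injective {false} {false} _ = refl

-- How the letters 1 of the word a₁ arise from those of a when a ⟶ a₁: each of them
-- stays at its place or moves to the preceding one.
record Strip (P : ℕ) (a a₁ stay move : Letters) : Set where
  field
    split  : ∀ i k → i + k ≡ suc P → ⟦ stay i k ⟧ + ⟦ move i k ⟧ ≡ ⟦ a i k ⟧
    merge  : ∀ i k → i + k ≡ P → ⟦ stay i (suc k) ⟧ + ⟦ move (suc i) k ⟧ ≡ ⟦ a₁ i (suc k) ⟧
    finish : stay (suc P) 0 ≡ a₁ (suc P) 0
    start  : move 0 (suc P) ≡ false

-- The equation for `stay` in `moves` is what decides the conditional in `retract′`.
data Shift (stay move : Letters) : ℕ → ℕ → ℕ → ℕ → Set where
  stays : ∀ {i k} → stay i k ≡ true → Shift stay move i k i k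
  moves : ∀ {i k} → stay (suc i) k ≡ false → move (suc i) k ≡ true → Shift stay move (suc i) k i (suc k)

one-of : ∀ {x y z} → ⟦ x ⟧ + ⟦ y ⟧ ≡ ⟦ z ⟧ → z ≡ true → x ≡ true × y ≡ false ⊎ x ≡ false × y ≡ true
one-of {true}  {false} _ refl = inj₁ (refl , refl)
one-of {false} {true}  _ refl = inj₂ (refl , refl)

either-of : ∀ {x y z} → ⟦ x ⟧ + ⟦ y ⟧ ≡ ⟦ z ⟧ → x ≡ true ⊎ y ≡ true → z ≡ true
either-of {true}  {false} {true} _ _ = refl
either-of {false} {true}  {true} _ _ = refl
either-of {false} {false} _ (inj₁ ())
either-of {false} {false} _ (inj₂ ())

module _ {P a a₁ stay move} (S : Strip P a a₁ stay move) where
  open Strip S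

  shift-forward : ∀ i k → i + k ≡ suc P → a i k ≡ true →
                  ∃₂ λ i′ k′ → i′ + k′ ≡ suc P × a₁ i′ k′ ≡ true × Shift stay move i k i′ k′
  shift-forward i k p e with one-of {stay i k} (split i k p) e
  shift-forward i zero p e | inj₁ (s , _) with refl ← trans (sym (+-identityʳ i)) p = i , 0 , p , trans (sym finish) s , stays s
  shift-forward i (suc k) p e | inj₁ (s , _) =
    i , suc k , p , either-of {stay i (suc k)} (merge i k (suc-injective (trans (sym (+-suc i k)) p))) (inj₁ s) , stays s
  shift-forward zero k p e | inj₂ (_ , m) with refl ← p with () ← trans (sym m) start
  shift-forward (suc i) k p e | inj₂ (s , m) =
    i , suc k , trans (+-suc i k) p , either-of {stay i (suc k)} (merge i k (suc-injective p)) (inj₂ m) , moves s m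

  shift-backward : ∀ i k → i + k ≡ suc P → a₁ i k ≡ true →
                   ∃₂ λ i′ k′ → i′ + k′ ≡ suc P × a i′ k′ ≡ true × Shift stay move i′ k′ i k
  shift-backward i zero p e with refl ← trans (sym (+-identityʳ i)) p =
    i , 0 , p , either-of {stay i 0} (split i 0 p) (inj₁ (trans finish e)) , stays (trans finish e)
  shift-backward i (suc k) p e with one-of {stay i (suc k)} (merge i k (suc-injective (trans (sym (+-suc i k)) p))) e
  ... | inj₁ (s , _) = i , suc k , p , either-of {stay i (suc k)} (split i (suc k) p) (inj₁ s) , stays s
  ... | inj₂ (_ , m) = suc i , k , q , a≡ , moves stay≡ m
    where
    q = trans (sym (+-suc i k)) p
    a≡ : a (suc i) k ≡ true
    a≡ = either-of {stay (suc i) k} (split (suc i) k q) (inj₂ m)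
    stay≡ : stay (suc i) k ≡ false
    stay≡ with one-of {stay (suc i) k} (split (suc i) k q) a≡
    ... | inj₁ (_ , m′) with () ← trans (sym m) m′
    ... | inj₂ (s , _) = s

-- The cells of the drift.  The cell (m , y , k) has the corners odd (m - 1) y k (nw),
-- even m y k (ne), odd m (y - 1) k (se) and even m (y - 1) (k + 1) (sw); on the left
-- boundary m = 0 the top and left sides encode the strip.
extend : Letters → Letters → Config → Cells
extend stay move h m y k = cell (bottomSide y) (floor h m y k) (topSide m) (leftSide m)
  where
  bottomSide : ℕ → Bool
  -- In a cell with y = 0 the external edge is the right side, and nothing lies below it.
  bottomSide zero    = false
  bottomSide (suc y) = h m y k west
  topSide leftSide : ℕ → Bool
  topSide zero    = stay y k
  topSide (suc m) = h m y k east
  leftSide zero    = move y k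
  leftSide (suc m) = h m y k south

-- The cells contribute the sides of the same cells of the triangle moved one unit to the right.
read : Cells → Config
read Y m y k west  = top (Y m y (suc k))
read Y m y k east  = bot (Y m (suc y) k)
read Y m y k north = lft (Y m (suc y) k)
read Y m y k south = rgt (Y m y (suc k))

drifted : Cells → Cells
drifted X m y k = drift (X m y k)

drifted-balanced : ∀ {P X} → Balanced P X → Balanced P (drifted X)
drifted-balanced {P} {X} B = record
  { black-degree = λ m y k p → complement (X m y (suc k)) ne (X m (suc y) k) sw (black-degree m y k p)
  ; white-degree = λ m y k p → complement (X (suc m) y k) nw (X m (suc y) k) se (white-degree m y k p) }
  where
  open Balanced B
  complement : ∀ c κ c′ κ′ → deg c κ + deg c′ κ′ ≡ 2 → deg (drift c) κ + deg (drift c′) κ′ ≡ 2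
  complement c κ c′ κ′ e = +-cancelʳ-≡ 2 (d + d′) 2
    (trans (cong (d + d′ +_) (sym e)) (trans (interchange d d′ (deg c κ) (deg c′ κ′)) (cong₂ _+_ (deg-drift c κ) (deg-drift c′ κ′))))
    where
    d  = deg (drift c) κ
    d′ = deg (drift c′) κ′

-- If the top is present and the bottom is not, the cell is not parallel and its complement has the
-- bottom. If both are present, the hypothesis makes the cell parallel, and it stays.
drift-bot : ∀ c → top c ≡ true → (bot c ≡ true → rgt c ≡ false × lft c ≡ false) → bot (drift c) ≡ true
drift-bot (cell false true  _ true)  refl f = refl
drift-bot (cell false true  _ false) refl f = refl
drift-bot (cell false false _ true)  refl f = refl
drift-bot (cell false false _ false) refl f = refl
drift-bot (cell true r _ l) refl f with f refl
... | refl , refl = refl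

drift-top : ∀ c → bot c ≡ true → (top c ≡ true → rgt c ≡ false × lft c ≡ false) → top (drift c) ≡ true
drift-top (cell _ true  false true)  refl f = refl
drift-top (cell _ true  false false) refl f = refl
drift-top (cell _ false false true)  refl f = refl
drift-top (cell _ false false false) refl f = refl
drift-top (cell _ r true l) refl f with f refl
... | refl , refl = refl

drift-bottom-row : ∀ c → bot c ≡ false → rgt c ≡ true → lft c ≡ false → drift c ≡ cell true false (not (top c)) true
drift-bottom-row (cell _ _ true  _) refl refl refl = refl
drift-bottom-row (cell _ _ false _) refl refl refl = refl

module _ {P a c M h} (T : TFPL P a c M h) where
  open TFPL T

  -- A letter 1 gives the vertical edge below its right boundary vertex, and the required horizontal
  -- edge leads on to the next such vertex. The descent stops at a letter 0 or at the last external
  -- edge.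
  right-chain : ∀ m y → m + y ≡ suc P →
    (∃₂ λ j l → m ≤ j × j + l ≡ suc P × c j l ≡ false × Linked P h (even m y 0) (even j l 0))
    ⊎ (∃₂ λ j l → Linked P h (even m y 0) (leg j l))
  right-chain m y p with c m y in e
  right-chain m y p | false = inj₁ (m , y , ≤-refl , p , e , ε)
  right-chain m zero p | true = inj₂ (m , 0 , bwd (legLink p) ◅ ε)
  right-chain m (suc y) p | true with right-chain (suc m) y (trans (sym (+-suc m y)) p)
  ... | r = continue r
    where
    q : m + y ≡ P
    q = suc-injective (trans (sym (+-suc m y)) p)
    two-steps : Linked P h (even m (suc y) 0) (even (suc m) y 0)
    two-steps = bwd (link north (trans (+-identityʳ _) q) (trans (right-floor m (suc y) p) e))
              ◅ fwd (link east (trans (+-identityʳ _) q) (right-edge m y q)) ◅ ε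
    continue : _ → _
    continue (inj₁ (j , l , m<j , q′ , f , s)) = inj₁ (j , l , ≤-trans (n≤1+n m) m<j , q′ , f , two-steps ◅◅ s)
    continue (inj₂ (j , l , s)) = inj₂ (j , l , two-steps ◅◅ s)

  -- Such a path would lead from one right boundary vertex down to the next one
  -- and along the right boundary to another end, but it comes from the left boundary.
  no-return : ∀ m y → suc m + y ≡ P → c (suc m) (suc y) ≡ false →
              h m (suc y) 0 south ≡ true → h (suc m) y 0 west ≡ true → ⊥
  no-return m y p e south≡ west≡ with right-path (suc m) (suc y) q e | right-chain (suc (suc m)) y (cong suc p)
    where
    q : suc m + suc y ≡ suc P
    q = trans (+-suc (suc m) y) (cong suc p)
  ... | i , k , q′ , f , s | r = conclude r
    where
    q : suc m + suc y ≡ suc P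
    q = trans (+-suc (suc m) y) (cong suc p)
    p′ : m + suc y ≡ P
    p′ = trans (+-suc m y) p
    -- One step west, one south and two east.
    around : Linked P h (even (suc m) (suc y) 0) (even (suc (suc m)) y 0)
    around = bwd (link east (trans (+-identityʳ _) p′) (right-edge m (suc y) p′))
           ◅ fwd (link south (trans (+-identityʳ _) p′) south≡)
           ◅ bwd (link west (trans (+-identityʳ _) p) west≡)
           ◅ fwd (link east (trans (+-identityʳ _) p) (right-edge (suc m) y p)) ◅ ε
    conclude : _ → ⊥
    conclude (inj₁ (j , l , 2+m≤j , q″ , f′ , s′))
      with refl ← ends-unique T (right-end T q e) (left-end T q′ f) (right-end T q″ f′)
                    (λ ()) (λ { refl → <-irrefl refl 2+m≤j }) (symˡ s) (around ◅◅ s′)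
      with () ← 2+m≤j
    conclude (inj₂ (j , l , s′))
      with () ← ends-unique T (right-end T q e) (left-end T q′ f) (leg-end T) (λ ()) (λ ()) (symˡ s) (around ◅◅ s′)

module Drift {P a a₁ stay move c M h} (S : Strip P a a₁ stay move) (T : TFPL P a₁ c M h) where
  open Strip S
  open TFPL T

  X Y : Cells
  X = extend stay move h
  Y = drifted X

  g : Config
  g = read Y

  c₁ stay′ move′ : Letters
  c₁ m y = lft (Y m y 0)
  stay′ y m = top (Y m y 0)
  move′ y m = rgt (Y m y 0)

  private
    ⟦⟧+⟦not⟧′ : ∀ s f v A → f ≡ not A → ⟦ s ⟧ + ⟦ v ⟧ ≡ ⟦ A ⟧ → ⟦ s ⟧ + ⟦ f ⟧ + (1 + ⟦ v ⟧) ≡ 2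
    ⟦⟧+⟦not⟧′ s _ v A refl e = trans (swap ⟦ s ⟧ ⟦ not A ⟧ ⟦ v ⟧) (cong suc (trans (cong (_+ ⟦ not A ⟧) e) (⟦⟧+⟦not⟧ A)))
      where
      swap : ∀ s f v → s + f + (1 + v) ≡ suc (s + v + f)
      swap = solve-∀

    a₁-first : a₁ 0 (suc P) ≡ false
    a₁-first = sym (Bool-flip (left-floor 0 (suc P) refl))

    top-left : ∀ {i k} → i + k ≡ suc P → stay i k ≡ true → move i k ≡ false
    top-left {i} {k} p s with stay i k | move i k | a i k | split i k p
    ... | true | false | _ | _ = refl
    top-left p () | false | _ | _ | _
    top-left p refl | true | true | true | ()

    a-last : a (suc P) 0 ≡ true
    a-last = either-of {stay (suc P) 0} (split (suc P) 0 (+-identityʳ _)) (inj₁ (trans finish summit))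

    move-last : move (suc P) 0 ≡ false
    move-last = top-left (+-identityʳ _) (trans finish summit)

    stay-first : stay 0 (suc P) ≡ false
    stay-first with stay 0 (suc P) in e | merge 0 P refl
    ... | false | _ = refl
    ... | true  | s rewrite a₁-first with () ← s

  balanced : Balanced P X
  balanced = record { black-degree = at-black ; white-degree = at-white }
    where
    rearrange : ∀ e f w s → e + f + (w + s) ≡ w + e + f + s
    rearrange = solve-∀
    rearrange′ : ∀ s e n w → s + e + (n + w) ≡ w + e + n + s
    rearrange′ = solve-∀
    at-black : ∀ m y k → m + y + k ≡ P → deg (X m y (suc k)) ne + deg (X m (suc y) k) sw ≡ 2
    -- At a left boundary vertex the strip contributes an edge when the letter of `a₁` is 1, the
    -- vertical edge is there when it is 0, and the horizontal edge makes up the total of 2.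
    at-black zero y k p rewrite left-edge y k p =
      ⟦⟧+⟦not⟧′ (stay y (suc k)) _ (move (suc y) k) (a₁ y (suc k)) (left-floor y (suc k) (raise-last 0 p)) (merge y k p)
    at-black (suc m) y k p = trans (rearrange ⟦ h m y (suc k) east ⟧ ⟦ floor h (suc m) y (suc k) ⟧ ⟦ h (suc m) y k west ⟧ ⟦ h m (suc y) k south ⟧) (even-degree m y k p)
    at-white : ∀ m y k → m + y + k ≡ P → deg (X (suc m) y k) nw + deg (X m (suc y) k) se ≡ 2
    at-white m y k p = trans (rearrange′ ⟦ h m y k south ⟧ ⟦ h m y k east ⟧ ⟦ h m y k north ⟧ ⟦ h m y k west ⟧) (odd-degree m y k p)

  balanced′ : Balanced P Y
  balanced′ = drifted-balanced balanced

  open Balanced balanced′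

  bottom-row : ∀ m k → m + k ≡ suc P → Y m 0 k ≡ cell true false (not (top (X m 0 k))) true
  bottom-row zero    k refl = drift-bottom-row (X 0 0 k) refl refl start
  bottom-row (suc m) k p = drift-bottom-row (X (suc m) 0 k) refl refl (bottom m k (suc-injective p))

  -- Where `stay` holds, the letter of `a₁` is 1, so the vertical edge is missing and the cell is
  -- parallel.
  left-top : ∀ y k → y + k ≡ suc P → top (Y 0 y k) ≡ true
  left-top zero    k refl = trans (cong top (bottom-row 0 k refl)) (cong not stay-first)
  left-top (suc y) k p = drift-top (X 0 (suc y) k) (left-edge y k (suc-injective p)) λ s → floor≡ s , top-left p s
    where
    floor≡ : stay (suc y) k ≡ true → floor h 0 (suc y) k ≡ false
    floor≡ s = trans (left-floor (suc y) k p) (cong not (a₁≡ k p s))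
      where
      a₁≡ : ∀ k → suc y + k ≡ suc P → stay (suc y) k ≡ true → a₁ (suc y) k ≡ true
      a₁≡ zero    p s with refl ← trans (sym (+-identityʳ (suc y))) p = trans (sym finish) s
      a₁≡ (suc k) p s = either-of {stay (suc y) (suc k)} (merge (suc y) k (suc-injective (trans (sym (+-suc (suc y) k)) p))) (inj₁ s)

  -- The outer corner has degree 1 or 0 according to the letter of `a`, hence 1 or 2 after the
  -- drift, and the top side accounts for 1 of it.
  left-side : ∀ y k → y + k ≡ suc P → lft (Y 0 y k) ≡ not (a y k)
  left-side y k p = conclude (lft (Y 0 y k)) (top (Y 0 y k)) (move y k) (stay y k) (a y k)
                      (left-top y k p) (deg-drift (X 0 y k) nw) (split y k p)
    where
    conclude : ∀ l t l′ t′ A → t ≡ true → ⟦ l ⟧ + ⟦ t ⟧ + (⟦ l′ ⟧ + ⟦ t′ ⟧) ≡ 2 → ⟦ t′ ⟧ + ⟦ l′ ⟧ ≡ ⟦ A ⟧ → l ≡ not A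
    conclude true  _ _     _     false refl _ _ = refl
    conclude false _ _     _     true  refl _ _ = refl
    conclude true  _ true  false true  refl () _
    conclude true  _ false true  true  refl () _
    conclude false _ false false false refl () _

  right-top : ∀ m y → m + y ≡ suc P → top (X m y 0) ≡ true
  right-top zero    y refl = trans finish summit
  right-top (suc m) y p = right-edge m y (suc-injective p)

  -- The first nonlocal point. A west edge next to the required east edge rules out the north edge
  -- by degree; the remaining side is ruled out by `no-return`, so the cell is parallel.
  right-bottom : ∀ m y → m + y ≡ P → bot (Y m (suc y) 0) ≡ true
  right-bottom m y p = drift-bot (X m (suc y) 0) (right-top m (suc y) (trans (+-suc m y) (cong suc p))) (others m p)
    where
    others : ∀ m → m + y ≡ P → h m y 0 west ≡ true → rgt (X m (suc y) 0) ≡ false × lft (X m (suc y) 0) ≡ false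
    others zero refl _ = trans (left-floor (suc P) 0 (+-identityʳ _)) (cong not summit) , move-last
    others (suc m) p w = r≡ , l≡
      where
      r≡ : h (suc m) y 0 north ≡ false
      r≡ with h (suc m) y 0 north in e | odd-degree (suc m) y 0 (trans (+-identityʳ _) p)
      ... | false | _ = refl
      ... | true  | d rewrite w | right-edge (suc m) y p with () ← d
      l≡ : h m (suc y) 0 south ≡ false
      l≡ with h m (suc y) 0 south in e
      ... | false = refl
      ... | true  = ⊥-elim (no-return T m y p
        (trans (sym (right-floor (suc m) (suc y) (trans (+-suc (suc m) y) (cong suc p)))) r≡) e w)

  -- The corner at the right boundary has degree 1 plus the letter of `c`, and the drift turns this
  -- into 1 minus that letter.
  right-degree : ∀ m y → m + y ≡ suc P → ⟦ stay′ y m ⟧ + ⟦ move′ y m ⟧ ≡ ⟦ not (c m y) ⟧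
  right-degree m y p = conclude (top (Y m y 0)) (rgt (Y m y 0)) _ _ _ (right-top m y p) (right-floor m y p) (deg-drift (X m y 0) ne)
    where
    conclude : ∀ t r t′ r′ C → t′ ≡ true → r′ ≡ C → ⟦ t ⟧ + ⟦ r ⟧ + (⟦ t′ ⟧ + ⟦ r′ ⟧) ≡ 2 → ⟦ t ⟧ + ⟦ r ⟧ ≡ ⟦ not C ⟧
    conclude true  false _ _ false refl refl _ = refl
    conclude false true  _ _ false refl refl _ = refl
    conclude false false _ _ true  refl refl _ = refl

  -- The last letter of `a₁` is a 1 that has stayed, by `finish`. So the topmost cell consists of
  -- its two horizontal sides and is parallel.
  summit-cell : Y 0 (suc P) 0 ≡ cell true false true false
  summit-cell rewrite left-edge P 0 (+-identityʳ _) | trans finish summit | move-last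
    | trans (left-floor (suc P) 0 (+-identityʳ _)) (cong not summit) = refl

  -- `merge` is the balance at a new right boundary vertex, where `right-bottom` accounts for one
  -- edge; `split` is the degree beyond the boundary. Positions are those in the conjugate words, so
  -- the coordinate y comes first.
  strip′ : Strip P (mirror-letters c) (mirror-letters c₁) stay′ move′
  strip′ = record
    { split  = λ y m p → right-degree m y (trans (+-comm m y) p)
    ; merge  = λ y m p → conclude (lft (Y (suc m) y 0)) (top (Y (suc m) y 0)) (rgt (Y m (suc y) 0)) (bot (Y m (suc y) 0))
                 (white-degree m y 0 (trans (+-identityʳ _) (trans (+-comm m y) p))) (right-bottom m y (trans (+-comm m y) p))
    ; finish = trans (cong top summit-cell) (sym (cong (not ∘ lft) summit-cell))
    ; start  = cong rgt (bottom-row (suc P) 0 (+-identityʳ _)) }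
    where
    conclude : ∀ l t r b → ⟦ l ⟧ + ⟦ t ⟧ + (⟦ r ⟧ + ⟦ b ⟧) ≡ 2 → b ≡ true → ⟦ t ⟧ + ⟦ r ⟧ ≡ ⟦ not l ⟧
    conclude true  false false _ _ refl = refl
    conclude false true  false _ _ refl = refl
    conclude false false true  _ _ refl = refl
    conclude true  true  true  _ () refl
    conclude false true  true  _ () refl
    conclude true  true  false _ () refl
    conclude true  false true  _ () refl
    conclude false false false _ () refl

  -- Odd points are white sites here and black ones in `embed′`: the move by one unit exchanges the
  -- two classes of the bipartition.
  embed : Point → Site
  embed (even m y k) = black m (suc y) k
  embed (odd m y k)  = white (suc m) (suc y) k
  embed (leg m k)    = white (suc m) 0 k

  embed-linked : ∀ {u v} → Linked P h u v → Connected P X (embed u) (embed v)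
  embed-linked = Eq.gfold (Eq.isEquivalence _) embed one
    where
    one : ∀ {u v} → Link P h u v → Connected P X (embed u) (embed v)
    one (link {m} west p e)  = bwd (wire sw (raise-middle m p) e) ◅ ε
    one (link east p e)      = bwd (wire ne (cong suc p) e) ◅ ε
    one (link {m} north p e) = fwd (wire se (raise-middle m p) e) ◅ ε
    one (link {m} {zero} south p e) = ε
    one (link {m} {suc y} south p e) = fwd (wire nw (cong suc p) e) ◅ ε
    one (legLink {m} p) = fwd (wire se (add-zero m p) refl) ◅ ε

  -- A site beyond the left boundary slides along its strip edge to the boundary, so that
  -- connections through the strip become paths of `h`.
  retract : Site → Point
  retract (black m (suc y) k)       = even m y k
  retract (black m zero k)          = leg m k
  retract (white (suc m) (suc y) k) = odd m y k
  retract (white (suc m) zero k)    = leg m k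
  retract (white zero (suc y) k)    = if stay y k then even 0 y k else even 0 (pred y) (suc k)
  retract (white zero zero k)       = leg 0 k

  retract-connected : ∀ {u v} → Connected P X u v → Linked P h (retract u) (retract v)
  retract-connected = Eq.gfold (Eq.isEquivalence _) retract one
    where
    one : ∀ {u v} → Wire P X u v → Linked P h (retract u) (retract v)
    one (wire {m} {suc y} sw p e) = bwd (link west (sum-middle m p) e) ◅ ε
    one (wire {m} {zero} se p e) = fwd (legLink (drop-zero m p)) ◅ ε
    one (wire {m} {suc y} se p e) = fwd (link north (sum-middle m p) e) ◅ ε
    one (wire {zero} {y} {k} ne p e) rewrite e = ε
    one (wire {suc m} ne p e) = bwd (link east (suc-injective p) e) ◅ ε
    one (wire {zero} {zero} nw refl e) with () ← trans (sym e) start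
    one (wire {zero} {suc y} {k} nw p e) with stay (suc y) k in s
    ... | true with () ← trans (sym e) (top-left p s)
    ... | false = ε
    one (wire {suc m} {zero} {k} nw p e) with () ← trans (sym e) (bottom m k (suc-injective (drop-zero (suc m) p)))
    one (wire {suc m} {suc y} nw p e) = fwd (link south (suc-injective p) e) ◅ ε

  embed′ : Point → Site
  embed′ (even m y k) = white m (suc y) k
  embed′ (odd m y k)  = black m (suc y) (suc k)
  embed′ (leg m k)    = black m 0 (suc k)

  embed-linked′ : ∀ {u v} → Linked P g u v → Connected P Y (embed′ u) (embed′ v)
  embed-linked′ = Eq.gfold (Eq.isEquivalence _) embed′ one
    where
    one : ∀ {u v} → Link P g u v → Connected P Y (embed′ u) (embed′ v)
    one (link {m} west p e)  = fwd (wire ne (raise-last m p) e) ◅ ε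
    one (link {m} east p e)  = fwd (wire sw (raise-middle m p) e) ◅ ε
    one (link {m} north p e) = bwd (wire nw (raise-middle m p) e) ◅ ε
    one (link {m} {zero} south p e) = ε
    one (link {m} {suc y} south p e) = bwd (wire se (raise-last m p) e) ◅ ε
    one (legLink {m} {k} p) = bwd (wire nw (add-zero m p) (cong lft (bottom-row m k p))) ◅ ε

  -- The drift adds the bottom side to each cell with y = 0; both ends of that side go to the foot
  -- of the external edge. Sites beyond the right boundary slide along the new strip.
  retract′ : Site → Point
  retract′ (white m (suc y) k)       = even m y k
  retract′ (white (suc m) zero k)    = leg m k
  retract′ (white zero zero k)       = leg 0 k
  retract′ (black m (suc y) (suc k)) = odd m y k
  retract′ (black m zero (suc k))    = leg m k
  retract′ (black m (suc y) zero)    = if stay′ y m then even m y 0 else even (suc m) (pred y) 0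
  retract′ (black m zero zero)       = leg m 0

  retract-connected′ : ∀ {u v} → Connected P Y u v → Linked P g (retract′ u) (retract′ v)
  retract-connected′ = Eq.gfold (Eq.isEquivalence _) retract′ one
    where
    no-rgt : ∀ m k → m + 0 + k ≡ suc P → rgt (Y m 0 k) ≡ true → ⊥
    no-rgt m k p e with () ← trans (sym e) (cong rgt (bottom-row m k (drop-zero m p)))
    one : ∀ {u v} → Wire P Y u v → Linked P g (retract′ u) (retract′ v)
    one (wire {m} {zero} sw p e)  = ε
    one (wire {m} {suc y} sw p e) = fwd (link east (sum-middle m p) e) ◅ ε
    one (wire {m} {zero} {k} se p e)  = ⊥-elim (no-rgt m k p e)
    one (wire {m} {suc y} {zero} se p e) with stay′ (suc y) m in s
    ... | false = ε
    ... | true with right-degree m (suc y) (trans (sym (+-identityʳ _)) p)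
    ...   | d rewrite s | e with not (c m (suc y)) | d
    ...     | true  | ()
    ...     | false | ()
    one (wire {m} {suc y} {suc k} se p e) = bwd (link south (suc-injective (trans (sym (+-suc (m + suc y) k)) p)) e) ◅ ε
    one (wire {m} {y} {zero} ne p e) rewrite e = ε
    one (wire {m} {y} {suc k} ne p e) = fwd (link west (suc-injective (trans (sym (+-suc (m + y) k)) p)) e) ◅ ε
    one (wire {m} {zero} nw p e)  = bwd (legLink (drop-zero m p)) ◅ ε
    one (wire {m} {suc y} nw p e) = bwd (link north (sum-middle m p) e) ◅ ε

  left-attached : ∀ {i k i′ k′} → i + k ≡ suc P → Shift stay move i k i′ k′ →
                  Connected P X (white 0 (suc i) k) (embed (even 0 i′ k′))
  left-attached p (stays s)   = bwd (wire ne p s) ◅ ε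
  left-attached p (moves s m) = fwd (wire nw p m) ◅ ε

  right-attached : ∀ {l j l′ j′} → Shift stay′ move′ l j l′ j′ → retract′ (black j (suc l) 0) ≡ even j′ l′ 0
  right-attached (stays s)   rewrite s = refl
  right-attached (moves s m) rewrite s = refl

  -- The path is prolonged by its strip edge on the left. In the extended array both of its ends
  -- then have degree 1 in their only cell, so the drift keeps them connected; on the right the new
  -- strip edge leads to the new end.
  across : ∀ {i k i′ k′ j l} → i + k ≡ suc P → a i k ≡ true → Shift stay move i k i′ k′ →
           j + l ≡ suc P → c j l ≡ false → Linked P h (even 0 i′ k′) (even j l 0) →
           Linked P g (even 0 i k) (retract′ (black j (suc l) 0))
  across {i} {k} {j = j} {l} p e sh q f s = retract-connected′ (drift-connected {Y = Y} (λ _ _ _ _ → refl) balanced start-degree ne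
      (trans (+-identityʳ _) q) end-degree (left-attached p sh ◅◅ embed-linked s))
    where
    start-degree : ∀ {m y k′} κ → m + y + k′ ≡ suc P → corner κ m y k′ ≡ white 0 (suc i) k → deg (X m y k′) κ ≡ 1
    start-degree nw _ refl = trans (+-comm ⟦ move i k ⟧ _) (trans (split i k p) (cong ⟦_⟧ e))
    end-degree : deg (X j l 0) ne ≡ 1
    end-degree = cong₂ (λ x y → ⟦ x ⟧ + ⟦ y ⟧) (right-top j l q) (trans (right-floor j l q) f)

  drift-TFPL : TFPL P a c₁ M g
  drift-TFPL = record
    { bottom      = λ m k p → cong rgt (bottom-row m (suc k) (trans (+-suc m k) (cong suc p)))
    ; odd-degree  = λ m y k p → trans (rearrange ⟦ g m y k west ⟧ ⟦ g m y k east ⟧ ⟦ g m y k north ⟧ ⟦ g m y k south ⟧) (black-degree m y k p)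
    ; even-degree = λ m y k p → trans (cong (λ z → ⟦ top (Y (suc m) y (suc k)) ⟧ + ⟦ bot (Y m (suc y) (suc k)) ⟧ + ⟦ z ⟧ + ⟦ rgt (Y m (suc y) (suc k)) ⟧)
                      (floor≡ (suc m) y (suc k) (raise-last (suc m) p)))
                    (trans (rearrange′ ⟦ top (Y (suc m) y (suc k)) ⟧ ⟦ bot (Y m (suc y) (suc k)) ⟧ ⟦ lft (Y (suc m) y (suc k)) ⟧ ⟦ rgt (Y m (suc y) (suc k)) ⟧) (white-degree m y (suc k) (trans (+-suc (m + y) k) p)))
    ; left-edge   = λ y k p → left-top y (suc k) (trans (+-suc y k) (cong suc p))
    ; left-floor  = λ y k p → trans (floor≡ 0 y k p) (left-side y k p)
    ; right-edge  = right-bottom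
    ; right-floor = λ m y p → floor≡ m y 0 (trans (+-identityʳ _) p)
    ; summit      = a-last
    ; left-path   = λ i k p e → case shift-forward S i k p e of λ { (i′ , k′ , p′ , e′ , sh) →
        case left-path i′ k′ p′ e′ of λ { (j , l , q , f , s) →
        case shift-forward strip′ l j (trans (+-comm l j) q) (cong not f) of λ { (l′ , j′ , q′ , f′ , sh′) →
          j′ , l′ , trans (+-comm j′ l′) q′ , trans (sym (Bool.not-involutive _)) (cong not f′)
          , subst (Linked P g _) (right-attached sh′) (across p e sh q f s) } } }
    ; right-path  = λ j′ l′ q′ f′ → case shift-backward strip′ l′ j′ (trans (+-comm l′ j′) q′) (cong not f′) of λ { (l , j , q , f , sh′) →
        case right-path j l (trans (+-comm j l) q) (trans (sym (Bool.not-involutive _)) (cong not f)) of λ { (i′ , k′ , p′ , e′ , s) →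
        case shift-backward S i′ k′ p′ e′ of λ { (i , k , p , e , sh) →
          i , k , p , e , subst (Linked P g _) (right-attached sh′)
            (across p e sh (trans (+-comm j l) q) (trans (sym (Bool.not-involutive _)) (cong not f)) s) } } }
    ; leg-path    = λ i k j l p q i<j → let open Equivalence (leg-path i k j l p q i<j) in
        mk⇔ (λ s → to (backward p q s)) (λ m → forward p q (from m)) }
    where
    rearrange : ∀ w e n s → w + e + n + s ≡ w + s + (e + n)
    rearrange = solve-∀
    rearrange′ : ∀ t b l r → t + b + l + r ≡ l + t + (r + b)
    rearrange′ = solve-∀
    floor≡ : ∀ m y k → m + y + k ≡ suc P → floor g m y k ≡ lft (Y m y k)
    floor≡ m zero    k p = sym (cong lft (bottom-row m k (drop-zero m p)))
    floor≡ m (suc y) k p = refl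
    foot-degree : ∀ {i k} → i + k ≡ suc P → ∀ {m y k′} κ → m + y + k′ ≡ suc P → corner κ m y k′ ≡ white (suc i) 0 k → deg (X m y k′) κ ≡ 1
    foot-degree _ se _ refl = refl
    foot-degree′ : ∀ {i k} → i + k ≡ suc P → ∀ {m y k′} κ → m + y + k′ ≡ suc P → corner κ m y k′ ≡ white (suc i) 0 k → deg (Y m y k′) κ ≡ 1
    foot-degree′ {i} {k} p se _ refl rewrite bottom-row i k p = refl
    forward : ∀ {i k j l} → i + k ≡ suc P → j + l ≡ suc P → Linked P h (leg i k) (leg j l) → Linked P g (leg i k) (leg j l)
    forward {j = j} {l} p q s = retract-connected′ (drift-connected {Y = Y} (λ _ _ _ _ → refl) balanced (foot-degree p) {j} {0} {l} se
      (add-zero j q) refl (embed-linked s))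
    -- The corner `se` under an external edge has degree 1 before and after the drift, so the
    -- involution allows the same argument in reverse. After the drift that corner is attached to
    -- the foot by the bottom side.
    backward : ∀ {i k j l} → i + k ≡ suc P → j + l ≡ suc P → Linked P g (leg i k) (leg j l) → Linked P h (leg i k) (leg j l)
    backward {i} {k} {j} {l} p q s = retract-connected (drift-connected {X = Y} {Y = X} (λ m y k _ → sym (drift-involutive (X m y k))) balanced′
      (foot-degree′ p) {j} {0} {l} se (add-zero j q) (foot-degree′ {j} {l} q {j} {0} {l} se (add-zero j q) refl)
      (bwd (wire sw (add-zero i p) (cong bot (bottom-row i k p))) ◅ embed-linked′ s
        ◅◅ (fwd (wire sw (add-zero j q) (cong bot (bottom-row j l q))) ◅ ε)))

-- Injectivity of the drift and the Dyck property of the new word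

-- `start` gives the first `move`; then `split` gives each `stay` and `merge` the next `move`.
strip-unique : ∀ {P a a₁ a₁′ stay move stay′ move′} → Strip P a a₁ stay move → Strip P a a₁′ stay′ move′ →
               (∀ i k → i + k ≡ suc P → a₁ i k ≡ a₁′ i k) →
               ∀ i k → i + k ≡ suc P → stay i k ≡ stay′ i k × move i k ≡ move′ i k
strip-unique {P} {a} {a₁} {a₁′} {stay} {move} {stay′} {move′} S S′ a₁≡ = go
  where
  open Strip
  same-stay : ∀ i k → i + k ≡ suc P → move i k ≡ move′ i k → stay i k ≡ stay′ i k
  same-stay i k p e = ⟦⟧-injective (+-cancelʳ-≡ ⟦ move i k ⟧ _ _
    (trans (split S i k p) (trans (sym (split S′ i k p)) (cong (λ b → ⟦ stay′ i k ⟧ + ⟦ b ⟧) (sym e)))))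
  go : ∀ i k → i + k ≡ suc P → stay i k ≡ stay′ i k × move i k ≡ move′ i k
  go zero k refl = same-stay 0 k refl move≡ , move≡
    where
    move≡ : move 0 (suc P) ≡ move′ 0 (suc P)
    move≡ = trans (start S) (sym (start S′))
  go (suc i) k p = same-stay (suc i) k p move≡ , move≡
    where
    q : i + suc k ≡ suc P
    q = trans (+-suc i k) p
    move≡ : move (suc i) k ≡ move′ (suc i) k
    move≡ = ⟦⟧-injective (+-cancelˡ-≡ ⟦ stay i (suc k) ⟧ _ _
      (trans (merge S i k (suc-injective p)) (trans (cong ⟦_⟧ (a₁≡ i (suc k) q)) (trans (sym (merge S′ i k (suc-injective p)))
        (cong (λ b → ⟦ b ⟧ + ⟦ move′ (suc i) k ⟧) (sym (proj₁ (go i (suc k) q))))))))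

module _ {P a c M} {a₁ stay move h} (S : Strip P a a₁ stay move) (T : TFPL P a₁ c M h)
         {a₁′ stay′ move′ h′} (S′ : Strip P a a₁′ stay′ move′) (T′ : TFPL P a₁′ c M h′) where

  private
    module D  = Drift S T
    module D′ = Drift S′ T′

  -- The sides of the drifted cells are edges of the new configuration, except at the bottom, where
  -- `bottom-row` fixes them, and at the right boundary, where `strip-unique` recovers them from the
  -- words.
  drift-injective : (∀ m y k → m + y + k ≡ P → ∀ d → D.g m y k d ≡ D′.g m y k d) →
                    (∀ m y → m + y ≡ suc P → D.c₁ m y ≡ D′.c₁ m y) →
                    (∀ m y k → m + y + k ≡ P → ∀ d → h m y k d ≡ h′ m y k d) ×
                    (∀ i k → i + k ≡ suc P → a₁ i k ≡ a₁′ i k)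
  drift-injective g≡ c₁≡ = h≡ , a₁≡
    where
    strips≡ : ∀ y m → y + m ≡ suc P → D.stay′ y m ≡ D′.stay′ y m × D.move′ y m ≡ D′.move′ y m
    strips≡ = strip-unique D.strip′ D′.strip′ λ i k p → cong not (c₁≡ k i (trans (+-comm k i) p))
    bot≡ : ∀ m y k → m + y + k ≡ suc P → bot (D.Y m y k) ≡ bot (D′.Y m y k)
    bot≡ m zero    k p = trans (cong bot (D.bottom-row m k (drop-zero m p))) (sym (cong bot (D′.bottom-row m k (drop-zero m p))))
    bot≡ m (suc y) k p = g≡ m y k (sum-middle m p) east
    lft≡ : ∀ m y k → m + y + k ≡ suc P → lft (D.Y m y k) ≡ lft (D′.Y m y k)
    lft≡ m zero    k p = trans (cong lft (D.bottom-row m k (drop-zero m p))) (sym (cong lft (D′.bottom-row m k (drop-zero m p))))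
    lft≡ m (suc y) k p = g≡ m y k (sum-middle m p) north
    top≡ : ∀ m y k → m + y + k ≡ suc P → top (D.Y m y k) ≡ top (D′.Y m y k)
    top≡ m y zero    p = proj₁ (strips≡ y m (trans (+-comm y m) (trans (sym (+-identityʳ _)) p)))
    top≡ m y (suc k) p = g≡ m y k (suc-injective (trans (sym (+-suc (m + y) k)) p)) west
    rgt≡ : ∀ m y k → m + y + k ≡ suc P → rgt (D.Y m y k) ≡ rgt (D′.Y m y k)
    rgt≡ m y zero    p = proj₂ (strips≡ y m (trans (+-comm y m) (trans (sym (+-identityʳ _)) p)))
    rgt≡ m y (suc k) p = g≡ m y k (suc-injective (trans (sym (+-suc (m + y) k)) p)) south
    cell≡ : ∀ {c c′} → bot c ≡ bot c′ → rgt c ≡ rgt c′ → top c ≡ top c′ → lft c ≡ lft c′ → c ≡ c′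
    cell≡ refl refl refl refl = refl
    X≡ : ∀ m y k → m + y + k ≡ suc P → D.X m y k ≡ D′.X m y k
    X≡ m y k p = trans (sym (drift-involutive (D.X m y k)))
      (trans (cong drift (cell≡ {D.Y m y k} {D′.Y m y k} (bot≡ m y k p) (rgt≡ m y k p) (top≡ m y k p) (lft≡ m y k p)))
             (drift-involutive (D′.X m y k)))
    h≡ : ∀ m y k → m + y + k ≡ P → ∀ d → h m y k d ≡ h′ m y k d
    h≡ m y k p west  = cong bot (X≡ m (suc y) k (raise-middle m p))
    h≡ m y k p east  = cong top (X≡ (suc m) y k (cong suc p))
    h≡ m y k p north = cong rgt (X≡ m (suc y) k (raise-middle m p))
    h≡ m y k p south = cong lft (X≡ (suc m) y k (cong suc p))
    floor≡ : ∀ y k → y + k ≡ suc P → floor h 0 y k ≡ floor h′ 0 y k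
    floor≡ zero    k p = refl
    floor≡ (suc y) k p = h≡ 0 y k (suc-injective p) north
    a₁≡ : ∀ i k → i + k ≡ suc P → a₁ i k ≡ a₁′ i k
    a₁≡ i k p = trans (sym (Bool-flip (TFPL.left-floor T i k p))) (trans (cong not (floor≡ i k p)) (Bool-flip (TFPL.left-floor T′ i k p)))


-- A relation, because a word and a list of edges reproduce the result of the drift only at the
-- positions inside the triangle.
record Drifts (P : ℕ) (a a₁ c c₁ : Letters) (M : Pairing) (h g : Config) : Set where
  field
    {stay move} : Letters
    strip       : Strip P a a₁ stay move
    source      : TFPL P a₁ c M h
    g≡          : ∀ m y k → m + y + k ≡ P → ∀ d → Drift.g strip source m y k d ≡ g m y k d
    c₁≡         : ∀ i k → i + k ≡ suc P → Drift.c₁ strip source i k ≡ c₁ i k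

Drifts-injective : ∀ {P a a₁ a₁′ c c₁ M h h′ g} → Drifts P a a₁ c c₁ M h g → Drifts P a a₁′ c c₁ M h′ g →
                   (∀ m y k → m + y + k ≡ P → ∀ d → h m y k d ≡ h′ m y k d) × (∀ i k → i + k ≡ suc P → a₁ i k ≡ a₁′ i k)
Drifts-injective D D′ = drift-injective (strip D) (source D) (strip D′) (source D′)
  (λ m y k p d → trans (g≡ D m y k p d) (sym (g≡ D′ m y k p d))) (λ i k p → trans (c₁≡ D i k p) (sym (c₁≡ D′ i k p)))
  where open Drifts

-- Injective relations, sums along diagonals, and crossings of diagonal lines.

pigeonhole : ∀ {A B : Set} (_~_ : A → B → Set) {xs : List A} {ys : List B} → Unique xs →
             (∀ {x} → x ∈ xs → ∃ λ y → y ∈ ys × x ~ y) →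
             (∀ {x x′ y} → x ∈ xs → x′ ∈ xs → x ~ y → x′ ~ y → x ≡ x′) → length xs ≤ length ys
pigeonhole _~_ [] f inj = z≤n
pigeonhole _~_ {x ∷ xs} (x∉ ∷ u) f inj with f (here refl)
... | y , y∈ , x~y with ∈.∈-∃++ y∈
...   | as , bs , refl = ≤-trans (s≤s (pigeonhole _~_ u f′ λ p q → inj (there p) (there q)))
    (≤-reflexive (trans (cong suc (List.length-++ as)) (trans (sym (+-suc (length as) (length bs))) (sym (List.length-++ as)))))
  where
  f′ : ∀ {z} → z ∈ xs → ∃ λ y′ → y′ ∈ as ++ bs × z ~ y′
  f′ z∈ with f (there z∈)
  ... | y′ , y′∈ , z~y′ with ∈.∈-++⁻ as y′∈
  ...   | inj₁ p = y′ , ∈.∈-++⁺ˡ p , z~y′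
  ...   | inj₂ (there p) = y′ , ∈.∈-++⁺ʳ as p , z~y′
  ...   | inj₂ (here refl) = contradiction (inj (here refl) (there z∈) x~y z~y′) (All.lookup x∉ z∈)

diag : (ℕ → ℕ → ℕ) → ℕ → ℕ
diag f zero    = f 0 0
diag f (suc s) = f 0 (suc s) + diag (λ y k → f (suc y) k) s

diag-last : ∀ f s → diag f (suc s) ≡ diag (λ y k → f y (suc k)) s + f (suc s) 0
diag-last f zero    = refl
diag-last f (suc s) = trans (cong (f 0 (suc (suc s)) +_) (diag-last (λ y k → f (suc y) k) s))
                            (sym (+-assoc (f 0 (suc (suc s))) _ _))

diag-+ : ∀ f g s → diag (λ y k → f y k + g y k) s ≡ diag f s + diag g s
diag-+ f g zero    = refl
diag-+ f g (suc s) = trans (cong (f 0 (suc s) + g 0 (suc s) +_) (diag-+ (λ y k → f (suc y) k) (λ y k → g (suc y) k) s))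
                           (interchange (f 0 (suc s)) (g 0 (suc s)) _ _)

diag-cong : ∀ {f g} s → (∀ y k → y + k ≡ s → f y k ≡ g y k) → diag f s ≡ diag g s
diag-cong zero    e = e 0 0 refl
diag-cong (suc s) e = cong₂ _+_ (e 0 (suc s) refl) (diag-cong s λ y k p → e (suc y) k (cong suc p))

diagonal : ∀ {A : Set} → (ℕ → ℕ → List A) → ℕ → List A
diagonal f zero    = f 0 0
diagonal f (suc s) = f 0 (suc s) ++ diagonal (λ y k → f (suc y) k) s

length-diagonal : ∀ {A : Set} (f : ℕ → ℕ → List A) s → length (diagonal f s) ≡ diag (λ y k → length (f y k)) s
length-diagonal f zero    = refl
length-diagonal f (suc s) = trans (List.length-++ (f 0 (suc s))) (cong (length (f 0 (suc s)) +_) (length-diagonal (λ y k → f (suc y) k) s))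

∈-diagonal : ∀ {A : Set} (f : ℕ → ℕ → List A) {x} s y k → y + k ≡ s → x ∈ f y k → x ∈ diagonal f s
∈-diagonal f zero    zero    zero refl x∈ = x∈
∈-diagonal f (suc s) zero    k    refl x∈ = ∈.∈-++⁺ˡ x∈
∈-diagonal f (suc s) (suc y) k    p    x∈ = ∈.∈-++⁺ʳ (f 0 (suc s)) (∈-diagonal (λ y k → f (suc y) k) s y k (suc-injective p) x∈)

-- The number of letters 1 from position m on, when s letters follow that position.
ones : Letters → ℕ → ℕ → ℕ
ones c m zero    = ⟦ c m 0 ⟧
ones c m (suc s) = ⟦ c m (suc s) ⟧ + ones c (suc m) s

flipped : Letters → Letters
flipped c m s = not (c m s)

module _ {P a c M h} (T : TFPL P a c M h) where
  open TFPL T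

  private
    -- With no letter moving, the extended array becomes available for any configuration, and its
    -- cells organise the degree count.
    trivial : Strip P a a a (λ _ _ → false)
    trivial = record { split = λ _ _ _ → +-identityʳ _ ; merge = λ _ _ _ → +-identityʳ _ ; finish = refl ; start = refl }

    open Drift trivial T using (X; balanced; right-top)
    open Balanced balanced

    -- Either pair of opposite corners sees each of the four sides once.
    sides : ∀ c → deg c nw + deg c se ≡ deg c sw + deg c ne
    sides (cell b r t l) = lemma ⟦ b ⟧ ⟦ r ⟧ ⟦ t ⟧ ⟦ l ⟧
      where
      lemma : ∀ b r t l → l + t + (r + b) ≡ b + l + (t + r)
      lemma = solve-∀

    leaving : ℕ → ℕ → ℕ → ℕ
    leaving m y k = ⟦ h m y k south ⟧ + ⟦ h m y k east ⟧

    bottom-corner : ∀ m k → m + k ≡ suc P → deg (X m 0 k) sw ≡ 0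
    bottom-corner zero    k p = refl
    bottom-corner (suc m) k p rewrite bottom m k (suc-injective p) = refl

  -- Both sides count the edges across a diagonal line of the triangle; the degrees
  -- of the vertices on two neighbouring lines determine the difference.
  crossings-ones : ∀ m s → m + s ≡ suc P → diag (λ y k → deg (X m y k) nw) s ≡ ones c m s
  crossings-ones m zero p with refl ← trans (sym (+-identityʳ m)) p
    rewrite bottom P 0 (+-identityʳ _) | right-edge P 0 (+-identityʳ _) = sym (cong ⟦_⟧ (sym (right-floor (suc P) 0 p)))
  -- The successor added to `D-se` is the external edge at the lowest `se` corner. It cancels
  -- against the required edge at the right end of the line, so that only the letter `C`
  -- distinguishes two neighbouring lines.
  crossings-ones m (suc s) p = +-cancelʳ-≡ (suc D-se) _ _ (begin
      diag N (suc s) + suc D-se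
    ≡⟨ sym (diag-+ N S (suc s)) ⟩
      diag (λ y k → N y k + S y k) (suc s)
    ≡⟨ diag-cong (suc s) (λ y k _ → sides (X m y k)) ⟩
      diag (λ y k → W y k + E y k) (suc s)
    ≡⟨ diag-+ W E (suc s) ⟩
      W 0 (suc s) + D-sw + diag E (suc s)
    ≡⟨ cong₂ (λ w e → w + D-sw + e) (bottom-corner m (suc s) p) (diag-last E s) ⟩
      D-sw + (D-ne + E (suc s) 0)
    ≡⟨ cong (λ e → D-sw + (D-ne + e)) (cong₂ (λ x z → ⟦ x ⟧ + ⟦ z ⟧) (right-top m (suc s) p) (right-floor m (suc s) p)) ⟩
      D-sw + (D-ne + suc C)
    ≡⟨ regroup D-sw D-ne C ⟩
      (D-ne + D-sw) + suc C
    ≡⟨ cong (_+ suc C) (trans (sym (diag-+ _ _ s)) (trans (diag-cong s (λ y k q → trans (black-degree m y k (in-line q)) (sym (white-degree m y k (in-line q)))))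
         (diag-+ _ _ s))) ⟩
      (diag (λ y k → deg (X (suc m) y k) nw) s + D-se) + suc C
    ≡⟨ cong (λ u → u + D-se + suc C) (crossings-ones (suc m) s (trans (sym (+-suc m s)) p)) ⟩
      (ones c (suc m) s + D-se) + suc C
    ≡⟨ regroup′ (ones c (suc m) s) D-se C ⟩
      C + ones c (suc m) s + suc D-se ∎)
    where
    open ≡-Reasoning
    N S W E : ℕ → ℕ → ℕ
    N y k = deg (X m y k) nw
    S y k = deg (X m y k) se
    W y k = deg (X m y k) sw
    E y k = deg (X m y k) ne
    D-se D-sw D-ne C : ℕ
    D-se = diag (λ y k → S (suc y) k) s
    D-sw = diag (λ y k → W (suc y) k) s
    D-ne = diag (λ y k → E y (suc k)) s
    C = ⟦ c m (suc s) ⟧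
    in-line : ∀ {y k} → y + k ≡ s → m + y + k ≡ P
    in-line {y} {k} q = suc-injective (trans (cong suc (trans (+-assoc m y k) (cong (m +_) q))) (trans (sym (+-suc m s)) p))
    regroup : ∀ x y z → x + (y + suc z) ≡ y + x + suc z
    regroup = solve-∀
    regroup′ : ∀ x y z → x + y + suc z ≡ z + x + suc y
    regroup′ = solve-∀

  private
    index : Point → ℕ
    index (even m _ _) = m
    index (odd m _ _)  = m
    index (leg m _)    = m

    -- An odd point is listed once for each of its edges across the line, so that the length is the
    -- number of crossings.
    gates : ℕ → ℕ → ℕ → List Point
    gates m y k = when (h m y k south) (odd m y k) ++ when (h m y k east) (odd m y k)

    length-gates : ∀ m y k → length (gates m y k) ≡ leaving m y k
    length-gates m y k = trans (List.length-++ (when (h m y k south) _)) (cong₂ _+_ (length-when (h m y k south) _) (length-when (h m y k east) _))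

    -- The index changes only along the east and south edges of odd points. A walk from beyond the
    -- line to index at most m uses one of those, and the gate is its odd end.
    exit : ∀ {m s u v} → m + s ≡ P → Linked P h u v → m < index u → index v ≤ m →
           ∃ λ w → w ∈ diagonal (gates m) s × Linked P h u w
    exit q ε m<u v≤m = contradiction v≤m (<⇒≱ m<u)
    exit {m} {s} q (_◅_ {j = w} e r) m<u v≤m with m <? index w
    ... | yes m<w = case exit q r m<w v≤m of λ { (x , x∈ , t) → x , x∈ , e ◅ t }
    ... | no m≮w = found e m<u (≮⇒≥ m≮w)
      where
      in-line : ∀ {y k} → m + y + k ≡ P → y + k ≡ s
      in-line {y} {k} p = +-cancelˡ-≡ m _ _ (trans (sym (+-assoc m y k)) (trans p (sym q)))
      found : ∀ {u w} → u ~[ P , h ] w → m < index u → index w ≤ m → ∃ λ x → x ∈ diagonal (gates m) s × Linked P h u x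
      found (fwd (link west p e)) m<u w≤m  = contradiction w≤m (<⇒≱ m<u)
      found (fwd (link east p e)) m<u w≤m  = contradiction w≤m (<⇒≱ (m≤n⇒m≤1+n m<u))
      found (fwd (link north p e)) m<u w≤m = contradiction w≤m (<⇒≱ m<u)
      found (fwd (link {y = zero} south p e)) m<u w≤m  = contradiction w≤m (<⇒≱ m<u)
      found (fwd (link {y = suc _} south p e)) m<u w≤m = contradiction w≤m (<⇒≱ (m≤n⇒m≤1+n m<u))
      found (fwd (legLink p)) m<u w≤m = contradiction w≤m (<⇒≱ m<u)
      found (bwd (legLink p)) m<u w≤m = contradiction w≤m (<⇒≱ m<u)
      found (bwd (link west p e)) m<u w≤m  = contradiction w≤m (<⇒≱ m<u)
      found (bwd (link north p e)) m<u w≤m = contradiction w≤m (<⇒≱ m<u)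
      found (bwd (link {y = zero} south p e)) m<u w≤m = contradiction w≤m (<⇒≱ m<u)
      found (bwd (link {m′} {y} {k} east p e)) (s≤s m≤m′) w≤m with refl ← ≤-antisym w≤m m≤m′ =
        odd m y k , ∈-diagonal (gates m) s y k (in-line p) (∈.∈-++⁺ʳ (when (h m y k south) _) (when∈ e)) , bwd (link east p e) ◅ ε
      found (bwd (link {m′} {suc y} {k} south p e)) (s≤s m≤m′) w≤m with refl ← ≤-antisym w≤m m≤m′ =
        odd m (suc y) k , ∈-diagonal (gates m) s (suc y) k (in-line p) (∈.∈-++⁺ˡ (when∈ e)) , bwd (link south p e) ◅ ε

    zeros : ℕ → ℕ → List Point
    zeros m zero    = when (not (c m 0)) (even m 0 0)
    zeros m (suc s) = when (not (c m (suc s))) (even m (suc s) 0) ++ zeros (suc m) s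

    length-zeros : ∀ m s → length (zeros m s) ≡ ones (flipped c) m s
    length-zeros m zero    = length-when (not (c m 0)) _
    length-zeros m (suc s) = trans (List.length-++ (when (not (c m (suc s))) _))
      (cong₂ _+_ (length-when (not (c m (suc s))) _) (length-zeros (suc m) s))

    Zero : ℕ → ℕ → Point → Set
    Zero m s u = ∃₂ λ j l → u ≡ even j l 0 × m ≤ j × j + l ≡ m + s × c j l ≡ false

    ∈-when : ∀ {b u v} → u ∈ when (not b) v → u ≡ v × b ≡ false
    ∈-when {false} (here refl) = refl , refl

    ∈zeros : ∀ m s {u} → u ∈ zeros m s → Zero m s u
    ∈zeros m zero u∈ = case ∈-when u∈ of λ { (refl , e) → m , 0 , refl , ≤-refl , refl , e }
    ∈zeros m (suc s) u∈ with ∈.∈-++⁻ (when (not (c m (suc s))) _) u∈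
    ... | inj₁ p = case ∈-when p of λ { (refl , e) → m , suc s , refl , ≤-refl , refl , e }
    ... | inj₂ p = case ∈zeros (suc m) s p of λ
      { (j , l , e , m<j , q , f) → j , l , e , ≤-trans (n≤1+n m) m<j , trans q (sym (+-suc m s)) , f }

    when-unique : ∀ b u → Unique (when b u)
    when-unique true  u = [] ∷ []
    when-unique false u = []

    zeros-unique : ∀ m s → Unique (zeros m s)
    zeros-unique m zero    = when-unique _ _
    zeros-unique m (suc s) = Unique.++⁺ (when-unique (not (c m (suc s))) _) (zeros-unique (suc m) s)
      λ { (p , q) → case (∈-when {c m (suc s)} p , ∈zeros (suc m) s q) of λ { ((refl , _) , (_ , _ , refl , m<m , _)) → <-irrefl refl m<m } }

  -- A path that ends at the right boundary beyond a diagonal line has crossed that line, and two of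
  -- them do not share an edge.
  zeros≤ones : ∀ m s → suc m + s ≡ suc P → ones (flipped c) (suc m) s ≤ ones c (suc m) s
  zeros≤ones m s p = subst₂ _≤_ (length-zeros (suc m) s)
      (trans (length-diagonal (gates m) s) (trans (diag-cong s (λ y k _ → length-gates m y k)) (crossings-ones (suc m) s p)))
      (pigeonhole (Linked P h) (zeros-unique (suc m) s) crosses distinct)
    where
    crosses : ∀ {u} → u ∈ zeros (suc m) s → ∃ λ w → w ∈ diagonal (gates m) s × Linked P h u w
    crosses u∈ with ∈zeros (suc m) s u∈
    ... | j , l , refl , m<j , q , e with right-path j l (trans q p) e
    ...   | i , k , _ , _ , r = exit (suc-injective p) (symˡ r) m<j z≤n
    distinct : ∀ {u v w} → u ∈ zeros (suc m) s → v ∈ zeros (suc m) s → Linked P h u w → Linked P h v w → u ≡ v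
    distinct {u} {v} u∈ v∈ r r′ with u ≟ᴾ v
    ... | yes u≡v = u≡v
    -- Two right ends linked to the same gate would be linked to each other, while the first is
    -- already linked to a left end.
    ... | no u≢v with ∈zeros (suc m) s u∈ | ∈zeros (suc m) s v∈
    ...   | j , l , refl , m<j , q , e | j′ , l′ , refl , m<j′ , q′ , e′ with right-path j l (trans q p) e
    ...     | i , k , q″ , e″ , r″
      with refl ← ends-unique T (right-end T (trans q p) e) (left-end T q″ e″) (right-end T (trans q′ p) e′)
                    (λ { refl → contradiction m<j λ () }) u≢v (symˡ r″) (r ◅◅ symˡ r′)
      with () ← m<j′

-- The triangle in coordinates


module _ {A : Set} where

  sublist⊆ : ∀ (xs : List A) {f} → f ∈ sublists xs → f ⊆ xs
  sublist⊆ [] (here refl) ()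
  sublist⊆ (x ∷ xs) f∈ e∈ with ∈.∈-++⁻ (map (x ∷_) (sublists xs)) f∈
  ... | inj₂ p = there (sublist⊆ xs p e∈)
  ... | inj₁ p with ∈.∈-map⁻ (x ∷_) p
  ...   | g , g∈ , refl with e∈
  ...     | here e≡   = here e≡
  ...     | there e∈g = there (sublist⊆ xs g∈ e∈g)

  ∈sublist-unique : ∀ {xs : List A} → Unique xs → ∀ {f} → f ∈ sublists xs → Unique f
  ∈sublist-unique [] (here refl) = []
  ∈sublist-unique {x ∷ xs} (x∉ ∷ u) f∈ with ∈.∈-++⁻ (map (x ∷_) (sublists xs)) f∈
  ... | inj₂ p = ∈sublist-unique u p
  ... | inj₁ p with ∈.∈-map⁻ (x ∷_) p
  ...   | g , g∈ , refl = All.tabulate (λ e∈ → All.lookup x∉ (sublist⊆ xs g∈ e∈)) ∷ ∈sublist-unique u g∈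

  sublist-ext : ∀ {xs : List A} → Unique xs → ∀ {f g} → f ∈ sublists xs → g ∈ sublists xs → f ⊆ g → g ⊆ f → f ≡ g
  sublist-ext [] (here refl) (here refl) _ _ = refl
  sublist-ext {x ∷ xs} (x∉ ∷ u) f∈ g∈ f⊆g g⊆f
    with ∈.∈-++⁻ (map (x ∷_) (sublists xs)) f∈ | ∈.∈-++⁻ (map (x ∷_) (sublists xs)) g∈
  ... | inj₂ p | inj₂ q = sublist-ext u p q f⊆g g⊆f
  ... | inj₁ p | inj₂ q with ∈.∈-map⁻ (x ∷_) p
  ...   | _ , _ , refl = contradiction refl (All.lookup x∉ (sublist⊆ xs q (f⊆g (here refl))))
  sublist-ext {x ∷ xs} (x∉ ∷ u) f∈ g∈ f⊆g g⊆f | inj₂ p | inj₁ q with ∈.∈-map⁻ (x ∷_) q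
  ...   | _ , _ , refl = contradiction refl (All.lookup x∉ (sublist⊆ xs p (g⊆f (here refl))))
  sublist-ext {x ∷ xs} (x∉ ∷ u) f∈ g∈ f⊆g g⊆f | inj₁ p | inj₁ q with ∈.∈-map⁻ (x ∷_) p | ∈.∈-map⁻ (x ∷_) q
  ...   | f′ , f′∈ , refl | g′ , g′∈ , refl = cong (x ∷_) (sublist-ext u f′∈ g′∈ (tail f′∈ f⊆g) (tail g′∈ g⊆f))
    where
    tail : ∀ {f g} → f ∈ sublists xs → x ∷ f ⊆ x ∷ g → f ⊆ g
    tail f∈ s e∈ with s (there e∈)
    ... | there p   = p
    ... | here refl = contradiction refl (All.lookup x∉ (sublist⊆ xs f∈ e∈))

  sublists-unique : ∀ {xs : List A} → Unique xs → Unique (sublists xs)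
  sublists-unique [] = [] ∷ []
  sublists-unique {x ∷ xs} (x∉ ∷ u) = Unique.++⁺ (Unique.map⁺ List.∷-injectiveʳ (sublists-unique u)) (sublists-unique u)
    λ { (p , q) → case ∈.∈-map⁻ (x ∷_) p of λ { (_ , _ , refl) → contradiction refl (All.lookup x∉ (sublist⊆ xs q (here refl))) } }

  filter∈sublists : ∀ {Q : A → Set} (Q? : ∀ x → Dec (Q x)) xs → filter Q? xs ∈ sublists xs
  filter∈sublists Q? [] = here refl
  filter∈sublists Q? (x ∷ xs) with Q? x
  ... | yes _ = ∈.∈-++⁺ˡ (∈.∈-map⁺ (x ∷_) (filter∈sublists Q? xs))
  ... | no  _ = ∈.∈-++⁺ʳ (map (x ∷_) (sublists xs)) (filter∈sublists Q? xs)

  same-length : ∀ {xs ys : List A} → Unique xs → Unique ys → xs ⊆ ys → ys ⊆ xs → length xs ≡ length ys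
  same-length u v s s′ = ≤-antisym (pigeonhole _≡_ u (λ {x} p → x , s p , refl) λ { _ _ refl refl → refl })
                                   (pigeonhole _≡_ v (λ {x} p → x , s′ p , refl) λ { _ _ refl refl → refl })

-- Doubling by recursion, so that parity can be decided on constructors.
double : ℕ → ℕ
double zero    = zero
double (suc m) = suc (suc (double m))

double≡ : ∀ m → double m ≡ 2 * m
double≡ zero    = refl
double≡ (suc m) = cong suc (trans (cong suc (double≡ m)) (sym (+-suc m (m + 0))))

double-+ : ∀ m y → double m + y + y ≡ double (m + y)
double-+ m y = trans (trans (cong (λ x → x + y + y) (double≡ m)) (lemma m y)) (sym (double≡ (m + y)))
  where
  lemma : ∀ m y → 2 * m + y + y ≡ 2 * (m + y)
  lemma = solve-∀

double-injective : ∀ {m m′} → double m ≡ double m′ → m ≡ m′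
double-injective {zero}  {zero}   e = refl
double-injective {suc m} {suc m′} e = cong suc (double-injective (suc-injective (suc-injective e)))

double≢ : ∀ {m m′} → double m ≢ suc (double m′)
double≢ {suc m} {suc m′} e = double≢ (suc-injective (suc-injective e))

double-≤ : ∀ {m m′} → double m ≤ suc (double m′) → m ≤ m′
double-≤ {zero}  _ = z≤n
double-≤ {suc m} {suc m′} (s≤s (s≤s l)) = s≤s (double-≤ l)
double-≤ {suc m} {zero} (s≤s ())

double-mono : ∀ {m m′} → m ≤ m′ → double m ≤ double m′
double-mono z≤n     = z≤n
double-mono (s≤s l) = s≤s (s≤s (double-mono l))

halve : ℕ → ℕ ⊎ ℕ
halve 0             = inj₁ 0
halve 1             = inj₂ 0
halve (suc (suc x)) with halve x
... | inj₁ m = inj₁ (suc m)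
... | inj₂ m = inj₂ (suc m)

halve-double : ∀ m → halve (double m) ≡ inj₁ m
halve-double zero    = refl
halve-double (suc m) rewrite halve-double m = refl

halve-suc-double : ∀ m → halve (suc (double m)) ≡ inj₂ m
halve-suc-double zero    = refl
halve-suc-double (suc m) rewrite halve-suc-double m = refl

parity : ∀ x → (∃ λ m → x ≡ double m) ⊎ (∃ λ m → x ≡ suc (double m))
parity 0 = inj₁ (0 , refl)
parity 1 = inj₂ (0 , refl)
parity (suc (suc x)) with parity x
... | inj₁ (m , refl) = inj₁ (suc m , refl)
... | inj₂ (m , refl) = inj₂ (suc m , refl)

-- A `Path` has distinct nodes: if u already lies on it, the part from u on is taken instead.
joined-step : ∀ {f u w v} → Adjacent f u w → Joined f w v → Joined f u v
joined-step {f} {u} {w} {v} e (us , p) with Any.any? (u ≟ⁿ_) us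
... | yes u∈ = from p u∈
  where
  from : ∀ {w us} → Path f w v us → u ∈ us → Joined f u v
  from p@stop         (here refl) = _ , p
  from p@(step _ _ _) (here refl) = _ , p
  from (step _ p _)   (there u∈)  = from p u∈
... | no u∉ = _ , step e p u∉

place : Point → Node
place (even m y k) = vertex (double m + y , y)
place (odd m y k)  = vertex (suc (double m + y) , y)
place (leg m k)    = foot (double m)

-- Edges are named from their odd end, but stored with their right or upper vertex; this is why
-- `east` and `north` refer to the neighbour.
edge : ℕ → ℕ → Dir → Edge
edge m y west  = left (suc (double m + y) , y)
edge m y east  = left (suc (suc (double m + y)) , y)
edge m y north = down (double m + suc y , suc y)
edge m y south = down (suc (double m + y) , y)

bits : List Edge → Config
bits f m y k d = does (edge m y d ∈ᵉ? f)

vertex-injective : ∀ {x y x′ y′} → vertex (x , y) ≡ vertex (x′ , y′) → x ≡ x′ × y ≡ y′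
vertex-injective refl = refl , refl

foot-injective : ∀ {x x′} → foot x ≡ foot x′ → x ≡ x′
foot-injective refl = refl

-- `place` forgets the last coordinate, which the fixed sum restores inside the triangle.
place-injective : ∀ {P u v} → Inside P u → Inside P v → place u ≡ place v → u ≡ v
place-injective {u = even m y k} {even m′ y′ k′} p q e with vertex-injective e
... | x≡ , refl with refl ← double-injective (+-cancelʳ-≡ y (double m) (double m′) x≡)
  with refl ← +-cancelˡ-≡ (m + y) k k′ (trans p (sym q)) = refl
place-injective {u = odd m y k} {odd m′ y′ k′} p q e with vertex-injective e
... | x≡ , refl with refl ← double-injective (+-cancelʳ-≡ y (double m) (double m′) (suc-injective x≡))
  with refl ← +-cancelˡ-≡ (m + y) k k′ (trans p (sym q)) = refl
place-injective {u = leg m k} {leg m′ k′} p q e 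
  with refl ← double-injective (foot-injective e)
  with refl ← +-cancelˡ-≡ m k k′ (trans p (sym q)) = refl
place-injective {u = even m y k} {odd m′ y′ k′} p q e with vertex-injective e
... | x≡ , refl = ⊥-elim (double≢ (+-cancelʳ-≡ y (double m) (suc (double m′)) x≡))
place-injective {u = odd m y k} {even m′ y′ k′} p q e with vertex-injective e
... | x≡ , refl = ⊥-elim (double≢ (+-cancelʳ-≡ y (double m′) (suc (double m)) (sym x≡)))

∈-bits : ∀ {f m y} k d → bits f m y k d ≡ true → edge m y d ∈ f
∈-bits {f} {m} {y} k d e with edge m y d ∈ᵉ? f
... | yes p = p

bits-∈ : ∀ {f m y} k d → edge m y d ∈ f → bits f m y k d ≡ true
bits-∈ {f} {m} {y} k d p = dec-true (edge m y d ∈ᵉ? f) p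

∉-bits : ∀ {f m y} k d → edge m y d ∉ f → bits f m y k d ≡ false
∉-bits {f} {m} {y} k d p = dec-false (edge m y d ∈ᵉ? f) p

-- South of odd m 0 there is no edge.
edge-ends : ∀ m y k d → (d ≡ south → 1 ≤ y) →
            ends (edge m y d) ≡ (place (odd m y k) , place (far d m y k)) ⊎
            ends (edge m y d) ≡ (place (far d m y k) , place (odd m y k))
edge-ends m y k west  _ = inj₁ refl
edge-ends m y k east  _ = inj₂ refl
edge-ends m y k north _ = inj₂ (cong (λ x → vertex (double m + suc y , suc y) , vertex (x , y)) (+-suc (double m) y))
edge-ends m zero k south h with () ← h refl
edge-ends m (suc y) k south _ = inj₁ (cong (λ x → vertex (suc (double m + suc y) , suc y) , vertex (suc x , y)) (+-suc (double m) y))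

at : List Letter → ℕ → Letter
at []      _       = 0F
at (x ∷ w) zero    = x
at (x ∷ w) (suc i) = at w i

is1 : Letter → Bool
is1 0F = false
is1 1F = true

is1-true : ∀ {x} → is1 x ≡ true → x ≡ 1F
is1-true {1F} _ = refl

is1-false : ∀ {x} → is1 x ≡ false → x ≡ 0F
is1-false {0F} _ = refl
is1-false {1F} ()

letters : ∀ {m} → Vec Letter m → Letters
letters w i k = is1 (at (toList w) i)

lookup-at : ∀ {m} (w : Vec Letter m) x → lookup w x ≡ at (toList w) (toℕ x)
lookup-at (_ ∷ w) Fin.zero    = refl
lookup-at (_ ∷ w) (Fin.suc x) = lookup-at w x

MatchedAt : List Letter → ℕ → ℕ → Set
MatchedAt w i j = at w i ≡ 0F × at w j ≡ 1F × IsDyck (count 0F between) between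
  where between = take (j ∸ suc i) (drop (suc i) w)

pairing : ∀ {m} → Vec Letter m → Pairing
pairing π i k j l = MatchedAt (toList π) i j

module Geometry {n P : ℕ} (N≡ : 2 * n ≡ suc (suc P)) where

  last≡ : 2 * n ∸ 1 ≡ suc P
  last≡ = cong (_∸ 1) N≡

  4n≡ : 4 * n ≡ suc (suc (double (suc P)))
  4n≡ = trans (lemma n) (trans (cong (2 *_) N≡) (sym (double≡ (suc (suc P)))))
    where
    lemma : ∀ n → 4 * n ≡ 2 * (2 * n)
    lemma = solve-∀

  index : ∀ {i k} → i + k ≡ suc P → ∃ λ (x : Fin (2 * n)) → toℕ x ≡ i
  index {i} {k} p = fromℕ< i<2n , Fin.toℕ-fromℕ< i<2n
    where
    i<2n : i < 2 * n
    i<2n = subst (suc i ≤_) (sym N≡) (s≤s (subst (i ≤_) p (m≤m+n i k)))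

  toℕ≤ : ∀ (x : Fin (2 * n)) → toℕ x ≤ suc P
  toℕ≤ x = ≤-pred (subst (suc (toℕ x) ≤_) N≡ (Fin.toℕ<n x))

  coindex : ∀ (x : Fin (2 * n)) → ∃ λ k → toℕ x + k ≡ suc P
  coindex x = suc P ∸ toℕ x , m+[n∸m]≡n (toℕ≤ x)

  R≡ : ∀ x {j l} → toℕ x ≡ j → j + l ≡ suc P → R n x ≡ (double j + l , l)
  R≡ x {j} {l} refl p = trans (cong (λ z → z + toℕ x , z ∸ toℕ x) (trans last≡ (sym p)))
    (cong₂ _,_ (trans (lemma (toℕ x) l) (cong (_+ l) (sym (double≡ (toℕ x))))) (m+n∸m≡n (toℕ x) l))
    where
    lemma : ∀ j l → j + l + j ≡ 2 * j + l
    lemma = solve-∀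

  InTriangle : ℕ → ℕ → Set
  InTriangle x y = y ≤ x × x + y ≤ double (suc P)

  triangle? : (v : Vertex) → Dec (proj₂ v ≤ proj₁ v × proj₁ v + proj₂ v ≤ 4 * n ∸ 2)
  triangle? (x , y) = (y ≤? x) ×-dec (x + y ≤? 4 * n ∸ 2)

  off-diagonal? : (v : Vertex) → Dec (proj₂ v < proj₁ v)
  off-diagonal? (x , y) = y <? x

  raised? : (v : Vertex) → Dec (0 < proj₂ v)
  raised? (x , y) = 0 <? y

  ∈vertices : ∀ {x y} → InTriangle x y → (x , y) ∈ vertices n
  ∈vertices {x} {y} (y≤x , x+y≤) = ∈.∈-filter⁺ triangle?
    (∈.∈-cartesianProduct⁺ (∈.∈-upTo⁺ (bound (m≤m+n x y))) (∈.∈-upTo⁺ (bound (m≤n+m y x))))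
    (y≤x , subst (x + y ≤_) (sym (cong (_∸ 2) 4n≡)) x+y≤)
    where
    bound : ∀ {z} → z ≤ x + y → z < 4 * n ∸ 1
    bound {z} l = subst (z <_) (sym (cong (_∸ 1) 4n≡)) (s≤s (≤-trans l x+y≤))

  vertices∋ : ∀ {x y} → (x , y) ∈ vertices n → InTriangle x y
  vertices∋ {x} {y} v∈ with ∈.∈-filter⁻ triangle? {xs = cartesianProduct (upTo (4 * n ∸ 1)) (upTo (4 * n ∸ 1))} v∈
  ... | _ , y≤x , x+y≤ = y≤x , subst (x + y ≤_) (cong (_∸ 2) 4n≡) x+y≤

  vertices-unique : Unique (vertices n)
  vertices-unique = Unique.filter⁺ triangle? (Unique.cartesianProduct⁺ (Unique.upTo⁺ (4 * n ∸ 1)) (Unique.upTo⁺ (4 * n ∸ 1)))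

  ∈edges-left : ∀ {x y} → y < x → x + y ≤ double (suc P) → left (x , y) ∈ edges n
  ∈edges-left y<x b = ∈.∈-++⁺ˡ (∈.∈-map⁺ left (∈.∈-filter⁺ off-diagonal? (∈vertices (<⇒≤ y<x , b)) y<x))

  ∈edges-down : ∀ {x y} → InTriangle x (suc y) → down (x , suc y) ∈ edges n
  ∈edges-down t∈ = ∈.∈-++⁺ʳ (map left (filter off-diagonal? (vertices n)))
    (∈.∈-++⁺ˡ (∈.∈-map⁺ down (∈.∈-filter⁺ raised? (∈vertices t∈) (s≤s z≤n))))

  ∈edges-external : ∀ x → external n x ∈ edges n
  ∈edges-external x = ∈.∈-++⁺ʳ (map left (filter off-diagonal? (vertices n)))
    (∈.∈-++⁺ʳ (map down (filter raised? (vertices n))) (∈.∈-map⁺ (external n) (∈.∈-allFin x)))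

  external≡ : ∀ {m k} → m + k ≡ suc P → ∃ λ x → external n x ≡ down (double m , 0) × toℕ x ≡ m
  external≡ {m} p with index {m} p
  ... | x , refl = x , cong (λ z → down (z , 0)) (sym (double≡ (toℕ x))) , refl

  data EdgeView : Edge → Set where
    inner : ∀ m y k d → m + y + k ≡ P → (d ≡ south → 1 ≤ y) → EdgeView (edge m y d)
    outer : ∀ m k → m + k ≡ suc P → EdgeView (down (double m , 0))

  -- For x = 2m + y the sum x + y is 2(m + y), and the bound 4n - 2 is 2(P + 1).
  even-bound : ∀ m y → double m + y + y ≤ double (suc P) → m + y ≤ suc P
  even-bound m y b = double-≤ (m≤n⇒m≤1+n (subst (_≤ double (suc P)) (double-+ m y) b))

  odd-bound : ∀ m y → suc (double m + y) + y ≤ double (suc P) → m + y ≤ P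
  odd-bound m y b = double-≤ (≤-pred (subst (_≤ double (suc P)) (cong suc (double-+ m y)) b))

  rest : ∀ {i j} → i ≤ j → i + (j ∸ i) ≡ j
  rest = m+[n∸m]≡n

  offset : ∀ {x y} → y ≤ x → (∃ λ m → x ≡ double m + y) ⊎ (∃ λ m → x ≡ suc (double m + y))
  offset {x} {y} y≤x with parity (x ∸ y) | m∸n+n≡m y≤x
  ... | inj₁ (m , e) | e′ = inj₁ (m , trans (sym e′) (cong (_+ y) e))
  ... | inj₂ (m , e) | e′ = inj₂ (m , trans (sym e′) (cong (_+ y) e))

  view : ∀ {e} → e ∈ edges n → EdgeView e
  view e∈ with ∈.∈-++⁻ (map left (filter off-diagonal? (vertices n))) e∈
  ... | inj₁ p with ∈.∈-map⁻ left p
  ...   | (x , y) , v∈ , refl with ∈.∈-filter⁻ off-diagonal? {xs = vertices n} v∈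
  ...     | v∈′ , y<x with vertices∋ v∈′
  ...       | y≤x , b with offset y≤x
  ...         | inj₁ (zero , refl)  = contradiction y<x (<-irrefl refl)
  ...         | inj₁ (suc m , refl) = inner m y _ east (rest (≤-pred (even-bound (suc m) y b))) λ ()
  ...         | inj₂ (m , refl)     = inner m y _ west (rest (odd-bound m y b)) λ ()
  view e∈ | inj₂ p with ∈.∈-++⁻ (map down (filter raised? (vertices n))) p
  ... | inj₂ q with ∈.∈-map⁻ (external n) q
  ...   | x , _ , refl = subst (λ z → EdgeView (down (z , 0))) (double≡ (toℕ x)) (outer (toℕ x) _ (proj₂ (coindex x)))
  view e∈ | inj₂ p | inj₁ q with ∈.∈-map⁻ down q
  ... | (x , y) , v∈ , refl with ∈.∈-filter⁻ raised? {xs = vertices n} v∈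
  view e∈ | inj₂ p | inj₁ q | (x , suc y) , v∈ , refl | v∈′ , _ with vertices∋ v∈′
  ... | y≤x , b with offset y≤x
  ...   | inj₁ (m , refl) = inner m y _ north (rest (≤-pred (subst (_≤ suc P) (+-suc m y) (even-bound m (suc y) b)))) λ ()
  ...   | inj₂ (m , refl) = inner m (suc y) _ south (rest (odd-bound m (suc y) b)) λ _ → s≤s z≤n

  even-in : ∀ {m y k} → m + y + k ≡ suc P → InTriangle (double m + y) y
  even-in {m} {y} {k} p = m≤n+m y (double m) , subst (_≤ double (suc P)) (sym (double-+ m y)) (double-mono (subst (m + y ≤_) p (m≤m+n (m + y) k)))

  odd-in : ∀ {m y k} → m + y + k ≡ P → InTriangle (suc (double m + y)) y
  odd-in {m} {y} {k} p = m≤n+m y (suc (double m)) ,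
    s≤s (subst (_≤ suc (double P)) (sym (double-+ m y)) (m≤n⇒m≤1+n (double-mono (subst (m + y ≤_) p (m≤m+n (m + y) k)))))

  ∈edges : ∀ {m y k} d → m + y + k ≡ P → (d ≡ south → 1 ≤ y) → edge m y d ∈ edges n
  ∈edges {m} {y} west  p _ = ∈edges-left (s≤s (m≤n+m y (double m))) (proj₂ (odd-in {m} p))
  ∈edges {m} {y} east  p _ = ∈edges-left (s≤s (m≤n+m y (suc (double m)))) (proj₂ (even-in {suc m} (cong suc p)))
  ∈edges {m} {y} north p _ = ∈edges-down (even-in (raise-middle m p))
  ∈edges {m} {zero}  south p h with () ← h refl
  ∈edges {m} {suc y} south p h = ∈edges-down (odd-in p)

  outer∈edges : ∀ {m k} → m + k ≡ suc P → down (double m , 0) ∈ edges n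
  outer∈edges {m} p with external≡ {m} p
  ... | x , e , _ = subst (_∈ edges n) e (∈edges-external x)

  -- External edges have even abscissas, and this one would have 2m + 1.
  south∉edges : ∀ m → edge m 0 south ∉ edges n
  south∉edges m e∈ = go (view e∈) refl
    where
    down-x : ∀ {x x′ : ℕ} {y} → down (x , y) ≡ down (x′ , y) → x ≡ x′
    down-x refl = refl
    go : ∀ {e} → EdgeView e → e ≡ edge m 0 south → ⊥
    go (inner m′ zero k south p h) e with () ← h refl
    go (outer m′ k p) e = double≢ (trans (down-x e) (cong suc (+-identityʳ (double m))))

  edges-unique : Unique (edges n)
  edges-unique = Unique.++⁺ (Unique.map⁺ (λ { refl → refl }) (Unique.filter⁺ off-diagonal? vertices-unique))
    (Unique.++⁺ (Unique.map⁺ (λ { refl → refl }) (Unique.filter⁺ raised? vertices-unique))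
      (Unique.map⁺ external-injective (Unique.allFin⁺ (2 * n)))
      λ { (p , q) → case ∈.∈-map⁻ down p of λ { ((x , y) , v∈ , refl) → case ∈.∈-map⁻ (external n) q of λ { (z , _ , refl) →
          case proj₂ (∈.∈-filter⁻ raised? {xs = vertices n} v∈) of λ () } } })
    λ { (p , q) → case ∈.∈-map⁻ left p of λ { (_ , _ , refl) → case ∈.∈-++⁻ (map down (filter raised? (vertices n))) q of λ
        { (inj₁ r) → case ∈.∈-map⁻ down r of λ { (_ , _ , ()) } ; (inj₂ r) → case ∈.∈-map⁻ (external n) r of λ { (_ , _ , ()) } } } }
    where
    external-injective : ∀ {x z} → external n x ≡ external n z → x ≡ z
    external-injective {x} {z} e = Fin.toℕ-injective (double-injective (trans (double≡ (toℕ x)) (trans (down-x e) (sym (double≡ (toℕ z))))))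
      where
      down-x : ∀ {x x′ : ℕ} → down (x , 0) ≡ down (x′ , 0) → x ≡ x′
      down-x refl = refl

  around : ℕ → ℕ → List Edge
  around x y = left (x , y) ∷ left (suc x , y) ∷ down (x , y) ∷ down (x , suc y) ∷ []

  left∈edges⁻ : ∀ {x y} → left (x , y) ∈ edges n → y < x
  left∈edges⁻ e∈ with ∈.∈-++⁻ (map left (filter off-diagonal? (vertices n))) e∈
  ... | inj₁ p with ∈.∈-map⁻ left p
  ...   | _ , v∈ , refl = proj₂ (∈.∈-filter⁻ off-diagonal? {xs = vertices n} v∈)
  left∈edges⁻ e∈ | inj₂ p with ∈.∈-++⁻ (map down (filter raised? (vertices n))) p
  ... | inj₁ q = case ∈.∈-map⁻ down q of λ { (_ , _ , ()) }
  ... | inj₂ q = case ∈.∈-map⁻ (external n) q of λ { (_ , _ , ()) }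

  incident-around : ∀ {x y e} → e ∈ edges n → Incident (x , y) e → e ∈ around x y
  incident-around {e = left (x′ , y′)} e∈ (inj₁ refl) = here refl
  -- Since `pred` fixes 0, `left (0 , y′)` would be a loop; it is no edge of the triangle.
  incident-around {e = left (zero , y′)} e∈ (inj₂ refl) with () ← left∈edges⁻ e∈
  incident-around {e = left (suc x′ , y′)} e∈ (inj₂ refl) = there (here refl)
  incident-around {e = down (x′ , zero)}  e∈ (inj₁ refl) = there (there (here refl))
  incident-around {e = down (x′ , suc y′)} e∈ (inj₁ refl) = there (there (here refl))
  incident-around {e = down (x′ , suc y′)} e∈ (inj₂ refl) = there (there (there (here refl)))

  around-incident : ∀ {x y e} → e ∈ around x y → Incident (x , y) e
  around-incident (here refl) = inj₁ refl
  around-incident (there (here refl)) = inj₂ refl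
  around-incident {y = zero}  (there (there (here refl))) = inj₁ refl
  around-incident {y = suc y} (there (there (here refl))) = inj₁ refl
  around-incident (there (there (there (here refl)))) = inj₂ refl

  around-unique : ∀ x y → Unique (around x y)
  around-unique x y = ((λ ()) ∷ (λ ()) ∷ (λ ()) ∷ []) ∷ ((λ ()) ∷ (λ ()) ∷ []) ∷ ((λ ()) ∷ []) ∷ [] ∷ []

  has : List Edge → Edge → ℕ
  has f e = ⟦ does (e ∈ᵉ? f) ⟧

  -- Both lists are free of repetitions and consist of the edges of `f` among the four possible ones
  -- around the vertex.
  degree≡ : ∀ {f} → f ⊆ edges n → Unique f → ∀ x y →
            degree f (x , y) ≡ has f (left (x , y)) + has f (left (suc x , y)) + has f (down (x , y)) + has f (down (x , suc y))
  degree≡ {f} f⊆ u x y = trans (same-length (Unique.filter⁺ (Incident? (x , y)) u) (Unique.filter⁺ (_∈ᵉ? f) (around-unique x y)) to from)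
      (count₄ (left (x , y)) (left (suc x , y)) (down (x , y)) (down (x , suc y)))
    where
    to : filter (Incident? (x , y)) f ⊆ filter (_∈ᵉ? f) (around x y)
    to e∈ with ∈.∈-filter⁻ (Incident? (x , y)) {xs = f} e∈
    ... | e∈f , i = ∈.∈-filter⁺ (_∈ᵉ? f) (incident-around (f⊆ e∈f) i) e∈f
    from : filter (_∈ᵉ? f) (around x y) ⊆ filter (Incident? (x , y)) f
    from e∈ with ∈.∈-filter⁻ (_∈ᵉ? f) {xs = around x y} e∈
    ... | e∈a , e∈f = ∈.∈-filter⁺ (Incident? (x , y)) e∈f (around-incident e∈a)
    cons : ∀ e es → length (filter (_∈ᵉ? f) (e ∷ es)) ≡ has f e + length (filter (_∈ᵉ? f) es)
    cons e es with does (e ∈ᵉ? f)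
    ... | true  = refl
    ... | false = refl
    assoc : ∀ a b c d → a + (b + (c + (d + 0))) ≡ a + b + c + d
    assoc = solve-∀
    count₄ : ∀ a b c d → length (filter (_∈ᵉ? f) (a ∷ b ∷ c ∷ d ∷ [])) ≡ has f a + has f b + has f c + has f d
    count₄ a b c d = trans (trans (cons a _) (cong (has f a +_) (trans (cons b _) (cong (has f b +_) (trans (cons c _) (cong (has f c +_) (cons d [])))))))
                           (assoc (has f a) _ _ _)

-- Edge sets read as configurations.

module Correspondence {n P : ℕ} (N≡ : 2 * n ≡ suc (suc P)) {f : List Edge} (f⊆ : f ⊆ edges n) (f-unique : Unique f)
                      (ext : ∀ m k → m + k ≡ suc P → down (double m , 0) ∈ f) where

  open Geometry {n} {P} N≡

  adjacent-sym : ∀ {u v} → Adjacent f u v → Adjacent f v u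
  adjacent-sym = Any.map λ { (inj₁ e) → inj₂ e ; (inj₂ e) → inj₁ e }

  link-adjacent : ∀ {u v} → Link P (bits f) u v → Adjacent f (place u) (place v)
  link-adjacent (link {m} {y} {k} d p e) = lose e∈ (edge-ends m y k d (positive y e∈))
    where
    e∈ : edge m y d ∈ f
    e∈ = ∈-bits k d e
    positive : ∀ y → edge m y d ∈ f → d ≡ south → 1 ≤ y
    positive zero    e∈ refl = ⊥-elim (south∉edges m (f⊆ e∈))
    positive (suc y) e∈ refl = s≤s z≤n
  link-adjacent (legLink {m} {k} p) = lose (ext m k p) (inj₂ (cong (λ x → vertex (x , 0) , foot (double m)) (sym (+-identityʳ (double m)))))

  linked-joined : ∀ {u v} → Linked P (bits f) u v → Joined f (place u) (place v)
  linked-joined ε            = _ , stop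
  linked-joined (fwd e ◅ s) = joined-step (link-adjacent e) (linked-joined s)
  linked-joined (bwd e ◅ s) = joined-step (adjacent-sym (link-adjacent e)) (linked-joined s)

  -- By `view` every edge of `f` joins two places, so a path that starts at a place never leaves
  -- them.
  adjacent-linked : ∀ {u v} → Inside P u → Adjacent f (place u) v →
                    ∃ λ w → v ≡ place w × Inside P w × u ~[ P , bits f ] w
  adjacent-linked {u} {v} u-in a with find a
  ... | e , e∈ , eq = go (view (f⊆ e∈)) e∈ eq
    where
    Goal : Set
    Goal = ∃ λ w → v ≡ place w × Inside P w × u ~[ P , bits f ] w
    match : ∀ {e w w′} → Inside P w → Inside P w′ → Link P (bits f) w w′ →
            ends e ≡ (place w , place w′) ⊎ ends e ≡ (place w′ , place w) →
            ends e ≡ (place u , v) ⊎ ends e ≡ (v , place u) → Goal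
    match {w = w} {w′} i i′ l (inj₁ p) (inj₁ q) with trans (sym p) q
    ... | r with refl ← place-injective u-in i (sym (,-injectiveˡ r)) = w′ , sym (,-injectiveʳ r) , i′ , fwd l
    match {w = w} {w′} i i′ l (inj₁ p) (inj₂ q) with trans (sym p) q
    ... | r with refl ← place-injective u-in i′ (sym (,-injectiveʳ r)) = w , sym (,-injectiveˡ r) , i , bwd l
    match {w = w} {w′} i i′ l (inj₂ p) (inj₁ q) with trans (sym p) q
    ... | r with refl ← place-injective u-in i′ (sym (,-injectiveˡ r)) = w , sym (,-injectiveʳ r) , i , bwd l
    match {w = w} {w′} i i′ l (inj₂ p) (inj₂ q) with trans (sym p) q
    ... | r with refl ← place-injective u-in i (sym (,-injectiveʳ r)) = w′ , sym (,-injectiveˡ r) , i′ , fwd l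
    go : ∀ {e} → EdgeView e → e ∈ f → ends e ≡ (place u , v) ⊎ ends e ≡ (v , place u) → Goal
    go (inner m y k d p h) e∈ = match p (far-inside d p) (link d p (bits-∈ k d e∈)) (edge-ends m y k d h)
    go (outer m k p) e∈ = match {e = down (double m , 0)} {w = leg m k} {w′ = even m 0 k} p (add-zero m p) (legLink p)
      (inj₂ (cong (λ x → vertex (x , 0) , foot (double m)) (sym (+-identityʳ (double m)))))

  path-linked : ∀ {u x z us} → Inside P u → x ≡ place u → Path f x z us →
                ∃ λ w → z ≡ place w × Inside P w × Linked P (bits f) u w
  path-linked {u} i e stop = u , e , i , ε
  path-linked {u} i refl (step a p _) with adjacent-linked i a
  ... | w , e , i′ , l with path-linked i′ e p
  ...   | w′ , e′ , i″ , s = w′ , e′ , i″ , l ◅ s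

  joined-linked : ∀ {u v} → Inside P u → Inside P v → Joined f (place u) (place v) → Linked P (bits f) u v
  joined-linked i j (us , p) with path-linked i refl p
  ... | w , e , i′ , s with refl ← place-injective j i′ e = s

  degree-odd : ∀ m y k → degree f (suc (double m + y) , y) ≡
    ⟦ bits f m y k west ⟧ + ⟦ bits f m y k east ⟧ + ⟦ bits f m y k north ⟧ + ⟦ bits f m y k south ⟧
  degree-odd m y k = trans (degree≡ f⊆ f-unique (suc (double m + y)) y)
    (trans (cong (λ x → W + E + S + has f (down (x , suc y))) (sym (+-suc (double m) y))) (lemma W E S N))
    where
    W E S N : ℕ
    W = ⟦ bits f m y k west ⟧
    E = ⟦ bits f m y k east ⟧
    S = ⟦ bits f m y k south ⟧
    N = ⟦ bits f m y k north ⟧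
    lemma : ∀ w e s n → w + e + s + n ≡ w + e + n + s
    lemma = solve-∀

  degree-even : ∀ m y k → suc m + y + k ≡ suc P → degree f (double (suc m) + y , y) ≡
    ⟦ bits f (suc m) y k west ⟧ + ⟦ bits f m y k east ⟧ + ⟦ floor (bits f) (suc m) y k ⟧ + ⟦ bits f m (suc y) k south ⟧
  degree-even m y k p = trans (degree≡ f⊆ f-unique (double (suc m) + y) y)
    (trans (cong₂ (λ d u → E + W + d + u) (below≡ y p) (cong (λ x → has f (down (suc x , suc y))) (sym (+-suc (double m) y))))
      (cong (λ s → s + F + S) (+-comm E W)))
    where
    W E S F : ℕ
    W = ⟦ bits f (suc m) y k west ⟧
    E = ⟦ bits f m y k east ⟧
    S = ⟦ bits f m (suc y) k south ⟧
    F = ⟦ floor (bits f) (suc m) y k ⟧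
    below≡ : ∀ y → suc m + y + k ≡ suc P → has f (down (double (suc m) + y , y)) ≡ ⟦ floor (bits f) (suc m) y k ⟧
    below≡ zero    p = cong ⟦_⟧ (dec-true (down (double (suc m) + 0 , 0) ∈ᵉ? f)
      (subst (λ x → down (x , 0) ∈ f) (sym (+-identityʳ _)) (ext (suc m) k (drop-zero (suc m) p))))
    below≡ (suc y) p = refl

  -- All boundary vertices have x - y even.
  odd-interior : ∀ m y → ¬ Boundary n (suc (double m + y) , y)
  odd-interior m y (x , inj₁ e) = <-irrefl (trans (,-injectiveʳ e) (sym (,-injectiveˡ e))) (s≤s (m≤n+m y (double m)))
  odd-interior m y (x , inj₂ e) with coindex x
  ... | l , p with trans e (R≡ x refl p)
  ...   | r with ,-injectiveˡ r | ,-injectiveʳ r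
  ...     | r₁ | refl = double≢ (sym (+-cancelʳ-≡ y (suc (double m)) (double (toℕ x)) r₁))

  even-interior : ∀ m y k → suc m + y + suc k ≡ suc P → ¬ Boundary n (double (suc m) + y , y)
  even-interior m y k p (x , inj₁ e) = <-irrefl (trans (,-injectiveʳ e) (sym (,-injectiveˡ e))) (s≤s (m≤n⇒m≤1+n (m≤n+m y (double m))))
  even-interior m y k p (x , inj₂ e) with coindex x
  ... | l , q with trans e (R≡ x refl q)
  ...   | r with ,-injectiveˡ r | ,-injectiveʳ r
  ...     | r₁ | refl with double-injective {suc m} (+-cancelʳ-≡ y (double (suc m)) (double (toℕ x)) r₁)
  ...       | m≡ = <-irrefl (trans (cong (_+ y) m≡) q) (subst (suc m + y <_) p (m<m+n (suc m + y) (s≤s z≤n)))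

  R-place : ∀ x {j l} → toℕ x ≡ j → j + l ≡ suc P → vertex (R n x) ≡ place (even j l 0)
  R-place x e p = cong vertex (R≡ x e p)

  L-place : ∀ x {i k} → toℕ x ≡ i → vertex (L n x) ≡ place (even 0 i k)
  L-place x refl = refl

  leg-place : ∀ x {i k} → toℕ x ≡ i → externalEnd n x ≡ place (leg i k)
  leg-place x refl = cong foot (sym (double≡ (toℕ x)))

  lookup≡ : ∀ (w : Word n) x {i} → toℕ x ≡ i → lookup w x ≡ at (toList w) i
  lookup≡ w x refl = lookup-at w x

  to-at : ∀ (π : Word n) x z → Matched n π x z → MatchedAt (toList π) (toℕ x) (toℕ z)
  to-at π x z (a , b , d) = trans (sym (lookup-at π x)) a , trans (sym (lookup-at π z)) b , d

  from-at : ∀ (π : Word n) x z → MatchedAt (toList π) (toℕ x) (toℕ z) → Matched n π x z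
  from-at π x z (a , b , d) = trans (lookup-at π x) a , trans (lookup-at π z) b , d

  module _ {σ τ π : Word n} where

    -- `IsTFPL` ties no vertical edge to the first letter of σ or the last one of τ, and the last
    -- letter of σ is needed for `summit`; these three letters are supplied separately, from the
    -- Dyck property.
    to-TFPL : at (toList σ) 0 ≡ 0F → at (toList σ) (suc P) ≡ 1F → at (toList τ) (suc P) ≡ 1F →
              IsTFPL n σ τ π f → TFPL P (letters σ) (letters τ) (pairing π) (bits f)
    to-TFPL σ-first σ-last τ-last I = record
      { bottom      = λ m k _ → ∉-bits k south (south∉edges m ∘ f⊆)
      ; odd-degree  = λ m y k p → trans (sym (degree-odd m y k)) (All.lookup interior (∈vertices (odd-in p)) (odd-interior m y))
      ; even-degree = λ m y k p → trans (sym (degree-even m y (suc k) (raise-last (suc m) p)))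
                        (All.lookup interior (∈vertices (even-in {suc m} (raise-last (suc m) p))) (even-interior m y k (raise-last (suc m) p)))
      ; left-edge   = λ y k p → bits-∈ k west (left-edge′ y k p)
      ; left-floor  = left-floor′
      ; right-edge  = λ m y p → bits-∈ 0 east (right-edge′ m y p)
      ; right-floor = right-floor′
      ; summit      = cong is1 σ-last
      ; left-path   = left-path′
      ; right-path  = right-path′
      ; leg-path    = leg-path′ }
      where
      open IsTFPL I
      left-edge′ : ∀ y k → y + k ≡ P → edge 0 y west ∈ f
      left-edge′ y k p with index {y} {suc k} (raise-last 0 p)
      ... | x , refl = leftHoriz x (subst (suc (suc (toℕ x)) ≤_) (sym N≡) (s≤s (s≤s (subst (toℕ x ≤_) p (m≤m+n _ k)))))
      left-floor′ : ∀ y k → y + k ≡ suc P → floor (bits f) 0 y k ≡ not (letters σ y k)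
      left-floor′ zero k p = sym (cong (not ∘ is1) σ-first)
      left-floor′ (suc y) k p with index {suc y} {k} p
      ... | x , e with at (toList σ) (suc y) in l
      ...   | 0F = bits-∈ {m = 0} k north (subst (λ z → down (z , z) ∈ f) e (Equivalence.from (leftVert x (subst (0 <_) (sym e) (s≤s z≤n))) (trans (lookup≡ σ x e) l)))
      ...   | 1F = ∉-bits {m = 0} k north λ e∈ → contradiction (trans (sym l) (trans (sym (lookup≡ σ x e))
                (Equivalence.to (leftVert x (subst (0 <_) (sym e) (s≤s z≤n))) (subst (λ z → down (z , z) ∈ f) (sym e) e∈)))) λ ()
      right-edge′ : ∀ m y → m + y ≡ P → edge m y east ∈ f
      right-edge′ m y p with index {suc m} {y} (cong suc p)
      ... | x , e = subst (λ v → left v ∈ f) (R≡ x e (cong suc p)) (rightHoriz x (subst (0 <_) (sym e) (s≤s z≤n)))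
      right-floor′ : ∀ m y → m + y ≡ suc P → floor (bits f) m y 0 ≡ letters τ m y
      right-floor′ m zero p = sym (trans (cong (is1 ∘ at (toList τ)) (trans (sym (+-identityʳ m)) p)) (cong is1 τ-last))
      right-floor′ m (suc y) p with index {m} {suc y} p
      ... | x , e with subst (suc (toℕ x) <_) (sym N≡) (s≤s (s≤s (subst₂ _≤_ (sym e) (suc-injective (trans (sym (+-suc m y)) p)) (m≤m+n m y))))
      ...   | below-last with at (toList τ) m in l
      ...     | 1F = bits-∈ 0 north (subst (λ v → down v ∈ f) (R≡ x e p) (Equivalence.from (rightVert x below-last) (trans (lookup≡ τ x e) l)))
      ...     | 0F = ∉-bits 0 north λ e∈ → contradiction (trans (sym l) (trans (sym (lookup≡ τ x e))
                (Equivalence.to (rightVert x below-last) (subst (λ v → down v ∈ f) (sym (R≡ x e p)) e∈)))) λ ()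
      left-path′ : ∀ i k → i + k ≡ suc P → letters σ i k ≡ true →
        ∃₂ λ j l → j + l ≡ suc P × letters τ j l ≡ false × Linked P (bits f) (even 0 i k) (even j l 0)
      left-path′ i k p e with index {i} {k} p
      ... | x , q with leftToRight x (trans (lookup≡ σ x q) (is1-true e))
      ...   | z , e′ , s with coindex z
      ...     | l , r = toℕ z , l , r , cong is1 (trans (sym (lookup≡ τ z refl)) e′) ,
        joined-linked p (trans (+-identityʳ _) r) (subst₂ (Joined f) (L-place x {k = k} q) (R-place z refl r) s)
      right-path′ : ∀ j l → j + l ≡ suc P → letters τ j l ≡ false →
        ∃₂ λ i k → i + k ≡ suc P × letters σ i k ≡ true × Linked P (bits f) (even 0 i k) (even j l 0)
      right-path′ j l p e with index {j} {l} p
      ... | z , q with rightToLeft z (trans (lookup≡ τ z q) (is1-false e))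
      ...   | x , e′ , s with coindex x
      ...     | k , r = toℕ x , k , r , cong is1 (trans (sym (lookup≡ σ x refl)) e′) ,
        joined-linked r (trans (+-identityʳ _) p) (subst₂ (Joined f) (L-place x {k = k} refl) (R-place z q p) s)
      leg-path′ : ∀ i k j l → i + k ≡ suc P → j + l ≡ suc P → i < j → Linked P (bits f) (leg i k) (leg j l) ⇔ pairing π i k j l
      leg-path′ i k j l p q i<j with index {i} {k} p | index {j} {l} q
      ... | x , refl | z , refl = mk⇔
        (λ s → to-at π x z
                 (to (subst₂ (Joined f) (sym (leg-place x {k = k} refl)) (sym (leg-place z {k = l} refl)) (linked-joined s))))
        (λ m → joined-linked p q (subst₂ (Joined f) (leg-place x {k = k} refl) (leg-place z {k = l} refl)
                 (from (from-at π x z m))))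
        where open Equivalence (matching x z i<j)

    from-TFPL : TFPL P (letters σ) (letters τ) (pairing π) (bits f) → IsTFPL n σ τ π f
    from-TFPL T = record
      { externals   = λ x → subst (λ z → down (z , 0) ∈ f) (double≡ (toℕ x)) (ext (toℕ x) _ (proj₂ (coindex x)))
      ; interior    = All.tabulate λ {v} v∈ → interior′ (proj₁ v) (proj₂ v) (vertices∋ v∈)
      ; leftHoriz   = leftHoriz′
      ; leftVert    = leftVert′
      ; rightHoriz  = rightHoriz′
      ; rightVert   = rightVert′
      ; leftToRight = leftToRight′
      ; rightToLeft = rightToLeft′
      ; matching    = matching′ }
      where
      open TFPL T
      interior′ : ∀ x y → InTriangle x y → ¬ Boundary n (x , y) → degree f (x , y) ≡ 2
      interior′ x y (y≤x , b) nb with offset y≤x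
      ... | inj₂ (m , refl) = trans (degree-odd m y (P ∸ (m + y))) (odd-degree m y _ (rest (odd-bound m y b)))
      ... | inj₁ (m , refl) = even-vertex m (suc P ∸ (m + y)) (rest (even-bound m y b)) nb
        where
        even-vertex : ∀ m k → m + y + k ≡ suc P → ¬ Boundary n (double m + y , y) → degree f (double m + y , y) ≡ 2
        even-vertex zero k p nb with index {y} {k} p
        ... | x , refl = contradiction (x , inj₁ refl) nb
        even-vertex (suc m) zero p nb with index {suc m} {y} (trans (sym (+-identityʳ _)) p)
        ... | x , e = contradiction (x , inj₂ (sym (R≡ x e (trans (sym (+-identityʳ _)) p)))) nb
        even-vertex (suc m) (suc k) p nb = trans (degree-even m y (suc k) p) (even-degree m y k (suc-injective (trans (sym (+-suc (suc m + y) k)) p)))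
      coindex₁ : ∀ x → suc (toℕ x) < 2 * n → ∃ λ k → toℕ x + k ≡ P
      coindex₁ x l = P ∸ toℕ x , rest (≤-pred (≤-pred (subst (suc (suc (toℕ x)) ≤_) N≡ l)))
      leftHoriz′ : ∀ x → suc (toℕ x) < 2 * n → left (suc (toℕ x) , toℕ x) ∈ f
      leftHoriz′ x l with coindex₁ x l
      ... | k , p = ∈-bits {m = 0} k west (left-edge (toℕ x) k p)
      leftVert′ : ∀ x → 0 < toℕ x → down (L n x) ∈ f ⇔ lookup σ x ≡ 0F
      leftVert′ x l = go (toℕ x) _ refl l (proj₂ (coindex x))
        where
        go : ∀ i k → toℕ x ≡ i → 0 < i → i + k ≡ suc P → down (i , i) ∈ f ⇔ lookup σ x ≡ 0F
        go (suc y) k e _ p = mk⇔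
          (λ e∈ → trans (lookup≡ σ x e) (is1-false (sym (Bool-flip (trans (sym (bits-∈ {m = 0} k north e∈)) (left-floor (suc y) k p))))))
          (λ s → ∈-bits {m = 0} k north (trans (left-floor (suc y) k p) (cong (not ∘ is1) (trans (sym (lookup≡ σ x e)) s))))
      rightHoriz′ : ∀ x → 0 < toℕ x → left (R n x) ∈ f
      rightHoriz′ x l = go (toℕ x) _ refl l (proj₂ (coindex x))
        where
        go : ∀ j y → toℕ x ≡ j → 0 < j → j + y ≡ suc P → left (R n x) ∈ f
        go (suc m) y e _ p = subst (λ v → left v ∈ f) (sym (R≡ x e p)) (∈-bits {m = m} 0 east (right-edge m y (suc-injective p)))
      rightVert′ : ∀ x → suc (toℕ x) < 2 * n → down (R n x) ∈ f ⇔ lookup τ x ≡ 1F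
      rightVert′ x l with coindex₁ x l
      ... | y , q with trans (+-suc (toℕ x) y) (cong suc q)
      ...   | p rewrite R≡ x refl p = mk⇔
        (λ e∈ → trans (lookup≡ τ x refl) (is1-true (trans (sym (right-floor (toℕ x) (suc y) p)) (bits-∈ {m = toℕ x} 0 north e∈))))
        (λ s → ∈-bits {m = toℕ x} 0 north (trans (right-floor (toℕ x) (suc y) p) (cong is1 (trans (sym (lookup≡ τ x refl)) s))))
      leftToRight′ : ∀ x → lookup σ x ≡ 1F → ∃[ z ] (lookup τ z ≡ 0F × Joined f (vertex (L n x)) (vertex (R n z)))
      leftToRight′ x e with coindex x
      ... | k , p with left-path (toℕ x) k p (cong is1 (trans (sym (lookup≡ σ x refl)) e))
      ...   | j , l , q , e′ , s with index {j} {l} q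
      ...     | z , r = z , trans (lookup≡ τ z r) (is1-false e′) ,
        subst₂ (Joined f) (sym (L-place x {k = k} refl)) (sym (R-place z r q)) (linked-joined s)
      rightToLeft′ : ∀ z → lookup τ z ≡ 0F → ∃[ x ] (lookup σ x ≡ 1F × Joined f (vertex (L n x)) (vertex (R n z)))
      rightToLeft′ z e with coindex z
      ... | l , q with right-path (toℕ z) l q (cong is1 (trans (sym (lookup≡ τ z refl)) e))
      ...   | i , k , p , e′ , s with index {i} {k} p
      ...     | x , r = x , trans (lookup≡ σ x r) (is1-true e′) ,
        subst₂ (Joined f) (sym (L-place x {k = k} r)) (sym (R-place z refl q)) (linked-joined s)
      matching′ : ∀ x z → x Fin.< z → Joined f (externalEnd n x) (externalEnd n z) ⇔ Matched n π x z
      matching′ x z x<z with coindex x | coindex z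
      ... | k , p | l , q = mk⇔
        (λ s → from-at π x z
                 (to (joined-linked p q (subst₂ (Joined f) (leg-place x {k = k} refl) (leg-place z {k = l} refl) s))))
        (λ m → subst₂ (Joined f) (sym (leg-place x {k = k} refl)) (sym (leg-place z {k = l} refl))
                 (linked-joined (from (to-at π x z m))))
        where open Equivalence (leg-path (toℕ x) k (toℕ z) l p q x<z)

TFPL-resp : ∀ {P a c M h h′} → (∀ m y k → m + y + k ≡ P → ∀ d → h m y k d ≡ h′ m y k d) → TFPL P a c M h → TFPL P a c M h′
TFPL-resp {P} {h = h} {h′} h≡ T = record
  { bottom      = λ m k p → trans (sym (h≡ m 0 k (add-zero m p) south)) (bottom m k p)
  ; odd-degree  = λ m y k p → trans (sym (sum≡ (h≡ m y k p west) (h≡ m y k p east) (h≡ m y k p north) (h≡ m y k p south))) (odd-degree m y k p)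
  ; even-degree = λ m y k p → let q = trans (+-suc (m + y) k) p in
      trans (sym (sum≡ (h≡ (suc m) y k p west) (h≡ m y (suc k) q east) (floor≡ (suc m) y (suc k) (raise-last (suc m) p))
        (h≡ m (suc y) k (trans (cong (_+ k) (+-suc m y)) p) south))) (even-degree m y k p)
  ; left-edge   = λ y k p → trans (sym (h≡ 0 y k p west)) (left-edge y k p)
  ; left-floor  = λ y k p → trans (sym (floor≡ 0 y k p)) (left-floor y k p)
  ; right-edge  = λ m y p → trans (sym (h≡ m y 0 (trans (+-identityʳ _) p) east)) (right-edge m y p)
  ; right-floor = λ m y p → trans (sym (floor≡ m y 0 (trans (+-identityʳ _) p))) (right-floor m y p)
  ; summit      = summit
  ; left-path   = λ i k p e → case left-path i k p e of λ { (j , l , q , f , s) → j , l , q , f , Eq.map there′ s }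
  ; right-path  = λ j l p e → case right-path j l p e of λ { (i , k , q , f , s) → i , k , q , f , Eq.map there′ s }
  ; leg-path    = λ i k j l p q i<j → let open Equivalence (leg-path i k j l p q i<j) in
      mk⇔ (λ s → to (Eq.map back s)) (λ m → Eq.map there′ (from m)) }
  where
  open TFPL T
  sum≡ : ∀ {x y z w x′ y′ z′ w′} → x ≡ x′ → y ≡ y′ → z ≡ z′ → w ≡ w′ →
         ⟦ x ⟧ + ⟦ y ⟧ + ⟦ z ⟧ + ⟦ w ⟧ ≡ ⟦ x′ ⟧ + ⟦ y′ ⟧ + ⟦ z′ ⟧ + ⟦ w′ ⟧
  sum≡ refl refl refl refl = refl
  floor≡ : ∀ m y k → m + y + k ≡ suc P → floor h m y k ≡ floor h′ m y k
  floor≡ m zero    k p = refl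
  floor≡ m (suc y) k p = h≡ m y k (sum-middle m p) north
  there′ : ∀ {u v} → Link P h u v → Link P h′ u v
  there′ (link d p e) = link d p (trans (sym (h≡ _ _ _ p d)) e)
  there′ (legLink p)  = legLink p
  back : ∀ {u v} → Link P h′ u v → Link P h u v
  back (link d p e) = link d p (trans (h≡ _ _ _ p d) e)
  back (legLink p)  = legLink p

-- Configurations turned into edge sets.

module Realize {n P : ℕ} (N≡ : 2 * n ≡ suc (suc P)) where

  open Geometry {n} {P} N≡

  value : Config → Edge → Bool
  value h (left (x , y)) with halve (x ∸ y)
  -- The east edge of `odd m y` is stored at x = 2(m + 1) + y, hence `pred`.
  ... | inj₁ m = h (pred m) y (P ∸ (pred m + y)) east
  ... | inj₂ m = h m y (P ∸ (m + y)) west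
  value h (down (x , zero)) = true
  value h (down (x , suc y)) with halve (x ∸ suc y)
  ... | inj₁ m = h m y (P ∸ (m + y)) north
  ... | inj₂ m = h m (suc y) (P ∸ (m + suc y)) south

  value-edge : ∀ h m y k d → m + y + k ≡ P → (d ≡ south → 1 ≤ y) → value h (edge m y d) ≡ h m y k d
  value-edge h m y k d p s with trans (cong (_∸ (m + y)) (sym p)) (m+n∸m≡n (m + y) k)
  value-edge h m y k west p s  | e rewrite m+n∸n≡m (suc (double m)) y | halve-suc-double m | e = refl
  value-edge h m y k east p s  | e rewrite m+n∸n≡m (double (suc m)) y | halve-double (suc m) | e = refl
  value-edge h m y k north p s | e rewrite m+n∸n≡m (double m) (suc y) | halve-double m | e = refl
  value-edge h m zero    k south p s | e with () ← s refl
  value-edge h m (suc y) k south p s | e rewrite m+n∸n≡m (suc (double m)) (suc y) | halve-suc-double m | e = refl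

  graph : Config → List Edge
  graph h = filter (λ e → value h e Bool.≟ true) (edges n)

  graph⊆ : ∀ h → graph h ⊆ edges n
  graph⊆ h e∈ = proj₁ (∈.∈-filter⁻ (λ e → value h e Bool.≟ true) {xs = edges n} e∈)

  graph∈sublists : ∀ h → graph h ∈ sublists (edges n)
  graph∈sublists h = filter∈sublists _ (edges n)

  graph-external : ∀ h m k → m + k ≡ suc P → down (double m , 0) ∈ graph h
  graph-external h m k p = ∈.∈-filter⁺ (λ e → value h e Bool.≟ true) (outer∈edges {m} p) refl

  bits-graph : ∀ h → (∀ m k → m + k ≡ P → h m 0 k south ≡ false) → ∀ m y k → m + y + k ≡ P → ∀ d → h m y k d ≡ bits (graph h) m y k d
  bits-graph h bottom m y k p d = decide y d p (h m y k d) refl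
    where
    proper : ∀ y d → m + y + k ≡ P → (d ≡ south → 1 ≤ y) → ∀ b → h m y k d ≡ b → b ≡ bits (graph h) m y k d
    proper y d p s true e = sym (bits-∈ {m = m} k d (∈.∈-filter⁺ (λ e → value h e Bool.≟ true) (∈edges d p s)
      (trans (value-edge h m y k d p s) e)))
    proper y d p s false e = sym (∉-bits {m = m} k d λ e∈ → contradiction (trans (sym e) (trans (sym (value-edge h m y k d p s))
      (proj₂ (∈.∈-filter⁻ (λ e → value h e Bool.≟ true) {xs = edges n} e∈)))) λ ())
    decide : ∀ y d → m + y + k ≡ P → ∀ b → h m y k d ≡ b → b ≡ bits (graph h) m y k d
    decide zero south p b e = trans (trans (sym e) (bottom m k (drop-zero m p)))
      (sym (∉-bits {m = m} k south (λ e∈ → south∉edges m (graph⊆ h e∈))))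
    decide (suc y) south p = proper (suc y) south p λ _ → s≤s z≤n
    decide y west  p = proper y west p λ ()
    decide y east  p = proper y east p λ ()
    decide y north p = proper y north p λ ()

  bits-⊆ : ∀ {f f′} → f ⊆ edges n → (∀ m k → m + k ≡ suc P → down (double m , 0) ∈ f′) →
           (∀ m y k → m + y + k ≡ P → ∀ d → bits f m y k d ≡ bits f′ m y k d) → f ⊆ f′
  bits-⊆ {f} {f′} f⊆ ext′ b≡ e∈ = go (view (f⊆ e∈)) e∈
    where
    go : ∀ {e} → EdgeView e → e ∈ f → e ∈ f′
    go (inner m y k d p _) e∈ = ∈-bits {m = m} k d (trans (sym (b≡ m y k p d)) (bits-∈ {m = m} k d e∈))
    go (outer m k p) e∈ = ext′ m k p

-- Words

dual : List Letter → List Letter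
dual w = reverse (map opposite w)

toList-* : ∀ {m} (w : Vec Letter m) → toList (w *) ≡ dual (toList w)
toList-* w = trans (Vec.toList-reverse (Vec.map opposite w)) (cong reverse (Vec.toList-map opposite w))

dual-∷ : ∀ x w → dual (x ∷ w) ≡ dual w ∷ʳ opposite x
dual-∷ x w = List.unfold-reverse (opposite x) (map opposite w)

dual-++ : ∀ u v → dual (u ++ v) ≡ dual v ++ dual u
dual-++ u v = trans (cong reverse (List.map-++ opposite u v)) (List.reverse-++ (map opposite u) (map opposite v))

length-dual : ∀ w → length (dual w) ≡ length w
length-dual w = trans (List.length-reverse (map opposite w)) (List.length-map opposite w)

opposite-involutive : ∀ (x : Letter) → opposite (opposite x) ≡ x
opposite-involutive 0F = refl
opposite-involutive 1F = refl

dual-involutive : ∀ w → dual (dual w) ≡ w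
dual-involutive []      = refl
dual-involutive (x ∷ w) = trans (cong dual (dual-∷ x w)) (trans (dual-++ (dual w) [ opposite x ])
  (cong₂ _∷_ (opposite-involutive x) (dual-involutive w)))

*-involutive : ∀ {m} (w : Vec Letter m) → (w *) * ≡ w
*-involutive w = trans (sym (Vec.cast-is-id refl _)) (Vec.toList-injective refl ((w *) *) w
  (trans (toList-* (w *)) (trans (cong dual (toList-* w)) (dual-involutive (toList w)))))

count-++ : ∀ a u v → count a (u ++ v) ≡ count a u + count a v
count-++ a u v = trans (cong length (List.filter-++ (Fin._≟ a) u v)) (List.length-++ (filter (Fin._≟ a) u))

count-dual : ∀ a w → count a (dual w) ≡ count (opposite a) w
count-dual a []      = refl
count-dual a (x ∷ w) = trans (cong (count a) (dual-∷ x w)) (trans (count-++ a (dual w) [ opposite x ])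
  (trans (cong₂ _+_ (count-dual a w) (single a x)) (trans (+-comm (count (opposite a) w) _) (sym (count-++ (opposite a) [ x ] w)))))
  where
  single : ∀ a x → count a [ opposite x ] ≡ count (opposite a) [ x ]
  single 0F 0F = refl
  single 0F 1F = refl
  single 1F 0F = refl
  single 1F 1F = refl

count-length : ∀ w → count 0F w + count 1F w ≡ length w
count-length []       = refl
count-length (0F ∷ w) = cong suc (count-length w)
count-length (1F ∷ w) = trans (+-suc (count 0F w) (count 1F w)) (cong suc (count-length w))

All-inits⁺ : ∀ {Q : List Letter → Set} w → (∀ p q → w ≡ p ++ q → Q p) → All Q (inits w)
All-inits⁺ []      h = h [] [] refl ∷ []
All-inits⁺ (x ∷ w) h = h [] (x ∷ w) refl ∷ All.map⁺ (All-inits⁺ w λ p q e → h (x ∷ p) q (cong (x ∷_) e))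

All-inits⁻ : ∀ {Q : List Letter → Set} w → All Q (inits w) → ∀ p q → w ≡ p ++ q → Q p
All-inits⁻ w       (h ∷ _)  []      q e = h
All-inits⁻ (x ∷ w) (_ ∷ hs) (y ∷ p) q e with refl ← List.∷-injectiveˡ e = All-inits⁻ w (All.map⁻ hs) p q (List.∷-injectiveʳ e)

suffix-prefix : ∀ {n w} → count 0F w ≡ n → count 1F w ≡ n → ∀ p q → w ≡ p ++ q →
                count 0F q ≤ count 1F q → count 1F p ≤ count 0F p
suffix-prefix {n} {w} z o p q refl l = +-cancelʳ-≤ (count 1F q) _ _
  (subst₂ _≤_ (trans z (trans (sym o) (count-++ 1F p q))) refl (subst (_≤ count 0F p + count 1F q) (sym (count-++ 0F p q)) (+-monoʳ-≤ (count 0F p) l)))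

prefix-suffix : ∀ {n w} → count 0F w ≡ n → count 1F w ≡ n → ∀ p q → w ≡ p ++ q →
                count 1F p ≤ count 0F p → count 0F q ≤ count 1F q
prefix-suffix {n} {w} z o p q refl l = +-cancelˡ-≤ (count 1F p) _ _
  (subst (count 1F p + count 0F q ≤_) (trans (sym (count-++ 0F p q)) (trans z (trans (sym o) (count-++ 1F p q)))) (+-monoˡ-≤ (count 0F q) l))

-- A prefix of the dual is the dual of a suffix, and a suffix of a Dyck word has at least as many
-- letters 1 as 0.
IsDyck-dual : ∀ {n w} → IsDyck n w → IsDyck n (dual w)
IsDyck-dual {n} {w} (z , o , pre) = trans (count-dual 0F w) o , trans (count-dual 1F w) z , All-inits⁺ (dual w) λ p q e →
  subst₂ _≤_ (trans (count-dual 0F p) refl) (count-dual 1F p)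
    (prefix-suffix z o (dual q) (dual p) (w≡ p q e) (All-inits⁻ w pre (dual q) (dual p) (w≡ p q e)))
  where
  w≡ : ∀ p q → dual w ≡ p ++ q → w ≡ dual q ++ dual p
  w≡ p q e = trans (sym (dual-involutive w)) (trans (cong dual e) (dual-++ p q))

Dyck-* : ∀ n (w : Word n) → Dyck n w → Dyck n (w *)
Dyck-* n w d = subst (IsDyck n) (sym (toList-* w)) (IsDyck-dual d)

at-++ˡ : ∀ u v {i} → i < length u → at (u ++ v) i ≡ at u i
at-++ˡ (x ∷ u) v {zero}  _       = refl
at-++ˡ (x ∷ u) v {suc i} (s≤s l) = at-++ˡ u v l

at-length : ∀ u x v → at (u ++ x ∷ v) (length u) ≡ x
at-length []      x v = refl
at-length (_ ∷ u) x v = at-length u x v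

at-dual : ∀ w {i k} → suc (i + k) ≡ length w → at (dual w) i ≡ opposite (at w k)
at-dual (x ∷ w) {i} {zero}  e = trans (cong₂ at (dual-∷ x w) (trans (trans (sym (+-identityʳ i)) (suc-injective e)) (sym (length-dual w))))
  (at-length (dual w) (opposite x) [])
at-dual (x ∷ w) {i} {suc k} e = trans (cong (λ u → at u i) (dual-∷ x w)) (trans (at-++ˡ (dual w) _ i<)
  (at-dual w (trans (sym (+-suc i k)) (suc-injective e))))
  where
  i< : i < length (dual w)
  i< = subst (i <_) (sym (length-dual w)) (subst (i <_) (suc-injective e) (m<m+n i (s≤s z≤n)))

is1-opposite : ∀ x → is1 (opposite x) ≡ not (is1 x)
is1-opposite 0F = refl
is1-opposite 1F = refl

module _ {m P : ℕ} (m≡ : m ≡ suc (suc P)) (w : Vec Letter m) where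

  length-word : length (toList w) ≡ suc (suc P)
  length-word = trans (Vec.length-toList w) m≡

  letters-* : ∀ i k → i + k ≡ suc P → letters (w *) i k ≡ mirror-letters (letters w) i k
  letters-* i k p = trans (cong (λ u → is1 (at u i)) (toList-* w))
    (trans (cong is1 (at-dual (toList w) (trans (cong suc p) (sym length-word)))) (is1-opposite (at (toList w) k)))

take-length : ∀ (u v : List Letter) → take (length u) (u ++ v) ≡ u
take-length []      v = refl
take-length (x ∷ u) v = cong (x ∷_) (take-length u v)

drop-length : ∀ (u v : List Letter) → drop (length u) (u ++ v) ≡ v
drop-length []      v = refl
drop-length (x ∷ u) v = drop-length u v

between-dual : ∀ w a b c → a + b + c ≡ length w → take b (drop c (dual w)) ≡ dual (take b (drop a w))
between-dual w a b c e = trans (cong₂ (λ i x → take b (drop i x)) (sym C-length) dual≡)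
  (trans (cong (take b) (drop-length (dual C) (dual B ++ dual A)))
    (trans (cong (λ i → take i (dual B ++ dual A)) (sym (trans (length-dual B) B-length))) (take-length (dual B) (dual A))))
  where
  A B C : List Letter
  A = take a w
  B = take b (drop a w)
  C = drop b (drop a w)
  dual≡ : dual w ≡ dual C ++ dual B ++ dual A
  dual≡ = trans (cong dual (trans (sym (List.take++drop≡id a w)) (cong (A ++_) (sym (List.take++drop≡id b (drop a w))))))
    (trans (dual-++ A (B ++ C)) (trans (cong (_++ dual A) (dual-++ B C)) (List.++-assoc (dual C) (dual B) (dual A))))
  drop-a : length (drop a w) ≡ b + c
  drop-a = trans (List.length-drop a w) (trans (cong (_∸ a) (trans (sym e) (+-assoc a b c))) (m+n∸m≡n a (b + c)))
  B-length : length B ≡ b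
  B-length = trans (List.length-take b (drop a w)) (m≤n⇒m⊓n≡m (subst (b ≤_) (sym drop-a) (m≤m+n b c)))
  C-length : length (dual C) ≡ c
  C-length = trans (length-dual C) (trans (List.length-drop b (drop a w)) (trans (cong (_∸ b) drop-a) (m+n∸m≡n b c)))

matched-dual : ∀ w {i k j l} → suc (i + k) ≡ length w → suc (j + l) ≡ length w → i < j →
               MatchedAt w i j → MatchedAt (dual w) l k
matched-dual w {i} {k} {j} {l} p q i<j (opens , closes , balanced) =
  trans (at-dual w (trans (cong suc (+-comm l j)) q)) (cong opposite closes) ,
  trans (at-dual w (trans (cong suc (+-comm k i)) p)) (cong opposite opens) ,
  subst (λ u → IsDyck (count 0F u) u) (sym between≡)
    -- The number of 0s of the dual is the number of 1s of `B`, which equals its number of 0s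
    -- because `B` is balanced.
    (subst (λ z → IsDyck z (dual B)) (sym (trans (count-dual 0F B) (proj₁ (proj₂ balanced)))) (IsDyck-dual balanced))
  where
  B : List Letter
  B = take (j ∸ suc i) (drop (suc i) w)
  b : ℕ
  b = j ∸ suc i
  i+b : suc i + b ≡ j
  i+b = m+[n∸m]≡n i<j
  k≡ : k ≡ suc l + b
  k≡ = +-cancelˡ-≡ i k (suc l + b) (trans (suc-injective (trans p (sym q))) (trans (cong (_+ l) (sym i+b)) (shuffle i b l)))
    where
    shuffle : ∀ i b l → suc i + b + l ≡ i + (suc l + b)
    shuffle = solve-∀
  between≡ : take (k ∸ suc l) (drop (suc l) (dual w)) ≡ dual B
  between≡ = trans (cong (λ z → take z (drop (suc l) (dual w))) (trans (cong (_∸ suc l) k≡) (m+n∸m≡n (suc l) b)))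
    (between-dual w (suc i) b (suc l) (trans (cong (_+ suc l) i+b) (trans (+-suc j l) q)))

module _ {m P : ℕ} (m≡ : m ≡ suc (suc P)) (π : Vec Letter m) where

  pairing-* : ∀ i k j l → i + k ≡ suc P → j + l ≡ suc P → i < j → pairing (π *) i k j l ⇔ mirror-pairing (pairing π) i k j l
  pairing-* i k j l p q i<j = mk⇔
    (λ h → subst (λ u → MatchedAt u l k) (dual-involutive w) (matched-dual (dual w) (bound p) (bound q) i<j
       (subst (λ u → MatchedAt u i j) (toList-* π) h)))
    (λ h → subst (λ u → MatchedAt u i j) (sym (toList-* π))
       (matched-dual w (bound′ (trans (+-comm l j) q)) (bound′ (trans (+-comm k i) p)) l<k h))
    where
    w : List Letter
    w = toList π
    bound′ : ∀ {s} → s ≡ suc P → suc s ≡ length w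
    bound′ p = trans (cong suc p) (sym (length-word m≡ π))
    bound : ∀ {s} → s ≡ suc P → suc s ≡ length (dual w)
    bound p = trans (bound′ p) (sym (length-dual w))
    l<k : l < k
    l<k = +-cancelˡ-< i l k (subst (i + l <_) (trans q (sym p)) (+-monoˡ-< l i<j))

-- Horizontal strips

nth : List ℕ → ℕ → ℕ
nth []       _       = 0
nth (l ∷ ls) zero    = l
nth (l ∷ ls) (suc r) = nth ls r

nth-++ˡ : ∀ as bs {r} → r < length as → nth (as ++ bs) r ≡ nth as r
nth-++ˡ (a ∷ as) bs {zero}  _       = refl
nth-++ˡ (a ∷ as) bs {suc r} (s≤s l) = nth-++ˡ as bs l

nth-++ʳ : ∀ as bs {r} → length as ≤ r → nth (as ++ bs) r ≡ nth bs (r ∸ length as)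
nth-++ʳ []       bs         _       = refl
nth-++ʳ (a ∷ as) bs {suc r} (s≤s l) = nth-++ʳ as bs l

nth≥ : ∀ {k ls r} → All (k ≤_) ls → r < length ls → k ≤ nth ls r
nth≥ {r = zero}  (l ∷ _)  _       = l
nth≥ {r = suc r} (_ ∷ ls) (s≤s l) = nth≥ ls l

nth≤ : ∀ {k ls} r → All (_≤ k) ls → nth ls r ≤ k
nth≤ r       []       = z≤n
nth≤ zero    (l ∷ _)  = l
nth≤ (suc r) (_ ∷ ls) = nth≤ r ls

∈boxesFrom⁺ : ∀ r₀ ls {r c} → c < nth ls r → (r₀ + r , c) ∈ boxesFrom r₀ ls
∈boxesFrom⁺ r₀ (l ∷ ls) {zero} {c} c< rewrite +-identityʳ r₀ = ∈.∈-++⁺ˡ (∈.∈-map⁺ (r₀ ,_) (∈.∈-upTo⁺ c<))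
∈boxesFrom⁺ r₀ (l ∷ ls) {suc r} c< rewrite +-suc r₀ r = ∈.∈-++⁺ʳ (map (r₀ ,_) (upTo l)) (∈boxesFrom⁺ (suc r₀) ls c<)

∈boxesFrom⁻ : ∀ r₀ ls {b} → b ∈ boxesFrom r₀ ls → ∃ λ r → proj₁ b ≡ r₀ + r × proj₂ b < nth ls r
∈boxesFrom⁻ r₀ (l ∷ ls) b∈ with ∈.∈-++⁻ (map (r₀ ,_) (upTo l)) b∈
... | inj₁ p with ∈.∈-map⁻ (r₀ ,_) p
...   | c , c∈ , refl = 0 , sym (+-identityʳ r₀) , ∈.∈-upTo⁻ c∈
∈boxesFrom⁻ r₀ (l ∷ ls) b∈ | inj₂ p with ∈boxesFrom⁻ (suc r₀) ls p
... | r , e , c< = suc r , trans e (sym (+-suc r₀ r)) , c<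

boxesFrom-unique : ∀ r₀ ls → Unique (boxesFrom r₀ ls)
boxesFrom-unique r₀ []       = []
boxesFrom-unique r₀ (l ∷ ls) = Unique.++⁺ (Unique.map⁺ ,-injectiveʳ (Unique.upTo⁺ l)) (boxesFrom-unique (suc r₀) ls)
  λ { (p , q) → case ∈.∈-map⁻ (r₀ ,_) p of λ { (_ , _ , refl) → case ∈boxesFrom⁻ (suc r₀) ls q of λ
      { (r , e , _) → <-irrefl e (s≤s (m≤m+n r₀ r)) } } }

row : List Letter → ℕ → ℕ
row w = nth (rows w)

∈boxes⁺ : ∀ {m} (w : Vec Letter m) {r c} → c < row (toList w) r → (r , c) ∈ boxes w
∈boxes⁺ w = ∈boxesFrom⁺ 0 (rows (toList w))

∈boxes⁻ : ∀ {m} (w : Vec Letter m) {r c} → (r , c) ∈ boxes w → c < row (toList w) r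
∈boxes⁻ w b∈ with ∈boxesFrom⁻ 0 (rows (toList w)) b∈
... | r , refl , c< = c<

rowsFrom-++ : ∀ k p q → rowsFrom k (p ++ q) ≡ rowsFrom (k + count 1F p) q ++ rowsFrom k p
rowsFrom-++ k []       q = trans (cong (λ z → rowsFrom z q) (sym (+-identityʳ k))) (sym (List.++-identityʳ _))
rowsFrom-++ k (0F ∷ p) q = trans (cong (_∷ʳ k) (rowsFrom-++ k p q)) (List.++-assoc (rowsFrom (k + count 1F p) q) (rowsFrom k p) [ k ])
rowsFrom-++ k (1F ∷ p) q = trans (rowsFrom-++ (suc k) p q) (cong (λ z → rowsFrom z q ++ rowsFrom (suc k) p) (sym (+-suc k (count 1F p))))

length-rowsFrom : ∀ k w → length (rowsFrom k w) ≡ count 0F w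
length-rowsFrom k []       = refl
length-rowsFrom k (0F ∷ w) = trans (List.length-++ (rowsFrom k w)) (trans (+-comm _ 1) (cong suc (length-rowsFrom k w)))
length-rowsFrom k (1F ∷ w) = length-rowsFrom (suc k) w

rowsFrom≥ : ∀ k w → All (k ≤_) (rowsFrom k w)
rowsFrom≥ k []       = []
rowsFrom≥ k (0F ∷ w) = All.++⁺ (rowsFrom≥ k w) (≤-refl ∷ [])
rowsFrom≥ k (1F ∷ w) = All.map (≤-trans (n≤1+n k)) (rowsFrom≥ (suc k) w)

rowsFrom≤ : ∀ k w → All (_≤ k + count 1F w) (rowsFrom k w)
rowsFrom≤ k []       = []
rowsFrom≤ k (0F ∷ w) = All.++⁺ (rowsFrom≤ k w) (m≤m+n k _ ∷ [])
rowsFrom≤ k (1F ∷ w) = subst (λ z → All (_≤ z) (rowsFrom (suc k) w)) (sym (+-suc k _)) (rowsFrom≤ (suc k) w)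

-- Rows are counted from the last 0 of the word, so row r belongs to a 0 in q, which all the 1s of p
-- precede. In `row≤` it belongs to a 0 in p or is empty.
row≥ : ∀ p q {r} → r < count 0F q → count 1F p ≤ row (p ++ q) r
row≥ p q {r} r< = subst (count 1F p ≤_) (sym (trans (cong (λ z → nth z r) (rowsFrom-++ 0 p q))
    (nth-++ˡ (rowsFrom (count 1F p) q) (rowsFrom 0 p) r<′)))
  (nth≥ (rowsFrom≥ (count 1F p) q) r<′)
  where
  r<′ : r < length (rowsFrom (count 1F p) q)
  r<′ = subst (r <_) (sym (length-rowsFrom (count 1F p) q)) r<

row≤ : ∀ p q {r} → count 0F q ≤ r → row (p ++ q) r ≤ count 1F p
row≤ p q {r} ≤r = subst (_≤ count 1F p) (sym (trans (cong (λ z → nth z r) (rowsFrom-++ 0 p q))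
    (nth-++ʳ (rowsFrom (count 1F p) q) (rowsFrom 0 p) (subst (_≤ r) (sym (length-rowsFrom (count 1F p) q)) ≤r))))
  (nth≤ _ (rowsFrom≤ 0 p))

nth-zero : ∀ w {r} → r < count 0F w → ∃₂ λ p q → w ≡ p ++ 0F ∷ q × count 0F q ≡ r
nth-zero (1F ∷ w) r< with nth-zero w r<
... | p , q , refl , e = 1F ∷ p , q , refl , e
nth-zero (0F ∷ w) {r} (s≤s r≤) with m≤n⇒m<n∨m≡n r≤
... | inj₂ e = [] , w , refl , sym e
... | inj₁ r< with nth-zero w r<
...   | p , q , refl , e = 0F ∷ p , q , refl , e

AllPairs-either : ∀ {A : Set} {Q : A → A → Set} {xs} → AllPairs Q xs → ∀ {x y} → x ∈ xs → y ∈ xs → x ≢ y → Q x y ⊎ Q y x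
AllPairs-either (h ∷ hs) (here refl) (here refl) x≢y = contradiction refl x≢y
AllPairs-either (h ∷ hs) (here refl) (there q)   x≢y = inj₁ (All.lookup h q)
AllPairs-either (h ∷ hs) (there p)   (here refl) x≢y = inj₂ (All.lookup h p)
AllPairs-either (h ∷ hs) (there p)   (there q)   x≢y = AllPairs-either hs p q x≢y

Unique-AllPairs : ∀ {A : Set} {Q : A → A → Set} {xs} → Unique xs → (∀ {x y} → x ∈ xs → y ∈ xs → x ≢ y → Q x y) → AllPairs Q xs
Unique-AllPairs []       h = []
Unique-AllPairs (u ∷ us) h = All.tabulate (λ y∈ → h (here refl) (there y∈) (All.lookup u y∈)) ∷ Unique-AllPairs us λ p q → h (there p) (there q)

-- The number of 1s in a prefix minus the number of 0s behind it is the length of the prefix minus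
-- the number of all 0s, hence the same for both words.
exchange : ∀ {u v} p q p₁ q₁ → u ≡ p ++ q → v ≡ p₁ ++ q₁ → length p ≡ length p₁ → count 0F u ≡ count 0F v →
           count 1F p + count 0F q₁ ≡ count 1F p₁ + count 0F q
exchange p q p₁ q₁ refl refl l z = +-cancelˡ-≡ (count 0F p + count 0F p₁) _ _ (begin
  Z + Z₁ + (O + Y₁)    ≡⟨ interchange Z Z₁ O Y₁ ⟩
  Z + O + (Z₁ + Y₁)    ≡⟨ cong₂ _+_ (trans (count-length p) (trans l (sym (count-length p₁)))) (trans (sym (count-++ 0F p₁ q₁)) (trans (sym z) (count-++ 0F p q))) ⟩
  Z₁ + O₁ + (Z + Y)    ≡⟨ swap′ Z₁ O₁ Z Y ⟩
  Z + Z₁ + (O₁ + Y)    ∎)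
  where
  open ≡-Reasoning
  Z Z₁ O O₁ Y Y₁ : ℕ
  Z  = count 0F p
  Z₁ = count 0F p₁
  O  = count 1F p
  O₁ = count 1F p₁
  Y  = count 0F q
  Y₁ = count 0F q₁
  swap′ : ∀ a b c d → a + b + (c + d) ≡ c + a + (b + d)
  swap′ = solve-∀

take-suc : ∀ w {i} → i < length w → take (suc i) w ≡ take i w ∷ʳ at w i
take-suc (x ∷ w) {zero}  _       = refl
take-suc (x ∷ w) {suc i} (s≤s l) = cong (x ∷_) (take-suc w l)

drop-at : ∀ w {i} → i < length w → drop i w ≡ at w i ∷ drop (suc i) w
drop-at (x ∷ w) {zero}  _       = refl
drop-at (x ∷ w) {suc i} (s≤s l) = drop-at w l

take-all : ∀ (w : List Letter) → take (length w) w ≡ w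
take-all []      = refl
take-all (x ∷ w) = cong (x ∷_) (take-all w)

count-take-suc : ∀ w {i} → i < length w → count 1F (take (suc i) w) ≡ count 1F (take i w) + ⟦ is1 (at w i) ⟧
count-take-suc w {i} l = trans (cong (count 1F) (take-suc w l)) (trans (count-++ 1F (take i w) [ at w i ]) (cong (count 1F (take i w) +_) (single (at w i))))
  where
  single : ∀ x → count 1F [ x ] ≡ ⟦ is1 x ⟧
  single 0F = refl
  single 1F = refl

module _ {m P : ℕ} (m≡ : m ≡ suc (suc P)) (σ σ₁ : Vec Letter m) where

  private
    w w₁ : List Letter
    w  = toList σ
    w₁ = toList σ₁

    o o₁ : ℕ → ℕ
    o  i = count 1F (take i w)
    o₁ i = count 1F (take i w₁)

    |w|≡ : length w ≡ suc (suc P)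
    |w|≡ = length-word m≡ σ

    |w₁|≡ : length w₁ ≡ suc (suc P)
    |w₁|≡ = length-word m≡ σ₁

    i<|w| : ∀ {i k} → i + k ≡ suc P → i < length w
    i<|w| {i} {k} p = subst (i <_) (sym |w|≡) (s≤s (subst (i ≤_) p (m≤m+n i k)))

    i<|w₁| : ∀ {i k} → i + k ≡ suc P → i < length w₁
    i<|w₁| {i} {k} p = subst (i <_) (sym |w₁|≡) (s≤s (subst (i ≤_) p (m≤m+n i k)))

    same-take : ∀ i → length (take i w) ≡ length (take i w₁)
    same-take i = trans (List.length-take i w) (trans (cong (i Data.Nat.⊓_) (trans |w|≡ (sym |w₁|≡))) (sym (List.length-take i w₁)))

  -- Position i is shifted when σ₁ has more 1s than σ strictly before it: the 1 of σ at i has moved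
  -- to i - 1.
  shifted remaining : Letters
  shifted i k = does (o i <? o₁ i)
  remaining i k = letters σ i k ∧ not (shifted i k)

  module _ (z≡ : count 0F w ≡ count 0F w₁) (s : σ ⟶ σ₁) where

    private
      o≡ : count 1F w ≡ count 1F w₁
      o≡ = +-cancelˡ-≡ (count 0F w) _ _ (trans (count-length w) (trans (trans |w|≡ (sym |w₁|≡)) (trans (sym (count-length w₁)) (cong (_+ count 1F w₁) (sym z≡)))))

      -- The box in row `count 0F q₁` and column `count 1F p₁` would belong to σ but not to σ₁.
      contained : ∀ p q p₁ q₁ → w ≡ p ++ q → w₁ ≡ p₁ ++ q₁ → count 0F q₁ < count 0F q → count 1F p₁ < count 1F p → ⊥
      contained p q p₁ q₁ e e₁ y<y o<o = <⇒≱ (∈boxes⁻ σ₁ (proj₁ s (∈boxes⁺ σ box)))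
        (subst (λ u → row u (count 0F q₁) ≤ count 1F p₁) (sym e₁) (row≤ p₁ q₁ ≤-refl))
        where
        box : count 1F p₁ < row w (count 0F q₁)
        box = <-≤-trans o<o (subst (λ u → count 1F p ≤ row u (count 0F q₁)) (sym e) (row≥ p q y<y))

      -- In column `count 1F p`, the box in row `count 0F q` and the one in the row after it would
      -- both belong to `σ₁ ∕ σ`.
      horizontal : ∀ p q p₁ q₁ → w ≡ p ++ q → w₁ ≡ p₁ ++ q₁ → suc (count 0F q) < count 0F q₁ → count 1F p < count 1F p₁ → ⊥
      horizontal p q p₁ q₁ e e₁ y<y o<o with AllPairs-either (proj₂ s) (box (count 0F q) ≤-refl (<-trans (n<1+n _) y<y))
                                               (box (suc (count 0F q)) (n≤1+n _) y<y) (λ b≡ → m≢1+m+n (count 0F q) (trans (,-injectiveˡ b≡) (cong suc (sym (+-identityʳ _)))))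
        where
        box : ∀ r → count 0F q ≤ r → r < count 0F q₁ → (r , count 1F p) ∈ σ₁ ∕ σ
        box r q≤r r<q₁ = ∈.∈-filter⁺ _ (∈boxes⁺ σ₁ (<-≤-trans o<o (subst (λ u → count 1F p₁ ≤ row u r) (sym e₁) (row≥ p₁ q₁ r<q₁))))
          λ b∈ → <⇒≱ (∈boxes⁻ σ b∈) (subst (λ u → row u r ≤ count 1F p) (sym e) (row≤ p q q≤r))
      ... | inj₁ c≢c = c≢c refl
      ... | inj₂ c≢c = c≢c refl

      exchange-at : ∀ i → o i + count 0F (drop i w₁) ≡ o₁ i + count 0F (drop i w)
      exchange-at i = exchange (take i w) (drop i w) (take i w₁) (drop i w₁) (sym (List.take++drop≡id i w)) (sym (List.take++drop≡id i w₁)) (same-take i) z≡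

      o≤o₁ : ∀ i → o i ≤ o₁ i
      o≤o₁ i = ≮⇒≥ λ o₁<o → contained (take i w) (drop i w) (take i w₁) (drop i w₁) (sym (List.take++drop≡id i w)) (sym (List.take++drop≡id i w₁))
        (≰⇒> λ y≤y₁ → <-irrefl (sym (exchange-at i)) (+-mono-<-≤ o₁<o y≤y₁)) o₁<o

      o₁≤1+o : ∀ i → o₁ i ≤ suc (o i)
      o₁≤1+o i = ≮⇒≥ λ 1+o<o₁ → horizontal (take i w) (drop i w) (take i w₁) (drop i w₁) (sym (List.take++drop≡id i w)) (sym (List.take++drop≡id i w₁))
        (≰⇒> λ y₁≤1+y → <-irrefl (trans (exchange-at i) refl) (subst (o i + count 0F (drop i w₁) <_) refl
          (≤-<-trans (+-monoʳ-≤ (o i) y₁≤1+y) (subst (_< o₁ i + count 0F (drop i w)) (sym (+-suc (o i) _)) (+-monoˡ-< (count 0F (drop i w)) 1+o<o₁)))))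
        (<-trans (n<1+n _) 1+o<o₁)

      -- Cutting σ behind the 0 leaves one row fewer in the suffix, so that a surplus of a single 1
      -- in σ₁ already produces two boxes in a column.
      o₁≤o : ∀ i → i < length w → at w i ≡ 0F → o₁ i ≤ o i
      o₁≤o i i<w e = ≮⇒≥ λ o<o₁ → horizontal (take i w ∷ʳ 0F) (drop (suc i) w) (take i w₁) (drop i w₁)
        (trans (sym (List.take++drop≡id (suc i) w)) (cong (_++ drop (suc i) w) (trans (take-suc w i<w) (cong (take i w ∷ʳ_) e))))
        (sym (List.take++drop≡id i w₁))
        (≰⇒> λ y₁≤1+y → <-irrefl (exchange-at i) (≤-<-trans (+-monoʳ-≤ (o i) (≤-trans y₁≤1+y (≤-reflexive (sym drop≡)))) (+-monoˡ-< (count 0F (drop i w)) o<o₁)))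
        (subst (_< o₁ i) (sym (trans (count-++ 1F (take i w) [ 0F ]) (+-identityʳ _))) o<o₁)
        where
        drop≡ : count 0F (drop i w) ≡ suc (count 0F (drop (suc i) w))
        drop≡ = trans (cong (count 0F) (drop-at w i<w)) (cong (λ x → count 0F (x ∷ drop (suc i) w)) e)

    private
      shifted≡ : ∀ i → ⟦ does (o i <? o₁ i) ⟧ + o i ≡ o₁ i
      shifted≡ i with o i <? o₁ i
      ... | yes l = trans (cong (λ b → ⟦ b ⟧ + o i) (dec-true (o i <? o₁ i) l)) (≤-antisym l (o₁≤1+o i))
      ... | no ¬l = trans (cong (λ b → ⟦ b ⟧ + o i) (dec-false (o i <? o₁ i) ¬l)) (≤-antisym (o≤o₁ i) (≮⇒≥ ¬l))

      remaining≡ : ∀ i k → i + k ≡ suc P → ⟦ remaining i k ⟧ + ⟦ shifted i k ⟧ ≡ ⟦ letters σ i k ⟧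
      remaining≡ i k p with at w i in e
      ... | 0F = cong ⟦_⟧ (dec-false (o i <? o₁ i) (≤⇒≯ (o₁≤o i (i<|w| p) e)))
      ... | 1F with does (o i <? o₁ i)
      ...   | true  = refl
      ...   | false = refl

      -- The surplus `o₁ - o` is recorded by `shifted`; from i to i + 1 it changes by the difference
      -- of the two letters at i.
      next≡ : ∀ i k → i + k ≡ suc P → ⟦ remaining i k ⟧ + ⟦ shifted (suc i) k ⟧ ≡ ⟦ letters σ₁ i k ⟧
      next≡ i k p = +-cancelʳ-≡ (⟦ shifted i k ⟧ + o i) _ _ (begin
        S + V′ + (V + o i)             ≡⟨ regroup S V′ V (o i) ⟩
        V′ + (o i + (S + V))           ≡⟨ cong (λ x → V′ + (o i + x)) (remaining≡ i k p) ⟩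
        V′ + (o i + ⟦ letters σ i k ⟧) ≡⟨ cong (V′ +_) (sym (count-take-suc w (i<|w| p))) ⟩
        V′ + o (suc i)                 ≡⟨ shifted≡ (suc i) ⟩
        o₁ (suc i)                     ≡⟨ count-take-suc w₁ (i<|w₁| p) ⟩
        o₁ i + ⟦ letters σ₁ i k ⟧      ≡⟨ +-comm (o₁ i) _ ⟩
        ⟦ letters σ₁ i k ⟧ + o₁ i      ≡⟨ cong (⟦ letters σ₁ i k ⟧ +_) (sym (shifted≡ i)) ⟩
        ⟦ letters σ₁ i k ⟧ + (V + o i) ∎)
        where
        open ≡-Reasoning
        S V V′ : ℕ
        S  = ⟦ remaining i k ⟧
        V  = ⟦ shifted i k ⟧
        V′ = ⟦ shifted (suc i) k ⟧
        regroup : ∀ s v′ v x → s + v′ + (v + x) ≡ v′ + (x + (s + v))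
        regroup = solve-∀

    ⟶-Strip : Strip P (letters σ) (letters σ₁) remaining shifted
    ⟶-Strip = record
      { split  = remaining≡
      ; merge  = λ i k p → next≡ i (suc k) (trans (+-suc i k) (cong suc p))
      ; finish = ⟦⟧-injective (trans (sym (+-identityʳ _)) (trans (cong (⟦ remaining (suc P) 0 ⟧ +_) (sym finished)) (next≡ (suc P) 0 (+-identityʳ _))))
      ; start  = refl }
      where
      finished : ⟦ shifted (suc (suc P)) 0 ⟧ ≡ 0
      finished = cong ⟦_⟧ (dec-false (o (suc (suc P)) <? o₁ (suc (suc P))) (≤⇒≯ (≤-reflexive (sym
        (trans (cong (λ x → count 1F (take x w)) (sym |w|≡)) (trans (cong (count 1F) (take-all w))
        (trans o≡ (trans (sym (cong (count 1F) (take-all w₁))) (cong (λ x → count 1F (take x w₁)) |w₁|≡)))))))))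

Strip-resp : ∀ {P a a′ a₁ a₁′ stay move} → (∀ i k → i + k ≡ suc P → a i k ≡ a′ i k) → (∀ i k → i + k ≡ suc P → a₁ i k ≡ a₁′ i k) →
             Strip P a a₁ stay move → Strip P a′ a₁′ stay move
Strip-resp a≡ a₁≡ S = record
  { split  = λ i k p → trans (split i k p) (cong ⟦_⟧ (a≡ i k p))
  ; merge  = λ i k p → trans (merge i k p) (cong ⟦_⟧ (a₁≡ i (suc k) (trans (+-suc i k) (cong suc p))))
  ; finish = trans finish (a₁≡ _ 0 (+-identityʳ _))
  ; start  = start }
  where open Strip S

module _ {m P : ℕ} (m≡ : m ≡ suc (suc P)) (σ σ₁ : Vec Letter m) {stay move} (S : Strip P (letters σ) (letters σ₁) stay move) where

  open Strip S

  private
    w w₁ : List Letter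
    w  = toList σ
    w₁ = toList σ₁

    o o₁ : ℕ → ℕ
    o  i = count 1F (take i w)
    o₁ i = count 1F (take i w₁)

    |w|≡ : length w ≡ suc (suc P)
    |w|≡ = length-word m≡ σ

    |w₁|≡ : length w₁ ≡ suc (suc P)
    |w₁|≡ = length-word m≡ σ₁

    within : ∀ {i k n} → n ≡ suc (suc P) → i + k ≡ suc P → i < n
    within {i} {k} e p = subst (i <_) (sym e) (s≤s (subst (i ≤_) p (m≤m+n i k)))

    next≡ : ∀ i k v v′ → i + k ≡ suc P → ⟦ stay i k ⟧ + v ≡ ⟦ letters σ i k ⟧ → ⟦ stay i k ⟧ + v′ ≡ ⟦ letters σ₁ i k ⟧ →
            o₁ i ≡ o i + v → o₁ (suc i) ≡ o (suc i) + v′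
    next≡ i k v v′ p split≡ merge≡ e = begin
      o₁ (suc i)                     ≡⟨ count-take-suc w₁ (within |w₁|≡ p) ⟩
      o₁ i + ⟦ letters σ₁ i k ⟧      ≡⟨ cong₂ _+_ e (sym merge≡) ⟩
      o i + v + (⟦ stay i k ⟧ + v′)  ≡⟨ regroup (o i) v ⟦ stay i k ⟧ v′ ⟩
      o i + (⟦ stay i k ⟧ + v) + v′  ≡⟨ cong (λ x → o i + x + v′) split≡ ⟩
      o i + ⟦ letters σ i k ⟧ + v′   ≡⟨ cong (_+ v′) (sym (count-take-suc w (within |w|≡ p))) ⟩
      o (suc i) + v′                 ∎
      where
      open ≡-Reasoning
      regroup : ∀ x v s v′ → x + v + (s + v′) ≡ x + (s + v) + v′
      regroup = solve-∀

    o₁≡ : ∀ i k → i + k ≡ suc P → o₁ i ≡ o i + ⟦ move i k ⟧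
    o₁≡ zero    k refl = sym (cong ⟦_⟧ start)
    o₁≡ (suc i) k p = next≡ i (suc k) ⟦ move i (suc k) ⟧ ⟦ move (suc i) k ⟧ q (split i (suc k) q) (merge i k (suc-injective p)) (o₁≡ i (suc k) q)
      where
      q : i + suc k ≡ suc P
      q = trans (+-suc i k) p

    all≡ : o₁ (suc (suc P)) ≡ o (suc (suc P))
    all≡ = trans (next≡ (suc P) 0 ⟦ move (suc P) 0 ⟧ 0 (+-identityʳ _) (split (suc P) 0 (+-identityʳ _))
      (trans (+-identityʳ _) (cong ⟦_⟧ finish)) (o₁≡ (suc P) 0 (+-identityʳ _))) (+-identityʳ _)

  Strip-ones : count 1F w₁ ≡ count 1F w
  Strip-ones = trans (whole w₁ |w₁|≡) (trans all≡ (sym (whole w |w|≡)))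
    where
    whole : ∀ u → length u ≡ suc (suc P) → count 1F u ≡ count 1F (take (suc (suc P)) u)
    whole u e = cong (count 1F) (trans (sym (take-all u)) (cong (λ i → take i u) e))

  Strip-zeros : count 0F w₁ ≡ count 0F w
  Strip-zeros = +-cancelʳ-≡ (count 1F w) _ _ (trans (cong (count 0F w₁ +_) (sym Strip-ones))
    (trans (count-length w₁) (trans |w₁|≡ (sym (trans (count-length w) |w|≡)))))

  private
    take-from : ∀ i → length (take i w₁) ≡ length (take i w)
    take-from i = trans (List.length-take i w₁) (trans (cong (i Data.Nat.⊓_) (trans |w₁|≡ (sym |w|≡))) (sym (List.length-take i w)))

    prefix≤ : ∀ i → i ≤ suc (suc P) → o i ≤ o₁ i
    prefix≤ i i≤ with m≤n⇒m<n∨m≡n i≤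
    ... | inj₂ refl = ≤-reflexive (sym all≡)
    ... | inj₁ i<   = subst (o i ≤_) (sym (o₁≡ i (suc P ∸ i) (m+[n∸m]≡n (≤-pred i<)))) (m≤m+n (o i) _)

    zero-prefix : ∀ i k → i + k ≡ suc P → at w i ≡ 0F → o₁ i ≡ o i
    zero-prefix i k p e = trans (o₁≡ i k p) (trans (cong (λ b → o i + ⟦ b ⟧) (still _ _ _ (cong is1 e) (split i k p))) (+-identityʳ _))
      where
      still : ∀ s v x → x ≡ false → ⟦ s ⟧ + ⟦ v ⟧ ≡ ⟦ x ⟧ → v ≡ false
      still false false _ refl _ = refl

    exchange-at : ∀ i → o i + count 0F (drop i w₁) ≡ o₁ i + count 0F (drop i w)
    exchange-at i = exchange (take i w) (drop i w) (take i w₁) (drop i w₁) (sym (List.take++drop≡id i w)) (sym (List.take++drop≡id i w₁))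
      (sym (take-from i)) (sym Strip-zeros)

    -- Both words are cut just behind the 0 of row r of σ₁. There σ has at most as many 1s before
    -- the cut, hence at most as many 0s behind it, so its row r belongs to a 0 before the cut.
    rows≤ : ∀ r → row w r ≤ row w₁ r
    rows≤ r with r <? count 0F w₁
    ... | no r≮ = ≤-trans (row≤ [] w (subst (_≤ r) Strip-zeros (≮⇒≥ r≮))) z≤n
    ... | yes r< with nth-zero w₁ r<
    ...   | p₁ , q₁ , e , c = begin
      row w r                            ≡⟨ cong (λ u → row u r) (sym (List.take++drop≡id i w)) ⟩
      row (take i w ++ drop i w) r       ≤⟨ row≤ (take i w) (drop i w) zeros≤ ⟩
      o i                                ≤⟨ prefix≤ i i≤ ⟩
      o₁ i                               ≡⟨ o₁i ⟩
      count 1F p₁                        ≤⟨ row≥ p₁ (0F ∷ q₁) (subst (_< suc (count 0F q₁)) c ≤-refl) ⟩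
      row (p₁ ++ 0F ∷ q₁) r              ≡⟨ cong (λ u → row u r) (sym e) ⟩
      row w₁ r                           ∎
      where
      open ≤-Reasoning
      i : ℕ
      i = length (p₁ ∷ʳ 0F)
      e′ : w₁ ≡ (p₁ ∷ʳ 0F) ++ q₁
      e′ = trans e (sym (List.++-assoc p₁ [ 0F ] q₁))
      i≤ : i ≤ suc (suc P)
      i≤ = subst (i ≤_) (trans (sym (trans (cong length e′) (List.length-++ (p₁ ∷ʳ 0F)))) |w₁|≡) (m≤m+n i (length q₁))
      o₁i : o₁ i ≡ count 1F p₁
      o₁i = trans (cong (λ u → count 1F (take i u)) e′) (trans (cong (count 1F) (take-length (p₁ ∷ʳ 0F) q₁)) (trans (count-++ 1F p₁ [ 0F ]) (+-identityʳ _)))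
      zeros≤ : count 0F (drop i w) ≤ r
      zeros≤ = subst (count 0F (drop i w) ≤_) (trans (cong (λ u → count 0F (drop i u)) e′) (trans (cong (count 0F) (drop-length (p₁ ∷ʳ 0F) q₁)) c))
        (≮⇒≥ λ y<y → <-irrefl (exchange-at i) (+-mono-≤-< (prefix≤ i i≤) y<y))

    -- The strip condition in terms of rows. No 1 moves away from a 0 of σ, so just before the 0 of
    -- row r both words have seen equally many 1s and have equally many 0s to come; row r′ of σ₁
    -- belongs to a 0 before that cut.
    interlacing : ∀ r r′ → r < r′ → r′ < count 0F w₁ → row w₁ r′ ≤ row w r
    interlacing r r′ r<r′ r′< with nth-zero w (<-trans r<r′ (subst (r′ <_) Strip-zeros r′<))
    ... | p , q , e , c = begin
      row w₁ r′                       ≡⟨ cong (λ u → row u r′) (sym (List.take++drop≡id i w₁)) ⟩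
      row (take i w₁ ++ drop i w₁) r′ ≤⟨ row≤ (take i w₁) (drop i w₁) zeros≤ ⟩
      o₁ i                            ≡⟨ o₁≡o ⟩
      o i                             ≡⟨ cong (count 1F) (trans (cong (take i) e) (take-length p (0F ∷ q))) ⟩
      count 1F p                      ≤⟨ row≥ p (0F ∷ q) (subst (_< suc (count 0F q)) c ≤-refl) ⟩
      row (p ++ 0F ∷ q) r             ≡⟨ cong (λ u → row u r) (sym e) ⟩
      row w r                         ∎
      where
      open ≤-Reasoning
      i : ℕ
      i = length p
      i≤ : i ≤ suc P
      i≤ = ≤-pred (subst (suc i ≤_) (trans (sym (trans (cong length e) (trans (List.length-++ p) (+-suc i (length q))))) |w|≡) (s≤s (m≤m+n i (length q))))
      o₁≡o : o₁ i ≡ o i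
      o₁≡o = zero-prefix i (suc P ∸ i) (m+[n∸m]≡n i≤) (trans (cong (λ u → at u i) e) (at-length p 0F q))
      zeros≤ : count 0F (drop i w₁) ≤ r′
      zeros≤ = ≤-trans (≤-reflexive (trans (+-cancelˡ-≡ (o i) _ _ (trans (exchange-at i) (cong (_+ count 0F (drop i w)) o₁≡o)))
        (trans (cong (λ u → count 0F (drop i u)) e) (trans (cong (count 0F) (drop-length p (0F ∷ q))) (cong suc c))))) r<r′

    apart : ∀ {b b′} → b ∈ σ₁ ∕ σ → b′ ∈ σ₁ ∕ σ → proj₁ b < proj₁ b′ → proj₂ b ≢ proj₂ b′
    apart {r , c} {r′ , _} b∈ b′∈ r<r′ refl with ∈.∈-filter⁻ _ {xs = boxes σ₁} b∈ | ∈.∈-filter⁻ _ {xs = boxes σ₁} b′∈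
    ... | _ , b∉ | b′∈₁ , _ = b∉ (∈boxes⁺ σ (<-≤-trans c< (interlacing r r′ r<r′ r′<)))
      where
      c< : c < row w₁ r′
      c< = ∈boxes⁻ σ₁ b′∈₁
      r′< : r′ < count 0F w₁
      r′< = ≰⇒> λ ≤r′ → contradiction (<-≤-trans c< (row≤ [] w₁ ≤r′)) λ ()

  Strip-⟶ : σ ⟶ σ₁
  Strip-⟶ = (λ {b} b∈ → ∈boxes⁺ σ₁ (<-≤-trans (∈boxes⁻ σ b∈) (rows≤ (proj₁ b)))) ,
    Unique-AllPairs (Unique.filter⁺ _ (boxesFrom-unique 0 (rows w₁))) λ {b} {b′} b∈ b′∈ b≢b′ c≡ →
      case <-cmp (proj₁ b) (proj₁ b′) of λ
        { (tri< r<r′ _ _) → apart b∈ b′∈ r<r′ c≡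
        ; (tri≈ _ r≡r′ _) → b≢b′ (cong₂ _,_ r≡r′ c≡)
        ; (tri> _ _ r′<r) → apart b′∈ b∈ r′<r (sym c≡) }

-- Words spelled from letters, and the Dyck property from suffixes.

letter : Bool → Letter
letter true  = 1F
letter false = 0F

is1-letter : ∀ b → is1 (letter b) ≡ b
is1-letter true  = refl
is1-letter false = refl

module Spell {n P : ℕ} (N≡ : 2 * n ≡ suc (suc P)) where

  open Geometry {n} {P} N≡

  spell : Letters → Word n
  spell c = tabulate λ x → letter (c (toℕ x) (suc P ∸ toℕ x))

  letters-spell : ∀ c i k → i + k ≡ suc P → letters (spell c) i k ≡ c i k
  letters-spell c i k p with index {i} {k} p
  ... | x , refl = trans (cong is1 (trans (sym (lookup-at (spell c) x)) (Vec.lookup∘tabulate _ x)))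
    (trans (is1-letter _) (cong (c (toℕ x)) (trans (cong (_∸ toℕ x) (sym p)) (m+n∸m≡n (toℕ x) k))))

  letters-injective : ∀ {σ τ : Word n} → (∀ i k → i + k ≡ suc P → letters σ i k ≡ letters τ i k) → σ ≡ τ
  letters-injective {σ} {τ} e = trans (sym (Vec.tabulate∘lookup σ)) (trans (Vec.tabulate-cong same) (Vec.tabulate∘lookup τ))
    where
    is1-injective : ∀ {x y} → is1 x ≡ is1 y → x ≡ y
    is1-injective {0F} {0F} _ = refl
    is1-injective {1F} {1F} _ = refl
    is1-injective {0F} {1F} ()
    is1-injective {1F} {0F} ()
    same : ∀ x → lookup σ x ≡ lookup τ x
    same x = is1-injective (trans (cong is1 (lookup-at σ x)) (trans (e (toℕ x) _ (proj₂ (coindex x))) (cong is1 (sym (lookup-at τ x)))))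

suffix-ones : ∀ w {c P} → length w ≡ suc P → (∀ i k → i + k ≡ P → c i k ≡ is1 (at w i)) →
              ∀ m s → m + s ≡ P → ones c m s ≡ count 1F (drop m w) × ones (flipped c) m s ≡ count 0F (drop m w)
suffix-ones w {c} {P} |w| c≡ = go
  where
  head : ∀ m s → m + s ≡ P → ∃ λ x → drop m w ≡ x ∷ drop (suc m) w × c m s ≡ is1 x
  head m s p = at w m , drop-at w (subst (m <_) (sym |w|) (s≤s (subst (m ≤_) p (m≤m+n m s)))) , c≡ m s p
  cons₁ : ∀ x u → ⟦ is1 x ⟧ + count 1F u ≡ count 1F (x ∷ u)
  cons₁ 0F u = refl
  cons₁ 1F u = refl
  cons₀ : ∀ x u → ⟦ not (is1 x) ⟧ + count 0F u ≡ count 0F (x ∷ u)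
  cons₀ 0F u = refl
  cons₀ 1F u = refl
  nothing-left : ∀ m → m + 0 ≡ P → drop (suc m) w ≡ []
  nothing-left m p = lemma (drop (suc m) w) (trans (List.length-drop (suc m) w) (trans (cong (_∸ suc m) |w|) (trans (cong (_∸ m) (trans (sym p) (+-identityʳ m))) (n∸n≡0 m))))
    where
    lemma : ∀ (u : List Letter) → length u ≡ 0 → u ≡ []
    lemma [] _ = refl
  go : ∀ m s → m + s ≡ P → ones c m s ≡ count 1F (drop m w) × ones (flipped c) m s ≡ count 0F (drop m w)
  go m zero p with head m 0 p
  ... | x , d , e rewrite d | e | nothing-left m p = trans (sym (+-identityʳ _)) (cons₁ x []) , trans (sym (+-identityʳ _)) (cons₀ x [])
  go m (suc s) p with head m (suc s) p | go (suc m) s (trans (sym (+-suc m s)) p)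
  ... | x , d , e | r₁ , r₀ rewrite d | e | r₁ | r₀ = cons₁ x (drop (suc m) w) , cons₀ x (drop (suc m) w)

-- The inequality is given for proper nonempty suffixes; the remaining prefixes are the empty one
-- and the whole word, where the totals decide.
suffixes-Dyck : ∀ {n P} w {c} → length w ≡ suc (suc P) → count 0F w ≡ n → count 1F w ≡ n →
                (∀ i k → i + k ≡ suc P → c i k ≡ is1 (at w i)) →
                (∀ m s → suc m + s ≡ suc P → ones (flipped c) (suc m) s ≤ ones c (suc m) s) → IsDyck n w
suffixes-Dyck {n} {P} w {c} |w| z o c≡ suffix = z , o , All-inits⁺ w prefix
  where
  prefix : ∀ p q → w ≡ p ++ q → count 1F p ≤ count 0F p
  prefix []      q       e = z≤n
  prefix (x ∷ p) []      e = ≤-reflexive (trans (cong (count 1F) (trans (sym (List.++-identityʳ (x ∷ p))) (sym e)))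
    (trans o (trans (sym z) (cong (count 0F) (trans e (List.++-identityʳ (x ∷ p)))))))
  prefix (x ∷ p) (y ∷ q) e = suffix-prefix z o (x ∷ p) (y ∷ q) e (subst₂ _≤_
      (trans (proj₂ counts) (cong (count 0F) drop≡)) (trans (proj₁ counts) (cong (count 1F) drop≡)) (suffix m s m+s))
    where
    m s : ℕ
    m = length p
    s = length q
    m+s : suc m + s ≡ suc P
    m+s = suc-injective (trans (cong suc (sym (+-suc m s))) (trans (sym (List.length-++ (x ∷ p))) (trans (cong length (sym e)) |w|)))
    counts : _
    counts = suffix-ones w |w| c≡ (suc m) s m+s
    drop≡ : drop (suc m) w ≡ y ∷ q
    drop≡ = trans (cong (drop (suc m)) e) (drop-length (x ∷ p) (y ∷ q))

Dyck-first : ∀ {n w} → 1 ≤ length w → IsDyck n w → at w 0 ≡ 0F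
Dyck-first {w = 0F ∷ w} _ d = refl
Dyck-first {w = 1F ∷ w} _ (_ , _ , pre) with () ← All-inits⁻ (1F ∷ w) pre [ 1F ] w refl

Dyck-last : ∀ {n w P} → length w ≡ suc P → IsDyck n w → at w P ≡ 1F
Dyck-last {n} {w} {P} |w| d = lemma (trans (sym (at-dual w {0} {P} (sym |w|))) (Dyck-first (subst (1 ≤_) (sym (trans (length-dual w) |w|)) (s≤s z≤n)) (IsDyck-dual d)))
  where
  lemma : ∀ {x : Letter} → opposite x ≡ 0F → x ≡ 1F
  lemma {1F} _ = refl

-- Counting

TFPL-words : ∀ {P a a′ c c′ M M′ h} → (∀ i k → i + k ≡ suc P → a i k ≡ a′ i k) → (∀ i k → i + k ≡ suc P → c i k ≡ c′ i k) →
             (∀ i k j l → i + k ≡ suc P → j + l ≡ suc P → i < j → M i k j l ⇔ M′ i k j l) → TFPL P a c M h → TFPL P a′ c′ M′ h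
TFPL-words {P} a≡ c≡ M≡ T = record
  { bottom      = bottom
  ; odd-degree  = odd-degree
  ; even-degree = even-degree
  ; left-edge   = left-edge
  ; left-floor  = λ y k p → trans (left-floor y k p) (cong not (a≡ y k p))
  ; right-edge  = right-edge
  ; right-floor = λ m y p → trans (right-floor m y p) (c≡ m y p)
  ; summit      = trans (sym (a≡ (suc P) 0 (+-identityʳ _))) summit
  ; left-path   = λ i k p e → case left-path i k p (trans (a≡ i k p) e) of λ { (j , l , q , f , s) → j , l , q , trans (sym (c≡ j l q)) f , s }
  ; right-path  = λ j l p e → case right-path j l p (trans (c≡ j l p) e) of λ { (i , k , q , f , s) → i , k , q , trans (sym (a≡ i k q)) f , s }
  ; leg-path    = λ i k j l p q i<j → mk⇔
      (λ s → Equivalence.to (M≡ i k j l p q i<j) (Equivalence.to (leg-path i k j l p q i<j) s))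
      (λ h → Equivalence.from (leg-path i k j l p q i<j) (Equivalence.from (M≡ i k j l p q i<j) h)) }
  where open TFPL T

∈allWords : ∀ {m} (w : Vec Letter m) → w ∈ allWords m
∈allWords []       = here refl
∈allWords (0F ∷ w) = ∈.∈-++⁺ˡ (∈.∈-map⁺ (0F ∷_) (∈allWords w))
∈allWords {suc m} (1F ∷ w) = ∈.∈-++⁺ʳ (map (0F ∷_) (allWords m)) (∈.∈-++⁺ˡ (∈.∈-map⁺ (1F ∷_) (∈allWords w)))

allWords-unique : ∀ m → Unique (allWords m)
allWords-unique zero    = [] ∷ []
allWords-unique (suc m) = Unique.++⁺ (Unique.map⁺ Vec.∷-injectiveʳ (allWords-unique m))
  (Unique.++⁺ (Unique.map⁺ Vec.∷-injectiveʳ (allWords-unique m)) [] λ { (_ , ()) })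
  λ { (p , q) → case ∈.∈-map⁻ (0F ∷_) p of λ { (_ , _ , refl) → case ∈.∈-++⁻ (map (1F ∷_) (allWords m)) q of λ
      { (inj₁ r) → case ∈.∈-map⁻ (1F ∷_) r of λ { (_ , _ , ()) } ; (inj₂ ()) } } }

module _ {A B : Set} (F : A → List B) where

  pairs : List A → List (A × B)
  pairs []       = []
  pairs (x ∷ xs) = map (x ,_) (F x) ++ pairs xs

  length-pairs : ∀ xs → length (pairs xs) ≡ sum (map (λ x → length (F x)) xs)
  length-pairs []       = refl
  length-pairs (x ∷ xs) = trans (List.length-++ (map (x ,_) (F x))) (cong₂ _+_ (List.length-map (x ,_) (F x)) (length-pairs xs))

  ∈pairs⁺ : ∀ {xs x y} → x ∈ xs → y ∈ F x → (x , y) ∈ pairs xs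
  ∈pairs⁺ (here refl) y∈ = ∈.∈-++⁺ˡ (∈.∈-map⁺ (_ ,_) y∈)
  ∈pairs⁺ {z ∷ _} (there x∈) y∈ = ∈.∈-++⁺ʳ (map (z ,_) (F z)) (∈pairs⁺ x∈ y∈)

  ∈pairs⁻ : ∀ {xs p} → p ∈ pairs xs → proj₁ p ∈ xs × proj₂ p ∈ F (proj₁ p)
  ∈pairs⁻ {z ∷ xs} p∈ with ∈.∈-++⁻ (map (z ,_) (F z)) p∈
  ... | inj₁ q = case ∈.∈-map⁻ (z ,_) q of λ { (_ , y∈ , refl) → here refl , y∈ }
  ... | inj₂ q = case ∈pairs⁻ {xs} q of λ { (x∈ , y∈) → there x∈ , y∈ }

  pairs-unique : ∀ {xs} → Unique xs → (∀ x → Unique (F x)) → Unique (pairs xs)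
  pairs-unique [] v = []
  pairs-unique {x ∷ xs} (x∉ ∷ u) v = Unique.++⁺ (Unique.map⁺ ,-injectiveʳ (v x)) (pairs-unique u v)
    λ { (p , q) → case ∈.∈-map⁻ (x ,_) p of λ { (_ , _ , refl) → All.lookup x∉ (proj₁ (∈pairs⁻ {xs} q)) refl } }

-- Each sum is the length of a list of dependent pairs, which turns the inequality into an instance
-- of `pigeonhole`.
sum-≤ : ∀ {A B C D : Set} (F : A → List B) (G : C → List D) (_~_ : A × B → C × D → Set) {xs ys} →
        Unique xs → (∀ x → Unique (F x)) →
        (∀ {x b} → x ∈ xs → b ∈ F x → ∃₂ λ y d → y ∈ ys × d ∈ G y × (x , b) ~ (y , d)) →
        (∀ {x b x′ b′} z → b ∈ F x → b′ ∈ F x′ → (x , b) ~ z → (x′ , b′) ~ z → (x , b) ≡ (x′ , b′)) →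
        sum (map (λ x → length (F x)) xs) ≤ sum (map (λ y → length (G y)) ys)
sum-≤ F G _~_ {xs} {ys} u v total inj = subst₂ _≤_ (length-pairs F xs) (length-pairs G ys)
  (pigeonhole _~_ (pairs-unique F u v)
    (λ p∈ → case ∈pairs⁻ F {xs} p∈ of λ { (x∈ , b∈) → case total x∈ b∈ of λ { (y , d , y∈ , d∈ , r) → (y , d) , ∈pairs⁺ G y∈ d∈ , r } })
    λ {_} {_} {z} p∈ q∈ r r′ → inj z (proj₂ (∈pairs⁻ F {xs} p∈)) (proj₂ (∈pairs⁻ F {xs} q∈)) r r′)

module Count (n P : ℕ) (N≡ : 2 * n ≡ suc (suc P)) where

  open Geometry {n} {P} N≡
  open Realize {n} {P} N≡
  open Spell {n} {P} N≡

  private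
    Same : Config → Config → Set
    Same h h′ = ∀ m y k → m + y + k ≡ P → ∀ d → h m y k d ≡ h′ m y k d

    configurations : (σ τ π : Word n) → List (List Edge)
    configurations σ τ π = filter (IsTFPL? n σ τ π) (sublists (edges n))

    configurations-unique : ∀ σ τ π → Unique (configurations σ τ π)
    configurations-unique σ τ π = Unique.filter⁺ (IsTFPL? n σ τ π) (sublists-unique edges-unique)

    ∈configurations : ∀ {σ τ π f} → f ∈ configurations σ τ π → f ∈ sublists (edges n) × IsTFPL n σ τ π f
    ∈configurations {σ} {τ} {π} = ∈.∈-filter⁻ (IsTFPL? n σ τ π) {xs = sublists (edges n)}

    externals⇒ : ∀ {σ τ π f} → IsTFPL n σ τ π f → ∀ m k → m + k ≡ suc P → down (double m , 0) ∈ f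
    externals⇒ {f = f} I m k p = case external≡ {m} p of λ { (x , e , _) → subst (_∈ f) e (IsTFPL.externals I x) }

    ∈𝒟⁺ : ∀ {w : Word n} → Dyck n w → w ∈ 𝒟 n
    ∈𝒟⁺ {w} = ∈.∈-filter⁺ (Dyck? n) (∈allWords w)

    ∈𝒟⁻ : ∀ {w : Word n} → w ∈ 𝒟 n → Dyck n w
    ∈𝒟⁻ w∈ = proj₂ (∈.∈-filter⁻ (Dyck? n) {xs = allWords (2 * n)} w∈)

    𝒟-unique : Unique (𝒟 n)
    𝒟-unique = Unique.filter⁺ (Dyck? n) (allWords-unique (2 * n))

    word-first : ∀ {w : Word n} → Dyck n w → at (toList w) 0 ≡ 0F
    word-first {w} = Dyck-first (subst (1 ≤_) (sym (length-word N≡ w)) (s≤s z≤n))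

    word-last : ∀ {w : Word n} → Dyck n w → at (toList w) (suc P) ≡ 1F
    word-last {w} = Dyck-last (length-word N≡ w)

    neutral : ∀ {σ τ π f} → Dyck n σ → Dyck n τ → f ∈ configurations σ τ π → TFPL P (letters σ) (letters τ) (pairing π) (bits f)
    neutral {σ} {τ} {π} {f} dσ dτ f∈ = Correspondence.to-TFPL N≡ (sublist⊆ (edges n) s) (∈sublist-unique edges-unique s)
        (externals⇒ {σ} {τ} {π} I) {σ} {τ} {π} (word-first {σ} dσ) (word-last {σ} dσ) (word-last {τ} dτ) I
      where
      s : f ∈ sublists (edges n)
      s = proj₁ (∈configurations {σ} {τ} {π} f∈)
      I : IsTFPL n σ τ π f
      I = proj₂ (∈configurations {σ} {τ} {π} f∈)

    realize : ∀ {σ τ π h} → TFPL P (letters σ) (letters τ) (pairing π) h → graph h ∈ configurations σ τ π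
    realize {σ} {τ} {π} {h} T = ∈.∈-filter⁺ (IsTFPL? n σ τ π) (graph∈sublists h)
      (Correspondence.from-TFPL N≡ (graph⊆ h) (∈sublist-unique edges-unique (graph∈sublists h)) (graph-external h) {σ} {τ} {π}
        (TFPL-resp (bits-graph h (TFPL.bottom T)) T))

    same-bits : ∀ {σ τ π σ′ τ′ π′ f f′} → f ∈ configurations σ τ π → f′ ∈ configurations σ′ τ′ π′ → Same (bits f) (bits f′) → f ≡ f′
    same-bits {σ} {τ} {π} {σ′} {τ′} {π′} {f} {f′} f∈ f′∈ b≡ = sublist-ext edges-unique s s′
      (bits-⊆ (sublist⊆ (edges n) s) (externals⇒ {σ′} {τ′} {π′} (proj₂ (∈configurations {σ′} {τ′} {π′} f′∈))) b≡)
      (bits-⊆ (sublist⊆ (edges n) s′) (externals⇒ {σ} {τ} {π} (proj₂ (∈configurations {σ} {τ} {π} f∈))) λ m y k p d → sym (b≡ m y k p d))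
      where
      s : f ∈ sublists (edges n)
      s = proj₁ (∈configurations {σ} {τ} {π} f∈)
      s′ : f′ ∈ sublists (edges n)
      s′ = proj₁ (∈configurations {σ′} {τ′} {π′} f′∈)

    drift-word : ∀ {σ σ₁ τ π : Word n} {f} → Dyck n σ → Dyck n σ₁ → Dyck n τ → σ ⟶ σ₁ → TFPL P (letters σ₁) (letters τ) (pairing π) (bits f) →
      ∃₂ λ τ₁ g → Dyck n τ₁ × (τ *) ⟶ (τ₁ *) × TFPL P (letters σ) (letters τ₁) (pairing π) g ×
        Drifts P (letters σ) (letters σ₁) (letters τ) (letters τ₁) (pairing π) (bits f) (bits (graph g))
    drift-word {σ} {σ₁} {τ} {π} {f} dσ dσ₁ dτ σ⟶σ₁ T = τ₁ , g , dτ₁ , Strip-⟶ N≡ (τ *) (τ₁ *) strip , T′ ,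
        record { strip = S ; source = T ; g≡ = bits-graph g (TFPL.bottom T′) ; c₁≡ = λ i k p → sym (c≡ i k p) }
      where
      S : Strip P (letters σ) (letters σ₁) (remaining N≡ σ σ₁) (shifted N≡ σ σ₁)
      S = ⟶-Strip N≡ σ σ₁ (trans (proj₁ dσ) (sym (proj₁ dσ₁))) σ⟶σ₁
      open Drift S T using (g; c₁; strip′; drift-TFPL)
      τ₁ : Word n
      τ₁ = spell c₁
      c≡ : ∀ i k → i + k ≡ suc P → letters τ₁ i k ≡ c₁ i k
      c≡ = letters-spell c₁
      T′ : TFPL P (letters σ) (letters τ₁) (pairing π) g
      T′ = TFPL-words (λ _ _ _ → refl) (λ i k p → sym (c≡ i k p)) (λ _ _ _ _ _ _ _ → mk⇔ id id) drift-TFPL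
      strip : Strip P (letters (τ *)) (letters (τ₁ *)) _ _
      strip = Strip-resp (λ i k p → sym (letters-* N≡ τ i k p))
        (λ i k p → trans (cong not (sym (c≡ k i (trans (+-comm k i) p)))) (sym (letters-* N≡ τ₁ i k p))) strip′
      ones* : count 1F (toList (τ₁ *)) ≡ n
      ones* = trans (Strip-ones N≡ (τ *) (τ₁ *) strip) (proj₁ (proj₂ (Dyck-* n τ dτ)))
      zeros* : count 0F (toList (τ₁ *)) ≡ n
      zeros* = trans (Strip-zeros N≡ (τ *) (τ₁ *) strip) (proj₁ (Dyck-* n τ dτ))
      dτ₁ : Dyck n τ₁
      -- The numbers of letters come from the strip, the inequality from the paths of the new
      -- configuration, counted in `zeros≤ones`.
      dτ₁ = suffixes-Dyck (toList τ₁) (length-word N≡ τ₁)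
        (trans (sym (count-dual 1F (toList τ₁))) (trans (cong (count 1F) (sym (toList-* τ₁))) ones*))
        (trans (sym (count-dual 0F (toList τ₁))) (trans (cong (count 0F) (sym (toList-* τ₁))) zeros*))
        (λ _ _ _ → refl) (zeros≤ones T′)

  lhs rhs : (σ τ π : Word n) → ℕ
  lhs σ τ π = sum (map (λ σ₁ → t n σ₁ τ π) (filter (λ σ₁ → σ ⟶? σ₁) (𝒟 n)))
  rhs σ τ π = sum (map (λ τ₁ → t n σ τ₁ π) (filter (λ τ₁ → (τ *) ⟶? (τ₁ *)) (𝒟 n)))

  drift-≤ : ∀ σ τ π → Dyck n σ → Dyck n τ → lhs σ τ π ≤ rhs σ τ π
  drift-≤ σ τ π dσ dτ = sum-≤ (λ σ₁ → configurations σ₁ τ π) (λ τ₁ → configurations σ τ₁ π) _~_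
    (Unique.filter⁺ (σ ⟶?_) 𝒟-unique) (λ σ₁ → configurations-unique σ₁ τ π) total injective
    where
    _~_ : Word n × List Edge → Word n × List Edge → Set
    (σ₁ , f) ~ (τ₁ , g) = Drifts P (letters σ) (letters σ₁) (letters τ) (letters τ₁) (pairing π) (bits f) (bits g)

    total : ∀ {σ₁ f} → σ₁ ∈ filter (λ σ₁ → σ ⟶? σ₁) (𝒟 n) → f ∈ configurations σ₁ τ π →
            ∃₂ λ τ₁ g → τ₁ ∈ filter (λ τ₁ → (τ *) ⟶? (τ₁ *)) (𝒟 n) × g ∈ configurations σ τ₁ π × (σ₁ , f) ~ (τ₁ , g)
    total {σ₁} {f} σ₁∈ f∈ = conclude (drift-word {σ} {σ₁} {τ} {π} {f} dσ dσ₁ dτ (proj₂ split) (neutral {σ₁} {τ} {π} dσ₁ dτ f∈))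
      where
      split : σ₁ ∈ 𝒟 n × σ ⟶ σ₁
      split = ∈.∈-filter⁻ (λ σ₁ → σ ⟶? σ₁) {xs = 𝒟 n} σ₁∈
      dσ₁ : Dyck n σ₁
      dσ₁ = ∈𝒟⁻ {σ₁} (proj₁ split)
      conclude : (∃₂ λ τ₁ g → Dyck n τ₁ × (τ *) ⟶ (τ₁ *) × TFPL P (letters σ) (letters τ₁) (pairing π) g ×
          Drifts P (letters σ) (letters σ₁) (letters τ) (letters τ₁) (pairing π) (bits f) (bits (graph g))) →
        ∃₂ λ τ₁ g → τ₁ ∈ filter (λ τ₁ → (τ *) ⟶? (τ₁ *)) (𝒟 n) × g ∈ configurations σ τ₁ π × (σ₁ , f) ~ (τ₁ , g)
      conclude (τ₁ , g , dτ₁ , τ⟶τ₁ , T , D) =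
        τ₁ , graph g , ∈.∈-filter⁺ (λ τ₁ → (τ *) ⟶? (τ₁ *)) (∈𝒟⁺ {τ₁} dτ₁) τ⟶τ₁ , realize {σ} {τ₁} {π} T , D

    injective : ∀ {σ₁ f σ₁′ f′} z → f ∈ configurations σ₁ τ π → f′ ∈ configurations σ₁′ τ π →
                (σ₁ , f) ~ z → (σ₁′ , f′) ~ z → (σ₁ , f) ≡ (σ₁′ , f′)
    injective {σ₁} {f} {σ₁′} {f′} z f∈ f′∈ D D′ = cong₂ _,_ (letters-injective {σ₁} {σ₁′} (proj₂ same))
        (same-bits {σ₁} {τ} {π} {σ₁′} {τ} {π} f∈ f′∈ (proj₁ same))
      where
      same : Same (bits f) (bits f′) × (∀ i k → i + k ≡ suc P → letters σ₁ i k ≡ letters σ₁′ i k)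
      same = Drifts-injective D D′

  -- Reflection takes the summand of `τ₁` to that of `τ₁ *`. An inequality is enough, since a second
  -- reflection returns to the original words.
  mirror-≤ : ∀ σ τ π → Dyck n σ → rhs σ τ π ≤ lhs (τ *) (σ *) (π *)
  mirror-≤ σ τ π dσ = sum-≤ (λ τ₁ → configurations σ τ₁ π) (λ ρ → configurations ρ (σ *) (π *)) _~_
    (Unique.filter⁺ (λ τ₁ → (τ *) ⟶? (τ₁ *)) 𝒟-unique) (λ τ₁ → configurations-unique σ τ₁ π) total injective
    where
    _~_ : Word n × List Edge → Word n × List Edge → Set
    (τ₁ , f) ~ (ρ , g) = ρ ≡ τ₁ * × Same (mirror (bits f)) (bits g)

    total : ∀ {τ₁ f} → τ₁ ∈ filter (λ τ₁ → (τ *) ⟶? (τ₁ *)) (𝒟 n) → f ∈ configurations σ τ₁ π →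
            ∃₂ λ ρ g → ρ ∈ filter (λ ρ → (τ *) ⟶? ρ) (𝒟 n) × g ∈ configurations ρ (σ *) (π *) × (τ₁ , f) ~ (ρ , g)
    total {τ₁} {f} τ₁∈ f∈ = τ₁ * , graph (mirror (bits f)) ,
        ∈.∈-filter⁺ (λ ρ → (τ *) ⟶? ρ) (∈𝒟⁺ {τ₁ *} (Dyck-* n τ₁ dτ₁)) (proj₂ split) ,
        realize {τ₁ *} {σ *} {π *} T′ , refl , bits-graph (mirror (bits f)) (TFPL.bottom T′)
      where
      split : τ₁ ∈ 𝒟 n × (τ *) ⟶ (τ₁ *)
      split = ∈.∈-filter⁻ (λ τ₁ → (τ *) ⟶? (τ₁ *)) {xs = 𝒟 n} τ₁∈
      dτ₁ : Dyck n τ₁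
      dτ₁ = ∈𝒟⁻ {τ₁} (proj₁ split)
      T′ : TFPL P (letters (τ₁ *)) (letters (σ *)) (pairing (π *)) (mirror (bits f))
      T′ = TFPL-words (λ i k p → sym (letters-* N≡ τ₁ i k p)) (λ i k p → sym (letters-* N≡ σ i k p))
        (λ i k j l p q i<j → let open Equivalence (pairing-* N≡ π i k j l p q i<j) in mk⇔ from to)
        (mirror-TFPL (neutral {σ} {τ₁} {π} dσ dτ₁ f∈))

    injective : ∀ {τ₁ f τ₁′ f′} z → f ∈ configurations σ τ₁ π → f′ ∈ configurations σ τ₁′ π →
                (τ₁ , f) ~ z → (τ₁′ , f′) ~ z → (τ₁ , f) ≡ (τ₁′ , f′)
    injective {τ₁} {f} {τ₁′} {f′} z f∈ f′∈ (refl , b≡) (e , b≡′) = cong₂ _,_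
      (trans (sym (*-involutive τ₁)) (trans (cong _* e) (*-involutive τ₁′)))
      (same-bits {σ} {τ₁} {π} {σ} {τ₁′} {π} f∈ f′∈ λ m y k p d →
        subst (λ d → bits f m y k d ≡ bits f′ m y k d) (flip-flip d)
          (trans (b≡ k y m (swap-sum m y p) (flip-dir d)) (sym (b≡′ k y m (swap-sum m y p) (flip-dir d)))))

  lhs≡rhs : ∀ σ τ π → Dyck n σ → Dyck n τ → lhs σ τ π ≡ rhs σ τ π
  lhs≡rhs σ τ π dσ dτ = ≤-antisym (drift-≤ σ τ π dσ dτ) (begin
    rhs σ τ π                       ≤⟨ mirror-≤ σ τ π dσ ⟩
    lhs (τ *) (σ *) (π *)           ≤⟨ drift-≤ (τ *) (σ *) (π *) (Dyck-* n τ dτ) (Dyck-* n σ dσ) ⟩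
    rhs (τ *) (σ *) (π *)           ≤⟨ mirror-≤ (τ *) (σ *) (π *) (Dyck-* n τ dτ) ⟩
    lhs ((σ *) *) ((τ *) *) ((π *) *) ≡⟨ cong₂ (λ x y → lhs x y ((π *) *)) (*-involutive σ) (*-involutive τ) ⟩
    lhs σ τ ((π *) *)               ≡⟨ cong (lhs σ τ) (*-involutive π) ⟩
    lhs σ τ π                       ∎)
    where open ≤-Reasoning

theorem3p1 : ∀ (n : ℕ) → 1 ≤ n →
    ∀ (σ τ π : Word n) → Dyck n σ → Dyck n τ → Dyck n π →
    sum (map (λ σ₁ → t n σ₁ τ π) (filter (λ σ₁ → σ ⟶? σ₁) (𝒟 n)))
    ≡ sum (map (λ τ₁ → t n σ τ₁ π) (filter (λ τ₁ → (τ *) ⟶? (τ₁ *)) (𝒟 n)))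
-- For words of length 2 * suc n the parameter `P`, two less than that length, is 2 * n.
theorem3p1 (suc n) _ σ τ π dσ dτ _ = Count.lhs≡rhs (suc n) (n + (n + 0)) (cong suc (+-suc n (n + 0))) σ τ π dσ dτ
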